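{- The map from matroids to $\mathbb{Z}[t]$ assigning to each non-empty loopless matroid $\mathsf{M}$ its chain polynomial $f_{\Delta(\widehat{\mathcal{L}}(\mathsf{M}))}(t)$, and to each matroid that either has loops or is empty the zero polynomial, is a valuative invariant.
   Context: All matroids have finite ground sets contained in the positive integers; a matroid is non-empty if its ground set is. For a loopless matroid $\mathsf{M}$ on a non-empty set $E$, $\mathcal{L}(\mathsf{M})$ is its lattice of flats, $\widehat{\mathcal{L}}(\mathsf{M})=\mathcal{L}(\mathsf{M})\smallsetminus\{\varnothing,E\}$, and $\Delta(\widehat{\mathcal{L}}(\mathsf{M}))$ is the order complex of the poset $\widehat{\mathcal{L}}(\mathsf{M})$. For a simplicial complex $\Delta$ let $f_i=|\{F\in\Delta: |F|=i\}|$ for $i\ge0$ and let $d$ be the size of a largest face; the $f$-polynomial is $f_{\Delta}(t)=\sum_{i=0}^d f_i\,t^{d-i}$. Thus the $f_i$ count chains $\varnothing\subsetneq F_1\subsetneq\cdots\subsetneq F_i\subsetneq E$ of flats, and $f_{\Delta(\widehat{\mathcal{L}}(\mathsf{M}))}$ is called the chain polynomial of $\mathsf{M}$. The base polytope of a matroid $\mathsf{M}$ on $E$ with bases $\mathscr{B}$ is $\mathscr{P}(\mathsf{M})=\operatorname{conv}\{\sum_{i\in B}e_i : B\in\mathscr{B}\}\subseteq\mathbb{R}^E$, with indicator function $\mathbf{1}_{\mathscr{P}(\mathsf{M})}:\mathbb{R}^E\to\mathbb{Z}$. A map $f$ from matroids to an abelian group is a valuation if $\sum_{i}a_if(\mathsf{M}_i)=0$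 whenever $\mathsf{M}_1,\dots,\mathsf{M}_s$ are matroids on a common ground set and $a_i\in\mathbb{Z}$ satisfy $\sum_i a_i\mathbf{1}_{\mathscr{P}(\mathsf{M}_i)}=0$. (This is known to be equivalent to the inclusion–exclusion property under matroid subdivisions.) A valuative invariant is a valuation with $f(\mathsf{M})=f(\mathsf{N})$ whenever $\mathsf{M}\cong\mathsf{N}$. -}

module Defs where

open import Algebra.Bundles using (AbelianGroup; RawMonoid)
import Algebra.Definitions.RawMonoid as RawMonoidDefs
open import Data.Bool.Base using (true; false; if_then_else_)
open import Data.Fin.Base using (Fin; toℕ)
open import Data.Fin.Properties using (all?)
open import Data.Fin.Subset using
  (Subset; inside; outside; _∈_; _∉_; _⊆_; _∪_; _-_; ⁅_⁆; ∣_∣; ⊥; ⊤)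
open import Data.Fin.Subset.Properties using (_∈?_; _⊆?_; anySubset?)
open import Data.Integer.Base as ℤ using (ℤ; +_; -[1+_]; 0ℤ; 1ℤ)
import Data.Integer.Properties as ℤ
open import Data.List.Base as List
  using (List; []; _∷_; [_]; _++_; length; filter; foldr)
open import Data.List.Relation.Unary.All using (All)
open import Data.List.Relation.Unary.Linked using (Linked)
open import Data.Nat.Base as ℕ using (ℕ; zero; suc; _∸_; _⊔_)
import Data.Nat.Properties as ℕ
open import Data.Product.Base using (∃; ∃-syntax; _×_; _,_; proj₁; proj₂)
open import Data.Rational.Base as ℚ using (ℚ; 0ℚ; 1ℚ; ½)
import Data.Rational.Properties as ℚ
import Data.Rational.Solver as ℚ-Solver
open import Data.Sum.Base using (_⊎_)
open import Data.Vec.Base as Vec using ([]; _∷_)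
open import Data.Vec.Properties using (≡-dec)
import Data.Bool.Properties as Bool
open import Function.Bundles using (_↔_; _⇔_; module Inverse)
open import Level using (0ℓ) renaming (_⊔_ to _⊔ˡ_)
open import Relation.Binary.Core using (Rel)
import Relation.Binary.Definitions as Binary
open import Relation.Binary.PropositionalEquality hiding ([_])
open import Relation.Nullary using (Dec; does; ¬_; ¬?; _×-dec_; _⊎-dec_; _→-dec_)
open import Relation.Unary using (Pred; Decidable)

------------------------------------------------------------------------
-- Real numbers: Cauchy sequences of rationals, with equality and order
-- up to arbitrarily small ε.

record ℝ : Set where
  field
    seq    : ℕ → ℚ
    cauchy : ∀ {ε} → 0ℚ ℚ.< ε → ∃[ N ] ∀ m n → N ℕ.≤ m → N ℕ.≤ n →
             ℚ.∣ seq m ℚ.- seq n ∣ ℚ.< ε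

open ℝ

infix 4 _≈ℝ_ _≤ℝ_

_≈ℝ_ : Rel ℝ 0ℓ
x ≈ℝ y = ∀ {ε} → 0ℚ ℚ.< ε → ∃[ N ] ∀ n → N ℕ.≤ n →
         ℚ.∣ seq x n ℚ.- seq y n ∣ ℚ.< ε

_≤ℝ_ : Rel ℝ 0ℓ
x ≤ℝ y = ∀ {ε} → 0ℚ ℚ.< ε → ∃[ N ] ∀ n → N ℕ.≤ n →
         seq x n ℚ.< seq y n ℚ.+ ε

fromℚ : ℚ → ℝ
fromℚ q .seq _ = q
fromℚ q .cauchy {ε} ε>0 = 0 , λ _ _ _ _ →
  subst (ℚ._< ε) (sym (cong ℚ.∣_∣ (ℚ.+-inverseʳ q))) ε>0

0ℝ 1ℝ : ℝ
0ℝ = fromℚ 0ℚ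
1ℝ = fromℚ 1ℚ

private
  halve : ∀ {ε} → 0ℚ ℚ.< ε → 0ℚ ℚ.< ½ ℚ.* ε
  halve {ε} ε>0 = subst (ℚ._< ½ ℚ.* ε) (ℚ.*-zeroʳ ½) (ℚ.*-monoʳ-<-pos ½ ε>0)

  -- Beyond some index, a Cauchy sequence is bounded by a positive constant.
  eventuallyBounded : (x : ℝ) → ∃[ K ] (0ℚ ℚ.< K) × ∃[ N ]
    ∀ n → N ℕ.≤ n → ℚ.∣ seq x n ∣ ℚ.< K
  eventuallyBounded x with cauchy x {1ℚ} (ℚ.positive⁻¹ 1ℚ)
  ... | N , c = 1ℚ ℚ.+ ℚ.∣ seq x N ∣
      , ℚ.+-mono-<-≤ (ℚ.positive⁻¹ 1ℚ) (ℚ.0≤∣p∣ (seq x N))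
      , N
      , λ n N≤n → begin-strict
          ℚ.∣ seq x n ∣
            ≡⟨ cong ℚ.∣_∣ (solve 2 (λ a b → a := (a :- b) :+ b) refl (seq x n) (seq x N)) ⟩
          ℚ.∣ (seq x n ℚ.- seq x N) ℚ.+ seq x N ∣
            ≤⟨ ℚ.∣p+q∣≤∣p∣+∣q∣ (seq x n ℚ.- seq x N) (seq x N) ⟩
          ℚ.∣ seq x n ℚ.- seq x N ∣ ℚ.+ ℚ.∣ seq x N ∣
            <⟨ ℚ.+-mono-<-≤ (c n N N≤n ℕ.≤-refl) (ℚ.≤-refl {ℚ.∣ seq x N ∣}) ⟩
          1ℚ ℚ.+ ℚ.∣ seq x N ∣ ∎
    where
    open ℚ.≤-Reasoning
    open ℚ-Solver.+-*-Solver

  *-difference : ∀ a b c d →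
    a ℚ.* b ℚ.- c ℚ.* d ≡ a ℚ.* (b ℚ.- d) ℚ.+ d ℚ.* (a ℚ.- c)
  *-difference = solve 4
    (λ a b c d → a :* b :- c :* d := a :* (b :- d) :+ d :* (a :- c)) refl
    where open ℚ-Solver.+-*-Solver

  divide : ∀ {B ε} → 0ℚ ℚ.< B → 0ℚ ℚ.< ε → ∃[ δ ] 0ℚ ℚ.< δ × B ℚ.* δ ≡ ε
  divide {B} {ε} B>0 ε>0 = ℚ.1/ B ℚ.* ε , δ>0 , Bδ≡ε
    where
    instance
      posB : ℚ.Positive B
      posB = ℚ.positive B>0
      nzB : ℚ.NonZero B
      nzB = ℚ.pos⇒nonZero B

    δ>0 : 0ℚ ℚ.< ℚ.1/ B ℚ.* ε
    δ>0 = ℚ.positive⁻¹ _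
      {{ℚ.pos*pos⇒pos (ℚ.1/ B) {{ℚ.1/pos⇒pos B}} ε {{ℚ.positive ε>0}}}}

    Bδ≡ε : B ℚ.* (ℚ.1/ B ℚ.* ε) ≡ ε
    Bδ≡ε = trans (sym (ℚ.*-assoc B (ℚ.1/ B) ε))
             (trans (cong (ℚ._* ε) (ℚ.*-inverseʳ B)) (ℚ.*-identityˡ ε))

  *-bound : ∀ {C δ} → 0ℚ ℚ.< C → ∀ p q →
            ℚ.∣ p ∣ ℚ.< C → ℚ.∣ q ∣ ℚ.< δ → ℚ.∣ p ℚ.* q ∣ ℚ.< C ℚ.* δ
  *-bound {C} {δ} C>0 p q p<C q<δ =
    subst (ℚ._< C ℚ.* δ) (sym (ℚ.∣p*q∣≡∣p∣*∣q∣ p q))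
      (ℚ.≤-<-trans
        (ℚ.*-monoʳ-≤-nonNeg ℚ.∣ q ∣ {{ℚ.∣-∣-nonNeg q}} (ℚ.<⇒≤ p<C))
        (ℚ.*-monoʳ-<-pos C {{ℚ.positive C>0}} q<δ))

  *-close : ∀ {K L δ} → 0ℚ ℚ.< K → 0ℚ ℚ.< L → ∀ a b c d →
            ℚ.∣ a ∣ ℚ.< K → ℚ.∣ d ∣ ℚ.< L →
            ℚ.∣ a ℚ.- c ∣ ℚ.< δ → ℚ.∣ b ℚ.- d ∣ ℚ.< δ →
            ℚ.∣ a ℚ.* b ℚ.- c ℚ.* d ∣ ℚ.< (K ℚ.+ L) ℚ.* δ
  *-close {K} {L} {δ} K>0 L>0 a b c d a<K d<L ac<δ bd<δ = begin-strict
    ℚ.∣ a ℚ.* b ℚ.- c ℚ.* d ∣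
      ≡⟨ cong ℚ.∣_∣ (*-difference a b c d) ⟩
    ℚ.∣ a ℚ.* (b ℚ.- d) ℚ.+ d ℚ.* (a ℚ.- c) ∣
      ≤⟨ ℚ.∣p+q∣≤∣p∣+∣q∣ (a ℚ.* (b ℚ.- d)) (d ℚ.* (a ℚ.- c)) ⟩
    ℚ.∣ a ℚ.* (b ℚ.- d) ∣ ℚ.+ ℚ.∣ d ℚ.* (a ℚ.- c) ∣
      <⟨ ℚ.+-mono-< (*-bound K>0 a (b ℚ.- d) a<K bd<δ) (*-bound L>0 d (a ℚ.- c) d<L ac<δ) ⟩
    K ℚ.* δ ℚ.+ L ℚ.* δ
      ≡⟨ ℚ.*-distribʳ-+ δ K L ⟨
    (K ℚ.+ L) ℚ.* δ ∎
    where open ℚ.≤-Reasoning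

infixl 6 _+ℝ_
infixl 7 _*ℝ_

_+ℝ_ : ℝ → ℝ → ℝ
(x +ℝ y) .seq n = seq x n ℚ.+ seq y n
(x +ℝ y) .cauchy {ε} ε>0 with cauchy x (halve ε>0) | cauchy y (halve ε>0)
... | N₁ , c₁ | N₂ , c₂ = N₁ ⊔ N₂ , λ m n N≤m N≤n → begin-strict
    ℚ.∣ (seq x m ℚ.+ seq y m) ℚ.- (seq x n ℚ.+ seq y n) ∣
      ≡⟨ cong ℚ.∣_∣ (solve 4 (λ a b c d → (a :+ b) :- (c :+ d) := (a :- c) :+ (b :- d))
           refl (seq x m) (seq y m) (seq x n) (seq y n)) ⟩
    ℚ.∣ (seq x m ℚ.- seq x n) ℚ.+ (seq y m ℚ.- seq y n) ∣
      ≤⟨ ℚ.∣p+q∣≤∣p∣+∣q∣ (seq x m ℚ.- seq x n) (seq y m ℚ.- seq y n) ⟩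
    ℚ.∣ seq x m ℚ.- seq x n ∣ ℚ.+ ℚ.∣ seq y m ℚ.- seq y n ∣
      <⟨ ℚ.+-mono-<
           (c₁ m n (ℕ.m⊔n≤o⇒m≤o N₁ N₂ N≤m) (ℕ.m⊔n≤o⇒m≤o N₁ N₂ N≤n))
           (c₂ m n (ℕ.m⊔n≤o⇒n≤o N₁ N₂ N≤m) (ℕ.m⊔n≤o⇒n≤o N₁ N₂ N≤n)) ⟩
    ½ ℚ.* ε ℚ.+ ½ ℚ.* ε
      ≡⟨ solve 1 (λ e → con ½ :* e :+ con ½ :* e := e) refl ε ⟩
    ε ∎
  where
  open ℚ.≤-Reasoning
  open ℚ-Solver.+-*-Solver

_*ℝ_ : ℝ → ℝ → ℝ
(x *ℝ y) .seq n = seq x n ℚ.* seq y n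
(x *ℝ y) .cauchy {ε} ε>0 =
  let K , K>0 , N₁ , b₁  = eventuallyBounded x
      L , L>0 , N₂ , b₂  = eventuallyBounded y
      δ , δ>0 , Bδ≡ε     = divide (ℚ.+-mono-< K>0 L>0) ε>0
      N₃ , c₁            = cauchy x δ>0
      N₄ , c₂            = cauchy y δ>0
  in (N₁ ⊔ N₂) ⊔ (N₃ ⊔ N₄) , λ m n N≤m N≤n →
    let m≥₁₂ = ℕ.m⊔n≤o⇒m≤o (N₁ ⊔ N₂) (N₃ ⊔ N₄) N≤m
        n≥₁₂ = ℕ.m⊔n≤o⇒m≤o (N₁ ⊔ N₂) (N₃ ⊔ N₄) N≤n
        m≥₃₄ = ℕ.m⊔n≤o⇒n≤o (N₁ ⊔ N₂) (N₃ ⊔ N₄) N≤m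
        n≥₃₄ = ℕ.m⊔n≤o⇒n≤o (N₁ ⊔ N₂) (N₃ ⊔ N₄) N≤n
    in subst (ℚ.∣ seq x m ℚ.* seq y m ℚ.- seq x n ℚ.* seq y n ∣ ℚ.<_) Bδ≡ε
         (*-close K>0 L>0 (seq x m) (seq y m) (seq x n) (seq y n)
           (b₁ m (ℕ.m⊔n≤o⇒m≤o N₁ N₂ m≥₁₂))
           (b₂ n (ℕ.m⊔n≤o⇒n≤o N₁ N₂ n≥₁₂))
           (c₁ m n (ℕ.m⊔n≤o⇒m≤o N₃ N₄ m≥₃₄) (ℕ.m⊔n≤o⇒m≤o N₃ N₄ n≥₃₄))
           (c₂ m n (ℕ.m⊔n≤o⇒n≤o N₃ N₄ m≥₃₄) (ℕ.m⊔n≤o⇒n≤o N₃ N₄ n≥₃₄)))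

+ℝ-rawMonoid : RawMonoid 0ℓ 0ℓ
+ℝ-rawMonoid = record { Carrier = ℝ ; _≈_ = _≈ℝ_ ; _∙_ = _+ℝ_ ; ε = 0ℝ }

open RawMonoidDefs +ℝ-rawMonoid using () renaming (sum to sumℝ)

Point : ℕ → Set
Point n = Fin n → ℝ

-- conv S, as the set of all finite convex combinations of points of S.
conv : ∀ {n} → Pred (Point n) 0ℓ → Pred (Point n) 0ℓ
conv {n} S x = ∃[ k ] ∃ λ (v : Fin k → Point n) → ∃ λ (c : Fin k → ℝ) →
  (∀ j → S (v j)) ×
  (∀ j → 0ℝ ≤ℝ c j) ×
  sumℝ c ≈ℝ 1ℝ ×
  (∀ e → x e ≈ℝ sumℝ (λ j → c j *ℝ v j e))

-- The sum of the standard basis vectors indexed by B.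
indicatorVector : ∀ {n} → Subset n → Point n
indicatorVector B e = if Vec.lookup B e then 1ℝ else 0ℝ

------------------------------------------------------------------------
-- Matroids

subsets : ∀ n → List (Subset n)
subsets zero    = [ [] ]
subsets (suc n) = List.map (outside ∷_) (subsets n) ++ List.map (inside ∷_) (subsets n)

-- A finite set of positive integers, listed in increasing order; the
-- increasing list makes each set have one representation only.
record GroundSet : Set where
  field
    elements   : List ℕ
    increasing : Linked ℕ._<_ elements
    positive   : All (0 ℕ.<_) elements

  size : ℕ
  size = length elements

open GroundSet public using (size)

-- The element of E in position i is represented by i : Fin (size E), and
-- subsets of E, or coordinates of ℝ^E, are indexed accordingly.
record Matroid (E : GroundSet) : Set₁ where
  field
    IsBasis  : Pred (Subset (size E)) 0ℓ
    isBasis? : Decidable IsBasis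
    nonempty : ∃ IsBasis
    exchange : ∀ {A B} → IsBasis A → IsBasis B →
               ∀ {a} → a ∈ A → a ∉ B →
               ∃[ b ] b ∈ B × b ∉ A × IsBasis ((A - a) ∪ ⁅ b ⁆)

module _ {E : GroundSet} (M : Matroid E) where
  open Matroid M

  Independent : Pred (Subset (size E)) 0ℓ
  Independent I = ∃[ B ] IsBasis B × I ⊆ B

  independent? : Decidable Independent
  independent? I = anySubset? λ B → isBasis? B ×-dec I ⊆? B

  rank : Subset (size E) → ℕ
  rank S = foldr _⊔_ 0
    (List.map ∣_∣ (filter (λ I → independent? I ×-dec I ⊆? S) (subsets (size E))))

  Flat : Pred (Subset (size E)) 0ℓ
  Flat F = ∀ e → e ∉ F → rank F ℕ.< rank (F ∪ ⁅ e ⁆)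

  flat? : Decidable Flat
  flat? F = all? λ e → ¬? (e ∈? F) →-dec (rank F ℕ.<? rank (F ∪ ⁅ e ⁆))

  ProperFlat : Pred (Subset (size E)) 0ℓ
  ProperFlat F = Flat F × F ≢ ⊥ × F ≢ ⊤

  properFlat? : Decidable ProperFlat
  properFlat? F = flat? F ×-dec ¬? (≡-dec Bool._≟_ F ⊥) ×-dec ¬? (≡-dec Bool._≟_ F ⊤)

  Loop : Pred (Fin (size E)) 0ℓ
  Loop e = ¬ Independent ⁅ e ⁆

  Loopless : Set
  Loopless = ∀ e → ¬ Loop e

  loopless? : Dec Loopless
  loopless? = all? λ e → ¬? (¬? (independent? ⁅ e ⁆))

  basePolytope : Pred (Point (size E)) 0ℓ
  basePolytope = conv (λ v → ∃[ B ] IsBasis B × v ≡ indicatorVector B)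

record _≅_ {E E′ : GroundSet} (M : Matroid E) (N : Matroid E′) : Set where
  private
    module M = Matroid M
    module N = Matroid N
  field
    bijection : Fin (size E) ↔ Fin (size E′)

  image : Subset (size E) → Subset (size E′)
  image B = Vec.tabulate λ e → Vec.lookup B (Inverse.from bijection e)

  field
    bases : ∀ B → M.IsBasis B ⇔ N.IsBasis (image B)

------------------------------------------------------------------------
-- Valuative invariants

-- The value at x of the indicator function of P, given a decision of
-- whether x belongs to P.
𝟙 : ∀ {A : Set} → Dec A → ℤ
𝟙 A? = if does A? then 1ℤ else 0ℤ

open RawMonoidDefs ℤ.+-0-rawMonoid using () renaming (sum to sumℤ)

module _ {c ℓ} (A : AbelianGroup c ℓ) where
  open AbelianGroup A
  open RawMonoidDefs rawMonoid using (sum) renaming (_×_ to _×ᴺ_)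

  infixr 8 _×ᶻ_

  _×ᶻ_ : ℤ → Carrier → Carrier
  (+ n)    ×ᶻ g = n ×ᴺ g
  -[1+ n ] ×ᶻ g = (suc n ×ᴺ g) ⁻¹

  -- Membership of a real point in a polytope cannot be decided in general,
  -- so the linear relation among the indicator functions is asked for at
  -- every point x and for all decisions of whether x lies in the polytopes.
  -- Under excluded middle each membership has a decision, with a determined
  -- value of 𝟙, and this is the pointwise vanishing of Σ aᵢ 1_{P(Mᵢ)}.
  IsValuation : (∀ {E} → Matroid E → Carrier) → Set (Level.suc 0ℓ ⊔ˡ ℓ)
  IsValuation f =
    ∀ (E : GroundSet) (s : ℕ) (M : Fin s → Matroid E) (a : Fin s → ℤ) →
    (∀ (x : Point (size E)) (x∈P? : ∀ i → Dec (basePolytope (M i) x)) →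
       sumℤ (λ i → a i ℤ.* 𝟙 (x∈P? i)) ≡ 0ℤ) →
    sum (λ i → a i ×ᶻ f (M i)) ≈ ε

  IsInvariant : (∀ {E} → Matroid E → Carrier) → Set (Level.suc 0ℓ ⊔ˡ ℓ)
  IsInvariant f =
    ∀ {E E′} (M : Matroid E) (N : Matroid E′) → M ≅ N → f M ≈ f N

  IsValuativeInvariant : (∀ {E} → Matroid E → Carrier) → Set (Level.suc 0ℓ ⊔ˡ ℓ)
  IsValuativeInvariant f = IsValuation f × IsInvariant f

------------------------------------------------------------------------
-- ℤ[t]: lists of coefficients, constant term first, up to trailing zeros

ℤ[t] : Set
ℤ[t] = List ℤ

coeff : ℤ[t] → ℕ → ℤ
coeff []      _       = 0ℤ
coeff (a ∷ p) zero    = a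
coeff (a ∷ p) (suc k) = coeff p k

infix 4 _≈ₚ_

record _≈ₚ_ (p q : ℤ[t]) : Set where
  constructor coeffwise
  field coeff-≡ : ∀ k → coeff p k ≡ coeff q k

open _≈ₚ_ public

infixl 6 _+ₚ_

_+ₚ_ : ℤ[t] → ℤ[t] → ℤ[t]
[]      +ₚ q       = q
(a ∷ p) +ₚ []      = a ∷ p
(a ∷ p) +ₚ (b ∷ q) = (a ℤ.+ b) ∷ (p +ₚ q)

-ₚ_ : ℤ[t] → ℤ[t]
-ₚ_ = List.map (ℤ.-_)

-- c t^k
monomial : ℤ → ℕ → ℤ[t]
monomial c k = List.replicate k 0ℤ ++ [ c ]

coeff-+ₚ : ∀ p q k → coeff (p +ₚ q) k ≡ coeff p k ℤ.+ coeff q k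
coeff-+ₚ []      q       k       = sym (ℤ.+-identityˡ (coeff q k))
coeff-+ₚ (a ∷ p) []      k       = sym (ℤ.+-identityʳ (coeff (a ∷ p) k))
coeff-+ₚ (a ∷ p) (b ∷ q) zero    = refl
coeff-+ₚ (a ∷ p) (b ∷ q) (suc k) = coeff-+ₚ p q k

coeff--ₚ : ∀ p k → coeff (-ₚ p) k ≡ ℤ.- coeff p k
coeff--ₚ []      k       = refl
coeff--ₚ (a ∷ p) zero    = refl
coeff--ₚ (a ∷ p) (suc k) = coeff--ₚ p k

ℤ[t]-abelianGroup : AbelianGroup 0ℓ 0ℓ
ℤ[t]-abelianGroup = record
  { Carrier = ℤ[t]
  ; _≈_     = _≈ₚ_
  ; _∙_     = _+ₚ_
  ; ε       = []
  ; _⁻¹     = -ₚ_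
  ; isAbelianGroup = record
    { isGroup = record
      { isMonoid = record
        { isSemigroup = record
          { isMagma = record
            { isEquivalence = record
              { refl  = coeffwise λ _ → refl
              ; sym   = λ e → coeffwise λ k → sym (coeff-≡ e k)
              ; trans = λ e e′ → coeffwise λ k → trans (coeff-≡ e k) (coeff-≡ e′ k)
              }
            ; ∙-cong = λ {p} {p′} {q} {q′} e e′ → coeffwise λ k → begin
                coeff (p +ₚ q) k            ≡⟨ coeff-+ₚ p q k ⟩
                coeff p k ℤ.+ coeff q k     ≡⟨ cong₂ ℤ._+_ (coeff-≡ e k) (coeff-≡ e′ k) ⟩
                coeff p′ k ℤ.+ coeff q′ k   ≡⟨ coeff-+ₚ p′ q′ k ⟨
                coeff (p′ +ₚ q′) k          ∎
            }
          ; assoc = λ p q r → coeffwise λ k → begin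
              coeff ((p +ₚ q) +ₚ r) k
                ≡⟨ coeff-+ₚ (p +ₚ q) r k ⟩
              coeff (p +ₚ q) k ℤ.+ coeff r k
                ≡⟨ cong (ℤ._+ coeff r k) (coeff-+ₚ p q k) ⟩
              (coeff p k ℤ.+ coeff q k) ℤ.+ coeff r k
                ≡⟨ ℤ.+-assoc (coeff p k) (coeff q k) (coeff r k) ⟩
              coeff p k ℤ.+ (coeff q k ℤ.+ coeff r k)
                ≡⟨ cong (λ z → coeff p k ℤ.+ z) (coeff-+ₚ q r k) ⟨
              coeff p k ℤ.+ coeff (q +ₚ r) k
                ≡⟨ coeff-+ₚ p (q +ₚ r) k ⟨
              coeff (p +ₚ (q +ₚ r)) k ∎
          }
        ; identity = (λ _ → coeffwise λ _ → refl)
                   , (λ p → coeffwise λ k →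
                       trans (coeff-+ₚ p [] k) (ℤ.+-identityʳ (coeff p k)))
        }
      ; inverse = (λ p → coeffwise λ k → begin
                    coeff ((-ₚ p) +ₚ p) k             ≡⟨ coeff-+ₚ (-ₚ p) p k ⟩
                    coeff (-ₚ p) k ℤ.+ coeff p k      ≡⟨ cong (ℤ._+ coeff p k) (coeff--ₚ p k) ⟩
                    ℤ.- coeff p k ℤ.+ coeff p k       ≡⟨ ℤ.+-inverseˡ (coeff p k) ⟩
                    0ℤ                                ∎)
                , (λ p → coeffwise λ k → begin
                    coeff (p +ₚ (-ₚ p)) k             ≡⟨ coeff-+ₚ p (-ₚ p) k ⟩
                    coeff p k ℤ.+ coeff (-ₚ p) k      ≡⟨ cong (λ z → coeff p k ℤ.+ z) (coeff--ₚ p k) ⟩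
                    coeff p k ℤ.+ ℤ.- coeff p k       ≡⟨ ℤ.+-inverseʳ (coeff p k) ⟩
                    0ℤ                                ∎)
      ; ⁻¹-cong = λ {p} {q} e → coeffwise λ k →
          trans (coeff--ₚ p k) (trans (cong (ℤ.-_) (coeff-≡ e k)) (sym (coeff--ₚ q k)))
      }
    ; comm = λ p q → coeffwise λ k →
        trans (coeff-+ₚ p q k)
          (trans (ℤ.+-comm (coeff p k) (coeff q k)) (sym (coeff-+ₚ q p k)))
    }
  }
  where open ≡-Reasoning

------------------------------------------------------------------------
-- Simplicial complexes and the chain polynomial

-- The vertices are those i : Fin N for which ⁅ i ⁆ is a face.
record SimplicialComplex (N : ℕ) : Set₁ where
  field
    Face        : Pred (Subset N) 0ℓ
    face?       : Decidable Face
    empty-face  : Face ⊥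
    down-closed : ∀ {F G} → F ⊆ G → Face G → Face F

module _ {N : ℕ} (Δ : SimplicialComplex N) where
  open SimplicialComplex Δ

  faceCount : ℕ → ℕ
  faceCount i = length (filter (λ F → face? F ×-dec (∣ F ∣ ℕ.≟ i)) (subsets N))

  largestFaceSize : ℕ
  largestFaceSize = foldr _⊔_ 0 (List.map ∣_∣ (filter face? (subsets N)))

  fPolynomial : ℤ[t]
  fPolynomial = sum {suc d} λ i → monomial (+ faceCount (toℕ i)) (d ∸ toℕ i)
    where
    open RawMonoidDefs (AbelianGroup.rawMonoid ℤ[t]-abelianGroup) using (sum)
    d = largestFaceSize

-- The order complex of the poset {i | P i} ordered by _≼_.
module _ {N : ℕ} {P : Pred (Fin N) 0ℓ} (P? : Decidable P)
         {_≼_ : Rel (Fin N) 0ℓ} (_≼?_ : Binary.Decidable _≼_) where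

  orderComplex : SimplicialComplex N
  orderComplex = record
    { Face  = λ F → (∀ i → i ∈ F → P i) ×
                    (∀ i → i ∈ F → ∀ j → j ∈ F → i ≼ j ⊎ j ≼ i)
    ; face? = λ F → (all? λ i → (i ∈? F) →-dec P? i) ×-dec
                    (all? λ i → (i ∈? F) →-dec
                      (all? λ j → (j ∈? F) →-dec ((i ≼? j) ⊎-dec (j ≼? i))))
    ; empty-face  = (λ _ i∈⊥ → contradiction i∈⊥ ∉⊥)
                  , (λ _ i∈⊥ → contradiction i∈⊥ ∉⊥)
    ; down-closed = λ F⊆G (inP , chain) →
        (λ i i∈F → inP i (F⊆G i∈F)) ,
        (λ i i∈F j j∈F → chain i (F⊆G i∈F) j (F⊆G j∈F))
    }
    where
    open import Data.Fin.Subset.Properties using (∉⊥)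
    open import Relation.Nullary using (contradiction)

module _ {E : GroundSet} (M : Matroid E) where

  nthSubset : Fin (length (subsets (size E))) → Subset (size E)
  nthSubset = List.lookup (subsets (size E))

  -- The order complex of the poset of flats other than ∅ and E. Its
  -- potential vertices are (positions in the list of) all subsets of E.
  flatComplex : SimplicialComplex (length (subsets (size E)))
  flatComplex = orderComplex
    (λ i → properFlat? M (nthSubset i))
    (λ i j → nthSubset i ⊆? nthSubset j)

  chainPolynomial : ℤ[t]
  chainPolynomial =
    if does (¬? (size E ℕ.≟ 0) ×-dec loopless? M) then fPolynomial flatComplex else []

-- By Edmonds' theorem a point x lies in the base polytope of M exactly if
-- x(S) ≤ rk S for all S, with equality for S = E. An integral submodular
-- upper bound f and an integral supermodular lower bound g with g ≤ f admit
-- an integral point between them, found one coordinate at a time: the range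
-- of the first coordinate is an interval with integral endpoints, and fixing
-- that coordinate leaves a pair of the same kind. For the same reason the
-- signed count of the points of a suitable finite grid lying between g and f
-- is 1 if g ≤ f and 0 otherwise. This plays the role of the Euler
-- characteristic, and expresses the indicator of g ≤ f through finitely many
-- point evaluations of the indicator function of the polytope.
--
-- For a chain of sets S with numbers d, g(A) = max (0, max {d | S ⊆ A}) is
-- supermodular. With f(A) = D rk A - |A|, where D = |E| + 1, it follows that
-- requiring d ≤ f(A) for all A ⊇ S, simultaneously for the members S of a
-- chain, is a valuative condition. In a loopless matroid, S ≠ ∅ is a flat of
-- rank ρ exactly if this holds for d = Dρ - |S| but not for d + 1. Hence
-- counting chains of flats is valuative, and the degree of the chain
-- polynomial is governed by the rank.

module Submission where

open import Defs

open import Algebra.Bundles using (AbelianGroup; CommutativeRing)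
import Algebra.Definitions.RawMonoid as RawMonoidDefs
import Algebra.Properties.Semiring.Sum as SemiringSum
open import Data.Bool.Base using (Bool; true; false; if_then_else_)
import Data.Bool.Properties as Bool
open import Data.Fin.Base using (Fin; zero; suc; toℕ; fromℕ<)
open import Data.Fin.Permutation using (↔⇒≡)
open import Data.Fin.Properties using
  (toℕ-fromℕ<; toℕ-injective; toℕ<n; any?; all?; injective⇒≤; suc-injective; fromℕ<-injective)
open import Data.Fin.Subset using
  (Subset; inside; outside; _∈_; _∉_; _⊆_; _∪_; _∩_; _-_; ∁; ∣_∣; ⁅_⁆; ⊥; ⊤)
open import Data.Fin.Subset.Properties
open import Data.Integer.Base as ℤ using (ℤ; +_; -[1+_]; 0ℤ; 1ℤ; _⊓_)
import Data.Integer.Properties as ℤ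
import Data.Integer.Solver as ℤ-Solver
open import Data.List.Base as List using (List; []; _∷_; foldr; filter; length)
import Data.List.Membership.Propositional as List
open import Data.List.Membership.Propositional.Properties using
  (∈-++⁺ˡ; ∈-++⁺ʳ; ∈-map⁺; ∈-map⁻; ∈-filter⁺; ∈-filter⁻; ∈-lookup)
open import Data.List.Membership.Propositional.Properties.WithK using (unique∧set⇒bag)
open import Data.List.Relation.Binary.BagAndSetEquality using (∼bag⇒↭)
open import Data.List.Relation.Binary.Permutation.Propositional as ↭ using (_↭_)
open import Data.List.Relation.Unary.All as All using (All; []; _∷_)
import Data.List.Relation.Unary.All.Properties as All
open import Data.List.Relation.Unary.AllPairs using ([]; _∷_)
open import Data.List.Relation.Unary.Any as Any using (here; there)
open import Data.List.Relation.Unary.Any.Properties using (lookup-index)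
open import Data.List.Relation.Unary.Unique.Propositional using (Unique)
import Data.List.Relation.Unary.Unique.Propositional.Properties as Unique
open import Data.Nat.Base as ℕ using (ℕ; zero; suc; z≤n; s≤s; _+_; _∸_; _⊔_; _≤_; _<_)
import Data.Nat.Properties as ℕ
open import Data.Product.Base using (∃; ∃-syntax; _×_; _,_; proj₁; proj₂)
open import Data.Rational.Base as ℚ using (ℚ; 0ℚ; 1ℚ; toℚᵘ)
import Data.Rational.Properties as ℚ
import Data.Rational.Solver as ℚ-Solver
open import Data.Rational.Unnormalised.Base as ℚᵘ using (mkℚᵘ; *≡*; *≤*)
import Data.Rational.Unnormalised.Properties as ℚᵘ
open import Data.Sum.Base as Sum using (_⊎_; inj₁; inj₂; [_,_]′)
open import Data.Vec.Base as Vec using (Vec; []; _∷_; here; there; lookup; tabulate)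
open import Data.Vec.Properties using
  (≡-dec; ∷-injectiveʳ; lookup-map; lookup-zipWith; lookup∘tabulate; tabulate∘lookup;
   tabulate-cong; []=⇒lookup; lookup⇒[]=)
open import Function.Base using (_∘_; case_of_)
open import Function.Bundles using (_↔_; mk↔ₛ′; mk⇔; module Inverse; module Equivalence)
open import Function.Properties.Inverse using (↔-sym)
open import Level using (0ℓ)
open import Relation.Binary.Definitions using (tri<; tri≈; tri>)
open import Relation.Binary.PropositionalEquality
open import Relation.Nullary using
  (Dec; yes; no; does; ¬_; ¬?; _×-dec_; _⊎-dec_; _→-dec_; contradiction; decidable-stable; map′)
open import Relation.Unary using (Pred; Decidable)

open ℝ
open RawMonoidDefs +ℝ-rawMonoid using () renaming (sum to sumℝ)
open RawMonoidDefs ℤ.+-0-rawMonoid using () renaming (sum to sumℤ)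
open RawMonoidDefs ℚ.+-0-rawMonoid using () renaming (sum to sumℚ)
open RawMonoidDefs (AbelianGroup.rawMonoid ℤ[t]-abelianGroup) using ()
  renaming (sum to sumₚ; _×_ to _×ₚ_)

private
  module Σℤ = SemiringSum (CommutativeRing.semiring ℤ.+-*-commutativeRing)
  module Σℚ = SemiringSum (CommutativeRing.semiring ℚ.+-*-commutativeRing)

  variable
    k m n : ℕ
    A B : Set

-- The hypothesis of a valuation yields an equation only at points whose membership in every
-- polytope is decided. It is applied only at points `y / q` with `y` integral, where Edmonds'
-- inequalities are finitely many comparisons of integers. One half of his theorem is then a limit
-- argument over Cauchy sequences; the other is integer decomposition, which writes `y` as a sum of
-- `q` bases. An interval from a to b with integral ends contains b - a + 1 integers and b - a odd
-- multiples of ½, so its signed count is 1. Slicing at multiples of ½ costs a factor 2 per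
-- coordinate if everything is to stay integral, whence the powers of 2. The term - |A| in D rk A -
-- |A| merely translates the dilate of the base polytope by D, so that counting points below it
-- still evaluates the indicator function of the base polytope. It penalises a larger set of the
-- same rank, while one more unit of rank, worth D, outweighs every cardinality. The equation for S
-- = E comes from putting E itself into the chain, with the value f(E).

χ : Bool → ℤ
χ b = if b then 1ℤ else 0ℤ

-- Integers as rational numbers

ι : ℤ → ℚ
ι z = z ℚ./ 1

private
  toℚᵘ-ι : ∀ z → toℚᵘ (ι z) ℚᵘ.≃ mkℚᵘ z 0
  toℚᵘ-ι z = ℚ.toℚᵘ-fromℚᵘ (mkℚᵘ z 0)

ι-+ : ∀ a b → ι (a ℤ.+ b) ≡ ι a ℚ.+ ι b
ι-+ a b = ℚ.toℚᵘ-injective (ℚᵘ.≃-trans (toℚᵘ-ι (a ℤ.+ b)) (ℚᵘ.≃-trans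
  (*≡* (solve 2 (λ a b → (a :+ b) :* con 1ℤ := (a :* con 1ℤ :+ b :* con 1ℤ) :* con 1ℤ) refl a b))
  (ℚᵘ.≃-sym (ℚᵘ.≃-trans (ℚ.toℚᵘ-homo-+ (ι a) (ι b)) (ℚᵘ.+-cong (toℚᵘ-ι a) (toℚᵘ-ι b))))))
  where open ℤ-Solver.+-*-Solver

ι-* : ∀ a b → ι (a ℤ.* b) ≡ ι a ℚ.* ι b
ι-* a b = ℚ.toℚᵘ-injective (ℚᵘ.≃-trans (toℚᵘ-ι (a ℤ.* b))
  (ℚᵘ.≃-sym (ℚᵘ.≃-trans (ℚ.toℚᵘ-homo-* (ι a) (ι b)) (ℚᵘ.*-cong (toℚᵘ-ι a) (toℚᵘ-ι b)))))

ι-mono-≤ : ∀ {a b} → a ℤ.≤ b → ι a ℚ.≤ ι b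
ι-mono-≤ {a} {b} a≤b = ℚ.toℚᵘ-cancel-≤ (ℚᵘ.≤-trans (ℚᵘ.≤-reflexive (toℚᵘ-ι a))
  (ℚᵘ.≤-trans (*≤* (ℤ.*-monoʳ-≤-nonNeg 1ℤ a≤b)) (ℚᵘ.≤-reflexive (ℚᵘ.≃-sym (toℚᵘ-ι b)))))

ι-cancel-≤ : ∀ {a b} → ι a ℚ.≤ ι b → a ℤ.≤ b
ι-cancel-≤ {a} {b} ιa≤ιb = lemma (ℚᵘ.≤-trans (ℚᵘ.≤-reflexive (ℚᵘ.≃-sym (toℚᵘ-ι a)))
    (ℚᵘ.≤-trans (ℚ.toℚᵘ-mono-≤ ιa≤ιb) (ℚᵘ.≤-reflexive (toℚᵘ-ι b))))
  where
  lemma : mkℚᵘ a 0 ℚᵘ.≤ mkℚᵘ b 0 → a ℤ.≤ b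
  lemma (*≤* p) = ℤ.*-cancelʳ-≤-pos a b 1ℤ p

ι-sum : (f : Fin n → ℤ) → ι (sumℤ f) ≡ sumℚ (ι ∘ f)
ι-sum {zero}  f = refl
ι-sum {suc n} f = trans (ι-+ (f zero) (sumℤ (f ∘ suc))) (cong (ι (f zero) ℚ.+_) (ι-sum (f ∘ suc)))

-- Inequalities between rational numbers

0≤q-p⇒p≤q : ∀ {e p q} → 0ℚ ℚ.≤ e → e ≡ q ℚ.- p → p ℚ.≤ q
0≤q-p⇒p≤q {e} {p} {q} 0≤e e≡ = subst₂ ℚ._≤_ (ℚ.+-identityˡ p)
  (trans (cong (ℚ._+ p) e≡) (solve 2 (λ p q → (q :- p) :+ p := q) refl p q))
  (ℚ.+-monoˡ-≤ p 0≤e)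
  where open ℚ-Solver.+-*-Solver

0≤q-p : ∀ {p q} → p ℚ.≤ q → 0ℚ ℚ.≤ q ℚ.- p
0≤q-p {p} {q} p≤q = subst (ℚ._≤ q ℚ.- p) (ℚ.+-inverseʳ p) (ℚ.+-monoˡ-≤ (ℚ.- p) p≤q)

0≤p*q : ∀ {p q} → 0ℚ ℚ.≤ p → 0ℚ ℚ.≤ q → 0ℚ ℚ.≤ p ℚ.* q
0≤p*q {p} {q} 0≤p 0≤q = subst (ℚ._≤ p ℚ.* q) (ℚ.*-zeroʳ p)
  (ℚ.*-monoˡ-≤-nonNeg p {{ℚ.nonNegative 0≤p}} 0≤q)

p≤∣p∣ : ∀ p → p ℚ.≤ ℚ.∣ p ∣
p≤∣p∣ p with ℚ.≤-total 0ℚ p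
... | inj₁ 0≤p = ℚ.≤-reflexive (sym (ℚ.0≤p⇒∣p∣≡p 0≤p))
... | inj₂ p≤0 = ℚ.≤-trans p≤0 (ℚ.0≤∣p∣ p)

w*d≤ε*∣w∣ : ∀ w {d ε} → ℚ.∣ d ∣ ℚ.≤ ε → w ℚ.* d ℚ.≤ ε ℚ.* ℚ.∣ w ∣
w*d≤ε*∣w∣ w {d} {ε} d≤ε = ℚ.≤-trans (p≤∣p∣ (w ℚ.* d)) (ℚ.≤-trans
  (ℚ.≤-reflexive (trans (ℚ.∣p*q∣≡∣p∣*∣q∣ w d) (ℚ.*-comm ℚ.∣ w ∣ ℚ.∣ d ∣)))
  (ℚ.*-monoʳ-≤-nonNeg ℚ.∣ w ∣ {{ℚ.∣-∣-nonNeg w}} d≤ε))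

sum-mono : {f g : Fin n → ℚ} → (∀ i → f i ℚ.≤ g i) → sumℚ f ℚ.≤ sumℚ g
sum-mono {zero}  f≤g = ℚ.≤-refl
sum-mono {suc n} f≤g = ℚ.+-mono-≤ (f≤g zero) (sum-mono (f≤g ∘ suc))

sum-nonneg : {f : Fin n → ℚ} → (∀ i → 0ℚ ℚ.≤ f i) → 0ℚ ℚ.≤ sumℚ f
sum-nonneg {zero}  0≤f = ℚ.≤-refl
sum-nonneg {suc n} 0≤f = ℚ.+-mono-≤ (0≤f zero) (sum-nonneg (0≤f ∘ suc))

-- If `b < a`, then `ε = (a - b) / (C + 1)` gives `b + ε C < a`. The added 1 keeps the denominator
-- positive when `C` is 0.
≤-limit : ∀ {a b C} → 0ℚ ℚ.≤ C → (∀ ε → 0ℚ ℚ.< ε → a ℚ.≤ b ℚ.+ ε ℚ.* C) → a ℚ.≤ b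
≤-limit {a} {b} {C} 0≤C approx with a ℚ.≤? b
... | yes a≤b = a≤b
... | no a≰b = contradiction refl (ℚ.<⇒≢ (ℚ.≤-<-trans (approx ε 0<ε) (begin-strict
    b ℚ.+ ε ℚ.* C             <⟨ ℚ.+-monoʳ-< b (ℚ.*-monoʳ-<-pos ε {{ℚ.positive 0<ε}} C<D) ⟩
    b ℚ.+ ε ℚ.* D             ≡⟨ cong (b ℚ.+_) (trans (ℚ.*-assoc (a ℚ.- b) (ℚ.1/ D) D)
                                   (trans (cong ((a ℚ.- b) ℚ.*_) (ℚ.*-inverseˡ D)) (ℚ.*-identityʳ (a ℚ.- b)))) ⟩
    b ℚ.+ (a ℚ.- b)           ≡⟨ solve 2 (λ a b → b :+ (a :- b) := a) refl a b ⟩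
    a                         ∎)))
  where
  open ℚ.≤-Reasoning
  open ℚ-Solver.+-*-Solver
  D = C ℚ.+ 1ℚ
  C<D : C ℚ.< D
  C<D = subst (ℚ._< D) (ℚ.+-identityʳ C) (ℚ.+-monoʳ-< C (ℚ.positive⁻¹ 1ℚ))
  instance
    D-positive : ℚ.Positive D
    D-positive = ℚ.positive (ℚ.≤-<-trans 0≤C C<D)
    D-nonZero : ℚ.NonZero D
    D-nonZero = ℚ.pos⇒nonZero D
  ε = (a ℚ.- b) ℚ.* ℚ.1/ D
  0<a-b : 0ℚ ℚ.< a ℚ.- b
  0<a-b = subst (ℚ._< a ℚ.- b) (ℚ.+-inverseʳ b) (ℚ.+-monoˡ-< (ℚ.- b) (ℚ.≰⇒> a≰b))
  0<ε : 0ℚ ℚ.< ε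
  0<ε = ℚ.positive⁻¹ ε {{ℚ.pos*pos⇒pos (a ℚ.- b) {{ℚ.positive 0<a-b}} (ℚ.1/ D) {{ℚ.1/pos⇒pos D}}}}

-- An ε-approximate convex combination p of points r j on which the linear
-- form w is at most m.
module _ {ε m : ℚ} (0<ε : 0ℚ ℚ.< ε) (w p : Fin n → ℚ) (c : Fin k → ℚ) (r : Fin k → Fin n → ℚ)
         (c-nonneg : ∀ j → 0ℚ ℚ.< c j ℚ.+ ε)
         (c-total : ℚ.∣ sumℚ c ℚ.- 1ℚ ∣ ℚ.< ε)
         (p-close : ∀ e → ℚ.∣ p e ℚ.- sumℚ (λ j → c j ℚ.* r j e) ∣ ℚ.< ε)
         (w≤m : ∀ j → sumℚ (λ e → w e ℚ.* r j e) ℚ.≤ m) where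
  private
    x : Fin n → ℚ
    x e = sumℚ (λ j → c j ℚ.* r j e)
    l : Fin k → ℚ
    l j = sumℚ (λ e → w e ℚ.* r j e)

    swap-sums : sumℚ (λ e → w e ℚ.* x e) ≡ sumℚ (λ j → c j ℚ.* l j)
    swap-sums = begin
      sumℚ (λ e → w e ℚ.* x e)
        ≡⟨ Σℚ.sum-cong-≗ (λ e → Σℚ.*-distribˡ-sum (w e) (λ j → c j ℚ.* r j e)) ⟩
      sumℚ (λ e → sumℚ (λ j → w e ℚ.* (c j ℚ.* r j e)))
        ≡⟨ Σℚ.∑-comm (λ e j → w e ℚ.* (c j ℚ.* r j e)) ⟩
      sumℚ (λ j → sumℚ (λ e → w e ℚ.* (c j ℚ.* r j e)))
        ≡⟨ Σℚ.sum-cong-≗ (λ j → Σℚ.sum-cong-≗ (λ e →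
             solve 3 (λ w c r → w :* (c :* r) := c :* (w :* r)) refl (w e) (c j) (r j e))) ⟩
      sumℚ (λ j → sumℚ (λ e → c j ℚ.* (w e ℚ.* r j e)))
        ≡⟨ Σℚ.sum-cong-≗ (λ j → Σℚ.*-distribˡ-sum (c j) (λ e → w e ℚ.* r j e)) ⟨
      sumℚ (λ j → c j ℚ.* l j) ∎
      where
      open ≡-Reasoning
      open ℚ-Solver.+-*-Solver

  -- Three errors add up: the distance from `p` to the combination, the coefficients that may be as
  -- low as `- ε`, and the total that may differ from 1. The factor of `ε` does not involve `c`, so
  -- it stays fixed when `c` varies with `ε`, as `≤-limit` requires.
  approximate-bound : sumℚ (λ e → w e ℚ.* p e) ℚ.≤
    m ℚ.+ ε ℚ.* ((ℚ.∣ m ∣ ℚ.+ sumℚ (λ j → m ℚ.- l j)) ℚ.+ sumℚ (λ e → ℚ.∣ w e ∣))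
  approximate-bound = begin
    sumℚ (λ e → w e ℚ.* p e)
      ≤⟨ sum-mono (λ e → 0≤q-p⇒p≤q (0≤q-p (w*d≤ε*∣w∣ (w e) (ℚ.<⇒≤ (p-close e))))
           (solve 4 (λ εw w p x → εw :- w :* (p :- x) := (w :* x :+ εw) :- w :* p) refl
             (ε ℚ.* ℚ.∣ w e ∣) (w e) (p e) (x e))) ⟩
    sumℚ (λ e → w e ℚ.* x e ℚ.+ ε ℚ.* ℚ.∣ w e ∣)
      ≡⟨ Σℚ.∑-distrib-+ (λ e → w e ℚ.* x e) (λ e → ε ℚ.* ℚ.∣ w e ∣) ⟩
    sumℚ (λ e → w e ℚ.* x e) ℚ.+ sumℚ (λ e → ε ℚ.* ℚ.∣ w e ∣)
      ≡⟨ cong₂ ℚ._+_ swap-sums (sym (Σℚ.*-distribˡ-sum ε (λ e → ℚ.∣ w e ∣))) ⟩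
    sumℚ (λ j → c j ℚ.* l j) ℚ.+ ε ℚ.* W
      ≤⟨ ℚ.+-monoˡ-≤ (ε ℚ.* W) (sum-mono (λ j → 0≤q-p⇒p≤q
           (0≤p*q (ℚ.<⇒≤ (c-nonneg j)) (0≤q-p (w≤m j)))
           (solve 4 (λ c ε m l → (c :+ ε) :* (m :- l) := (c :* m :+ ε :* (m :- l)) :- c :* l) refl
             (c j) ε m (l j)))) ⟩
    sumℚ (λ j → c j ℚ.* m ℚ.+ ε ℚ.* (m ℚ.- l j)) ℚ.+ ε ℚ.* W
      ≡⟨ cong (ℚ._+ ε ℚ.* W) (trans (Σℚ.∑-distrib-+ (λ j → c j ℚ.* m) (λ j → ε ℚ.* (m ℚ.- l j)))
           (cong₂ ℚ._+_ (sym (Σℚ.*-distribʳ-sum m c)) (sym (Σℚ.*-distribˡ-sum ε (λ j → m ℚ.- l j))))) ⟩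
    (sumℚ c ℚ.* m ℚ.+ ε ℚ.* V) ℚ.+ ε ℚ.* W
      ≤⟨ 0≤q-p⇒p≤q (0≤q-p (w*d≤ε*∣w∣ m (ℚ.<⇒≤ c-total)))
           (solve 6 (λ s m ε am V W → ε :* am :- m :* (s :- con 1ℚ) :=
               (m :+ ε :* ((am :+ V) :+ W)) :- ((s :* m :+ ε :* V) :+ ε :* W)) refl
             (sumℚ c) m ε ℚ.∣ m ∣ V W) ⟩
    m ℚ.+ ε ℚ.* ((ℚ.∣ m ∣ ℚ.+ V) ℚ.+ W) ∎
    where
    open ℚ.≤-Reasoning
    open ℚ-Solver.+-*-Solver
    V = sumℚ (λ j → m ℚ.- l j)
    W = sumℚ (λ e → ℚ.∣ w e ∣)

-- Convex hulls over Cauchy sequences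

seq-sum : (f : Fin n → ℝ) (N : ℕ) → seq (sumℝ f) N ≡ sumℚ (λ j → seq (f j) N)
seq-sum {zero}  f N = refl
seq-sum {suc n} f N = cong (seq (f zero) N ℚ.+_) (seq-sum (f ∘ suc) N)

≗⇒≈ℝ : ∀ {x y} → (∀ N → seq x N ≡ seq y N) → x ≈ℝ y
≗⇒≈ℝ {x} {y} x≗y {ε} 0<ε = 0 , λ N _ →
  subst (ℚ._< ε) (sym (cong ℚ.∣_∣ (trans (cong (ℚ._- seq y N) (x≗y N)) (ℚ.+-inverseʳ (seq y N))))) 0<ε

eventually-all : (P : Fin k → ℕ → Set) → (∀ j → ∃[ N ] ∀ m → N ℕ.≤ m → P j m) →
                 ∃[ N ] ∀ m → N ℕ.≤ m → ∀ j → P j m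
eventually-all {zero}  P ev = 0 , λ _ _ ()
eventually-all {suc k} P ev with ev zero | eventually-all (P ∘ suc) (ev ∘ suc)
... | N , p | N′ , p′ = N ℕ.⊔ N′ , λ where
  m ≤m zero    → p m (ℕ.m⊔n≤o⇒m≤o N N′ ≤m)
  m ≤m (suc j) → p′ m (ℕ.m⊔n≤o⇒n≤o N N′ ≤m) j

seq-indicator : (B : Subset n) (e : Fin n) (N : ℕ) → seq (indicatorVector B e) N ≡ ι (χ (lookup B e))
seq-indicator B e N with lookup B e
... | true  = refl
... | false = refl

-- At a single index the coefficients are only nearly nonnegative, with total only nearly 1. An
-- index at which all the approximations are within `ε` gives the bound up to a multiple of `ε`, and
-- `ε` is arbitrary.
hull-bound : (P : Subset n → Set) (p : Fin n → ℚ) →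
  conv (λ v → ∃[ B ] P B × v ≡ indicatorVector B) (fromℚ ∘ p) →
  (w : Fin n → ℚ) (m : ℚ) → (∀ B → P B → sumℚ (λ e → w e ℚ.* ι (χ (lookup B e))) ℚ.≤ m) →
  sumℚ (λ e → w e ℚ.* p e) ℚ.≤ m
hull-bound P p (k , v , c , vP , 0≤c , total , p≈) w m w≤m = ≤-limit
  (ℚ.+-mono-≤ (ℚ.+-mono-≤ (ℚ.0≤∣p∣ m) (sum-nonneg (λ j → 0≤q-p (w≤m _ (vertex∈P j)))))
              (sum-nonneg (λ e → ℚ.0≤∣p∣ (w e))))
  approx
  where
  vertex = λ j → proj₁ (vP j)
  vertex∈P = λ j → proj₁ (proj₂ (vP j))
  r = λ j e → ι (χ (lookup (vertex j) e))

  seq-v : ∀ j e N → seq (v j e) N ≡ r j e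
  seq-v j e N = trans (cong (λ u → seq (u e) N) (proj₂ (proj₂ (vP j)))) (seq-indicator (vertex j) e N)

  approx : ∀ ε → 0ℚ ℚ.< ε → _
  approx ε 0<ε with total 0<ε
    | eventually-all (λ j N → 0ℚ ℚ.< seq (c j) N ℚ.+ ε) (λ j → 0≤c j 0<ε)
    | eventually-all (λ e N → ℚ.∣ p e ℚ.- seq (sumℝ (λ j → c j *ℝ v j e)) N ∣ ℚ.< ε) (λ e → p≈ e 0<ε)
  ... | N₁ , h₁ | N₂ , h₂ | N₃ , h₃ = approximate-bound 0<ε w p (λ j → seq (c j) N) r
      (h₂ N (ℕ.≤-trans (ℕ.m≤n⊔m N₁ N₂) (ℕ.m≤m⊔n _ N₃)))
      (subst (λ s → ℚ.∣ s ℚ.- 1ℚ ∣ ℚ.< ε) (seq-sum c N) (h₁ N (ℕ.≤-trans (ℕ.m≤m⊔n N₁ N₂) (ℕ.m≤m⊔n _ N₃))))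
      (λ e → subst (λ s → ℚ.∣ p e ℚ.- s ∣ ℚ.< ε)
        (trans (seq-sum (λ j → c j *ℝ v j e) N) (Σℚ.sum-cong-≗ (λ j → cong (seq (c j) N ℚ.*_) (seq-v j e N))))
        (h₃ N (ℕ.m≤n⊔m (N₁ ℕ.⊔ N₂) N₃) e))
      (λ j → w≤m (vertex j) (vertex∈P j))
    where
    N = (N₁ ℕ.⊔ N₂) ℕ.⊔ N₃

-- Indicators, maxima over subsets, and weights

+-congˡ : ∀ x {y z} → y ≡ z → x ℤ.+ y ≡ x ℤ.+ z
+-congˡ x = cong (λ k → x ℤ.+ k)

open ℤ-Solver.+-*-Solver using (solve; con; _:=_; _:+_; _:*_; _:-_; :-_)

𝟙-true : (d : Dec A) → A → 𝟙 d ≡ 1ℤ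
𝟙-true (yes _) _ = refl
𝟙-true (no ¬a) a = contradiction a ¬a

𝟙-false : (d : Dec A) → ¬ A → 𝟙 d ≡ 0ℤ
𝟙-false (yes a) ¬a = contradiction a ¬a
𝟙-false (no _)  _  = refl

𝟙-cong : (d : Dec A) (e : Dec B) → (A → B) → (B → A) → 𝟙 d ≡ 𝟙 e
𝟙-cong (yes a) e f g = sym (𝟙-true e (f a))
𝟙-cong (no ¬a) e f g = sym (𝟙-false e (¬a ∘ g))

allSubset? : ∀ {P : Pred (Subset n) 0ℓ} → Decidable P → Dec (∀ S → P S)
allSubset? P? = map′ (λ ¬∃ S → decidable-stable (P? S) λ ¬p → ¬∃ (S , ¬p))
                     (λ all (S , ¬p) → ¬p (all S))
                     (¬? (anySubset? (¬? ∘ P?)))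

maxSubset : (φ : Subset n → ℤ) → ∃[ S ] ∀ T → φ T ℤ.≤ φ S
maxSubset {zero}  φ = [] , λ { [] → ℤ.≤-refl }
maxSubset {suc n} φ
  with maxSubset (φ ∘ (outside ∷_)) | maxSubset (φ ∘ (inside ∷_))
... | S , maxS | T , maxT with ℤ.≤-total (φ (outside ∷ S)) (φ (inside ∷ T))
...   | inj₁ S≤T = inside ∷ T , λ where
  (outside ∷ U) → ℤ.≤-trans (maxS U) S≤T
  (inside ∷ U)  → maxT U
...   | inj₂ T≤S = outside ∷ S , λ where
  (outside ∷ U) → maxS U
  (inside ∷ U)  → ℤ.≤-trans (maxT U) T≤S

weight : Vec ℤ n → Subset n → ℤ
weight []      []            = 0ℤ
weight (x ∷ z) (outside ∷ S) = weight z S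
weight (x ∷ z) (inside ∷ S)  = x ℤ.+ weight z S

-- Lets an inequality be certified by writing `v - u` as a sum of quantities known to be
-- nonnegative, the identity being left to the ring solver.
≤-cert : ∀ {e u v} → 0ℤ ℤ.≤ e → e ≡ v ℤ.- u → u ℤ.≤ v
≤-cert 0≤e e≡ = ℤ.0≤i-j⇒j≤i (subst (0ℤ ℤ.≤_) e≡ 0≤e)

-- Submodular functions on the subsets of Fin n

Submodular : (Subset n → ℤ) → Set
Submodular f = ∀ A B → f (A ∪ B) ℤ.+ f (A ∩ B) ℤ.≤ f A ℤ.+ f B

-- The slice of `double f` at an integer `t` is twice the slice of `f` at height `t / 2`;
-- half-integral heights thereby stay within the integers.
double : (Subset n → ℤ) → Subset n → ℤ
double f S = f S ℤ.+ f S

-- The constraints weight z ≤ f on z = t ∷ z′, as constraints on z′.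
slice : ℤ → (Subset (suc n) → ℤ) → Subset n → ℤ
slice t f S = f (outside ∷ S) ⊓ (f (inside ∷ S) ℤ.- t)

slice-outside : ∀ t (f : Subset (suc n) → ℤ) S → slice t f S ℤ.≤ f (outside ∷ S)
slice-outside t f S = ℤ.i⊓j≤i _ _

slice-inside : ∀ t (f : Subset (suc n) → ℤ) S → slice t f S ℤ.≤ f (inside ∷ S) ℤ.- t
slice-inside t f S = ℤ.i⊓j≤j (f (outside ∷ S)) _

double-submodular : (f : Subset n → ℤ) → Submodular f → Submodular (double f)
double-submodular f sub A B = ≤-cert
  (ℤ.+-mono-≤ (ℤ.i≤j⇒0≤j-i (sub A B)) (ℤ.i≤j⇒0≤j-i (sub A B)))
  (solve 4 (λ u i a b → ((a :+ b) :- (u :+ i)) :+ ((a :+ b) :- (u :+ i))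
      := ((a :+ a) :+ (b :+ b)) :- ((u :+ u) :+ (i :+ i)))
    refl (f (A ∪ B)) (f (A ∩ B)) (f A) (f B))

-- Each minimum is attained at a lift of its set to `suc n`. The union and intersection of lifts of
-- `A` and `B` are lifts of `A ∪ B` and `A ∩ B`, and they contain the new element as often in total,
-- so the copies of `t` cancel.
slice-submodular : ∀ t (f : Subset (suc n) → ℤ) → Submodular f → Submodular (slice t f)
slice-submodular t f sub A B
  with ℤ.⊓-sel (f (outside ∷ A)) (f (inside ∷ A) ℤ.- t)
     | ℤ.⊓-sel (f (outside ∷ B)) (f (inside ∷ B) ℤ.- t)
... | inj₁ eA | inj₁ eB rewrite eA | eB = ℤ.≤-trans
  (ℤ.+-mono-≤ (slice-outside t f (A ∪ B)) (slice-outside t f (A ∩ B)))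
  (sub (outside ∷ A) (outside ∷ B))
... | inj₁ eA | inj₂ eB rewrite eA | eB = ℤ.≤-trans
  (ℤ.+-mono-≤ (slice-inside t f (A ∪ B)) (slice-outside t f (A ∩ B)))
  (≤-cert (ℤ.i≤j⇒0≤j-i (sub (outside ∷ A) (inside ∷ B)))
    (solve 5 (λ u i a b t → (a :+ b) :- (u :+ i) := (a :+ (b :- t)) :- ((u :- t) :+ i)) refl
      (f (inside ∷ (A ∪ B))) (f (outside ∷ (A ∩ B))) (f (outside ∷ A)) (f (inside ∷ B)) t))
... | inj₂ eA | inj₁ eB rewrite eA | eB = ℤ.≤-trans
  (ℤ.+-mono-≤ (slice-inside t f (A ∪ B)) (slice-outside t f (A ∩ B)))
  (≤-cert (ℤ.i≤j⇒0≤j-i (sub (inside ∷ A) (outside ∷ B)))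
    (solve 5 (λ u i a b t → (a :+ b) :- (u :+ i) := ((a :- t) :+ b) :- ((u :- t) :+ i)) refl
      (f (inside ∷ (A ∪ B))) (f (outside ∷ (A ∩ B))) (f (inside ∷ A)) (f (outside ∷ B)) t))
... | inj₂ eA | inj₂ eB rewrite eA | eB = ℤ.≤-trans
  (ℤ.+-mono-≤ (slice-inside t f (A ∪ B)) (slice-inside t f (A ∩ B)))
  (≤-cert (ℤ.i≤j⇒0≤j-i (sub (inside ∷ A) (inside ∷ B)))
    (solve 5 (λ u i a b t → (a :+ b) :- (u :+ i) := ((a :- t) :+ (b :- t)) :- ((u :- t) :+ (i :- t))) refl
      (f (inside ∷ (A ∪ B))) (f (inside ∷ (A ∩ B))) (f (inside ∷ A)) (f (inside ∷ B)) t))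

-- The polytope { z | - h ≤ weight z ≤ f } is given by the pair f , h; its
-- lower bounds - h are supermodular when h is submodular.
Consistent : (f h : Subset n → ℤ) → Set
Consistent f h = ∀ S → 0ℤ ℤ.≤ f S ℤ.+ h S

consistent? : (f h : Subset n → ℤ) → Dec (Consistent f h)
consistent? f h = allSubset? λ S → 0ℤ ℤ.≤? f S ℤ.+ h S

-- The range of the first coordinate of the points of a polytope f , h.
record Range (f h : Subset (suc n) → ℤ) : Set where
  field
    lo hi         : ℤ
    lo≤hi         : lo ℤ.≤ hi
    lo-attained   : ∃[ S ] lo ≡ ℤ.- (f (outside ∷ S) ℤ.+ h (inside ∷ S))
    hi-attained   : ∃[ S ] hi ≡ f (inside ∷ S) ℤ.+ h (outside ∷ S)
    lo-max        : ∀ S → ℤ.- (f (outside ∷ S) ℤ.+ h (inside ∷ S)) ℤ.≤ lo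
    hi-min        : ∀ S → hi ℤ.≤ f (inside ∷ S) ℤ.+ h (outside ∷ S)

-- The bounds eliminate the other coordinates: `t + weight z S` is at least `- h (inside ∷ S)`,
-- while `weight z S` is at most `f (outside ∷ S)`; dually from above. For `lo ≤ hi`, uncrossing the
-- sets that attain the two bounds leads, for `f` and for `h` alike, to `inside ∷ (S ∪ T)` and
-- `outside ∷ (S ∩ T)`, where consistency applies.
range : (f h : Subset (suc n) → ℤ) → Submodular f → Submodular h →
        Consistent f h → Range f h
range {n} f h subf subh good with maxSubset (λ S → ℤ.- (f (outside ∷ S) ℤ.+ h (inside ∷ S)))
                            | maxSubset (λ S → ℤ.- (f (inside ∷ S) ℤ.+ h (outside ∷ S)))
... | S , maxS | T , maxT = record
  { lo = ℤ.- (f (outside ∷ S) ℤ.+ h (inside ∷ S))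
  ; hi = f (inside ∷ T) ℤ.+ h (outside ∷ T)
  ; lo≤hi = ≤-cert
      (ℤ.+-mono-≤
        (ℤ.+-mono-≤ (ℤ.i≤j⇒0≤j-i (subf (outside ∷ S) (inside ∷ T)))
                    (ℤ.i≤j⇒0≤j-i (subh (inside ∷ S) (outside ∷ T))))
        (ℤ.+-mono-≤ (good (inside ∷ (S ∪ T))) (good (outside ∷ (S ∩ T)))))
      (solve 8 (λ f0 h1 f1 h0 fu fi hu hi →
          (((f0 :+ f1) :- (fu :+ fi)) :+ ((h1 :+ h0) :- (hu :+ hi))) :+ ((fu :+ hu) :+ (fi :+ hi))
          := (f1 :+ h0) :- (:- (f0 :+ h1))) refl
        (f (outside ∷ S)) (h (inside ∷ S)) (f (inside ∷ T)) (h (outside ∷ T))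
        (f (inside ∷ (S ∪ T))) (f (outside ∷ (S ∩ T))) (h (inside ∷ (S ∪ T))) (h (outside ∷ (S ∩ T))))
  ; lo-attained = S , refl
  ; hi-attained = T , refl
  ; lo-max = maxS
  ; hi-min = λ U → ℤ.neg-cancel-≤ (maxT U)
  }

-- The four choices of the minima correspond to consistency at the two lifts of `S` and to the two
-- bounds on `t`.
slice-consistent : ∀ (f h : Subset (suc n) → ℤ) t → Consistent f h →
  (∀ S → ℤ.- (f (outside ∷ S) ℤ.+ h (inside ∷ S)) ℤ.≤ t) →
  (∀ S → t ℤ.≤ f (inside ∷ S) ℤ.+ h (outside ∷ S)) →
  Consistent (slice t f) (slice (ℤ.- t) h)
slice-consistent f h t good lo hi S
  with ℤ.⊓-sel (f (outside ∷ S)) (f (inside ∷ S) ℤ.- t)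
     | ℤ.⊓-sel (h (outside ∷ S)) (h (inside ∷ S) ℤ.- ℤ.- t)
... | inj₁ ef | inj₁ eh rewrite ef | eh = good (outside ∷ S)
... | inj₁ ef | inj₂ eh rewrite ef | eh = subst (0ℤ ℤ.≤_)
  (solve 3 (λ a b t → t :- (:- (a :+ b)) := a :+ (b :- (:- t))) refl (f (outside ∷ S)) (h (inside ∷ S)) t)
  (ℤ.i≤j⇒0≤j-i (lo S))
... | inj₂ ef | inj₁ eh rewrite ef | eh = subst (0ℤ ℤ.≤_)
  (solve 3 (λ a b t → (a :+ b) :- t := (a :- t) :+ b) refl (f (inside ∷ S)) (h (outside ∷ S)) t)
  (ℤ.i≤j⇒0≤j-i (hi S))
... | inj₂ ef | inj₂ eh rewrite ef | eh = subst (0ℤ ℤ.≤_)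
  (solve 3 (λ a b t → a :+ b := (a :- t) :+ (b :- (:- t))) refl (f (inside ∷ S)) (h (inside ∷ S)) t)
  (good (inside ∷ S))

module _ (f h : Subset (suc n) → ℤ) t (good : Consistent (slice t f) (slice (ℤ.- t) h)) where

  private
    below : ∀ S {x y} → slice t f S ℤ.≤ x → slice (ℤ.- t) h S ℤ.≤ y → 0ℤ ℤ.≤ x ℤ.+ y
    below S p q = ℤ.≤-trans (good S) (ℤ.+-mono-≤ p q)

  consistent-slice : Consistent f h
  consistent-slice (outside ∷ S) = below S (slice-outside t f S) (slice-outside (ℤ.- t) h S)
  consistent-slice (inside ∷ S)  = subst (0ℤ ℤ.≤_)
    (solve 3 (λ a b t → (a :- t) :+ (b :- (:- t)) := a :+ b) refl (f (inside ∷ S)) (h (inside ∷ S)) t)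
    (below S (slice-inside t f S) (slice-inside (ℤ.- t) h S))

  slice-lower : ∀ S → ℤ.- (f (outside ∷ S) ℤ.+ h (inside ∷ S)) ℤ.≤ t
  slice-lower S = ≤-cert (below S (slice-outside t f S) (slice-inside (ℤ.- t) h S))
    (solve 3 (λ a b t → a :+ (b :- (:- t)) := t :- (:- (a :+ b))) refl (f (outside ∷ S)) (h (inside ∷ S)) t)

  slice-upper : ∀ S → t ℤ.≤ f (inside ∷ S) ℤ.+ h (outside ∷ S)
  slice-upper S = ≤-cert (below S (slice-inside t f S) (slice-outside (ℤ.- t) h S))
    (solve 3 (λ a b t → (a :- t) :+ b := (a :+ b) :- t) refl (f (inside ∷ S)) (h (outside ∷ S)) t)

nonneg-of-sum : ∀ {x y} → 0ℤ ℤ.≤ x ℤ.+ y → y ℤ.≤ 0ℤ → 0ℤ ℤ.≤ x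
nonneg-of-sum {x} {y} p q = ℤ.≤-trans p
  (ℤ.≤-trans (ℤ.+-monoʳ-≤ x q) (ℤ.≤-reflexive (ℤ.+-identityʳ x)))

-- Frank's discrete sandwich theorem. The conditions at `⊥` pass to slices, which lie below the
-- `outside` values; in dimension 0 they combine with consistency to give both inequalities for the
-- empty weight.
sandwich : (f h : Subset n → ℤ) → Submodular f → Submodular h →
           f ⊥ ℤ.≤ 0ℤ → h ⊥ ℤ.≤ 0ℤ → Consistent f h →
           ∃[ z ] ∀ S → weight z S ℤ.≤ f S × ℤ.- weight z S ℤ.≤ h S
sandwich {zero} f h _ _ f⊥ h⊥ good = [] , λ
  { [] → nonneg-of-sum (good []) h⊥
       , nonneg-of-sum {h []} {f []} (subst (0ℤ ℤ.≤_) (ℤ.+-comm (f []) (h [])) (good [])) f⊥ }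
sandwich {suc n} f h subf subh f⊥ h⊥ good = lo ∷ z , λ where
    (outside ∷ S) → ℤ.≤-trans (proj₁ (bound S)) (slice-outside lo f S)
                  , ℤ.≤-trans (proj₂ (bound S)) (slice-outside (ℤ.- lo) h S)
    (inside ∷ S) →
        ≤-cert (ℤ.i≤j⇒0≤j-i (ℤ.≤-trans (proj₁ (bound S)) (slice-inside lo f S)))
          (solve 3 (λ f t w → (f :- t) :- w := f :- (t :+ w)) refl (f (inside ∷ S)) lo (weight z S))
      , ≤-cert (ℤ.i≤j⇒0≤j-i (ℤ.≤-trans (proj₂ (bound S)) (slice-inside (ℤ.- lo) h S)))
          (solve 3 (λ h t w → (h :- (:- t)) :- (:- w) := h :- (:- (t :+ w))) refl (h (inside ∷ S)) lo (weight z S))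
  where
  open Range (range f h subf subh good)
  rec : ∃[ z ] ∀ S → weight z S ℤ.≤ slice lo f S × ℤ.- weight z S ℤ.≤ slice (ℤ.- lo) h S
  rec = sandwich (slice lo f) (slice (ℤ.- lo) h)
    (slice-submodular lo f subf) (slice-submodular (ℤ.- lo) h subh)
    (ℤ.≤-trans (slice-outside lo f ⊥) f⊥) (ℤ.≤-trans (slice-outside (ℤ.- lo) h ⊥) h⊥)
    (slice-consistent f h lo good lo-max (λ S → ℤ.≤-trans lo≤hi (hi-min S)))
  z = proj₁ rec
  bound = proj₂ rec

-- Alternating sums over a grid

-- φ 0 - φ 1 + φ 2 - ⋯ + φ (2K)
alt : ℕ → (ℕ → ℤ) → ℤ
alt zero    φ = φ 0
alt (suc K) φ = (φ 0 ℤ.- φ 1) ℤ.+ alt K (φ ∘ (2 ℕ.+_))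

alt-cong : ∀ K {φ ψ} → (∀ t → φ t ≡ ψ t) → alt K φ ≡ alt K ψ
alt-cong zero    e = e 0
alt-cong (suc K) e = cong₂ ℤ._+_ (cong₂ ℤ._-_ (e 0) (e 1)) (alt-cong K (e ∘ (2 ℕ.+_)))

alt-zero : ∀ K {φ} → (∀ t → φ t ≡ 0ℤ) → alt K φ ≡ 0ℤ
alt-zero zero    e = e 0
alt-zero (suc K) e = cong₂ ℤ._+_ (cong₂ ℤ._-_ (e 0) (e 1)) (alt-zero K (e ∘ (2 ℕ.+_)))

-- Among the numbers from `2a` to `2b` the even ones outnumber the odd ones by one. The terms are
-- removed in pairs: before `2a` a pair is 0 - 0, inside the interval 1 - 1, and only the pair
-- starting at `2b` leaves 1.
alt-interval : ∀ K a b φ → a ℕ.≤ b → b ℕ.≤ K →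
  (∀ t → a ℕ.+ a ℕ.≤ t → t ℕ.≤ b ℕ.+ b → φ t ≡ 1ℤ) →
  (∀ t → t ℕ.< a ℕ.+ a → φ t ≡ 0ℤ) →
  (∀ t → b ℕ.+ b ℕ.< t → φ t ≡ 0ℤ) →
  alt K φ ≡ 1ℤ
alt-interval zero    zero    zero    φ _ _ mid below above = mid 0 z≤n z≤n
alt-interval (suc K) zero    zero    φ _ _ mid below above = cong₂ ℤ._+_
  (cong₂ ℤ._-_ (mid 0 z≤n z≤n) (above 1 (s≤s z≤n)))
  (alt-zero K (λ t → above (suc (suc t)) (s≤s z≤n)))
alt-interval (suc K) zero    (suc b) φ _ (s≤s b≤K) mid below above = cong₂ ℤ._+_
  (cong₂ ℤ._-_ (mid 0 z≤n z≤n) (mid 1 z≤n (s≤s z≤n)))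
  (alt-interval K zero b (φ ∘ (2 ℕ.+_)) z≤n b≤K
    (λ t _ t≤ → mid _ z≤n (s≤s (subst (suc t ℕ.≤_) (sym (ℕ.+-suc b b)) (s≤s t≤))))
    (λ t ())
    (λ t <t → above _ (s≤s (subst (ℕ._< suc t) (sym (ℕ.+-suc b b)) (s≤s <t)))))
alt-interval (suc K) (suc a) (suc b) φ (s≤s a≤b) (s≤s b≤K) mid below above = cong₂ ℤ._+_
  (cong₂ ℤ._-_ (below 0 (s≤s z≤n)) (below 1 (s≤s (subst (0 ℕ.<_) (sym (ℕ.+-suc a a)) (s≤s z≤n)))))
  (alt-interval K a b (φ ∘ (2 ℕ.+_)) a≤b b≤K
    (λ t ≤t t≤ → mid _ (s≤s (subst (ℕ._≤ suc t) (sym (ℕ.+-suc a a)) (s≤s ≤t)))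
                       (s≤s (subst (suc t ℕ.≤_) (sym (ℕ.+-suc b b)) (s≤s t≤))))
    (λ t t< → below _ (s≤s (subst (suc t ℕ.<_) (sym (ℕ.+-suc a a)) (s≤s t<))))
    (λ t <t → above _ (s≤s (subst (ℕ._< suc t) (sym (ℕ.+-suc b b)) (s≤s <t)))))

2^ : ℕ → ℕ
2^ n = 2 ℕ.^ n

2^-suc : ∀ n → + 2^ (suc n) ≡ + 2^ n ℤ.+ + 2^ n
2^-suc n = cong (λ k → + (2^ n ℕ.+ k)) (ℕ.+-identityʳ (2^ n))

-- The alternating sum over the points of 2ⁿ · (½ ℤ × ¼ ℤ × ⋯ × 2⁻ⁿ ℤ) whose
-- coordinates lie between 0 and 2ⁿ K.
∑grid : ∀ n → ℕ → (Vec ℤ n → ℤ) → ℤ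
∑grid zero    K φ = φ []
∑grid (suc n) K φ = alt K λ t → ∑grid n (K ℕ.+ K) λ z → φ (+ t ℤ.* + 2^ n ∷ z)

∑grid-cong : ∀ n K {φ ψ} → (∀ z → φ z ≡ ψ z) → ∑grid n K φ ≡ ∑grid n K ψ
∑grid-cong zero    K e = e []
∑grid-cong (suc n) K e = alt-cong K λ t → ∑grid-cong n (K ℕ.+ K) λ z → e (+ t ℤ.* + 2^ n ∷ z)

Box : (f h : Subset n → ℤ) → Vec ℤ n → Set
Box {n} f h z = (∀ S → weight z S ℤ.≤ + 2^ n ℤ.* f S) ×
                (∀ S → ℤ.- weight z S ℤ.≤ + 2^ n ℤ.* h S)

box? : (f h : Subset n → ℤ) (z : Vec ℤ n) → Dec (Box f h z)
box? f h z = (allSubset? λ S → _ ℤ.≤? _) ×-dec (allSubset? λ S → _ ℤ.≤? _)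

-- Abstract in `w` and `u` so as to serve the upper bounds, with `weight`, and the lower bounds,
-- with its negative and `- t`.
module _ (p : ℤ) .{{_ : ℤ.NonNegative p}} (t : ℤ) (f w : Subset (suc n) → ℤ) (u : Subset n → ℤ)
         (w-outside : ∀ S → w (outside ∷ S) ≡ u S)
         (w-inside : ∀ S → w (inside ∷ S) ≡ t ℤ.* p ℤ.+ u S) where

  private
    pf-outside : ∀ S → p ℤ.* double f (outside ∷ S) ≡ (p ℤ.+ p) ℤ.* f (outside ∷ S)
    pf-outside S = solve 2 (λ p f → p :* (f :+ f) := (p :+ p) :* f) refl p (f (outside ∷ S))

  below-slice : (∀ S → w S ℤ.≤ (p ℤ.+ p) ℤ.* f S) → ∀ S → u S ℤ.≤ p ℤ.* slice t (double f) S
  below-slice below S = subst (u S ℤ.≤_) (sym (ℤ.*-distribˡ-⊓-nonNeg p _ _))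
    (ℤ.⊓-glb
      (subst₂ ℤ._≤_ (w-outside S) (sym (pf-outside S)) (below (outside ∷ S)))
      (≤-cert (ℤ.i≤j⇒0≤j-i (subst (ℤ._≤ (p ℤ.+ p) ℤ.* f (inside ∷ S)) (w-inside S) (below (inside ∷ S))))
        (solve 4 (λ p t f u → (p :+ p) :* f :- (t :* p :+ u) := p :* ((f :+ f) :- t) :- u) refl
          p t (f (inside ∷ S)) (u S))))

  slice-below : (∀ S → u S ℤ.≤ p ℤ.* slice t (double f) S) → ∀ S → w S ℤ.≤ (p ℤ.+ p) ℤ.* f S
  slice-below below (outside ∷ S) = subst₂ ℤ._≤_ (sym (w-outside S)) (pf-outside S)
    (ℤ.≤-trans (below S) (ℤ.*-monoˡ-≤-nonNeg p (slice-outside t (double f) S)))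
  slice-below below (inside ∷ S) = subst (ℤ._≤ (p ℤ.+ p) ℤ.* f (inside ∷ S)) (sym (w-inside S))
    (≤-cert
      (ℤ.i≤j⇒0≤j-i (ℤ.≤-trans (below S) (ℤ.*-monoˡ-≤-nonNeg p (slice-inside t (double f) S))))
      (solve 4 (λ p t f u → p :* ((f :+ f) :- t) :- u := (p :+ p) :* f :- (t :* p :+ u)) refl
          p t (f (inside ∷ S)) (u S)))

module _ (f h : Subset (suc n) → ℤ) (t : ℤ) (z : Vec ℤ n) where
  private
    p = + 2^ n
    neg-inside : ∀ S → ℤ.- (t ℤ.* p ℤ.+ weight z S) ≡ (ℤ.- t) ℤ.* p ℤ.+ ℤ.- weight z S
    neg-inside S = solve 3 (λ t p w → :- (t :* p :+ w) := (:- t) :* p :+ :- w) refl t p (weight z S)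

  box-slice : Box f h (t ℤ.* p ∷ z) → Box (slice t (double f)) (slice (ℤ.- t) (double h)) z
  box-slice (upper , lower) =
      below-slice p t f (weight (t ℤ.* p ∷ z)) (weight z) (λ _ → refl) (λ _ → refl)
        (λ S → subst (λ q → weight (t ℤ.* p ∷ z) S ℤ.≤ q ℤ.* f S) (2^-suc n) (upper S))
    , below-slice p (ℤ.- t) h (ℤ.-_ ∘ weight (t ℤ.* p ∷ z)) (ℤ.-_ ∘ weight z) (λ _ → refl) neg-inside
        (λ S → subst (λ q → ℤ.- weight (t ℤ.* p ∷ z) S ℤ.≤ q ℤ.* h S) (2^-suc n) (lower S))

  slice-box : Box (slice t (double f)) (slice (ℤ.- t) (double h)) z → Box f h (t ℤ.* p ∷ z)
  slice-box (upper , lower) =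
      (λ S → subst (λ q → weight (t ℤ.* p ∷ z) S ℤ.≤ q ℤ.* f S) (sym (2^-suc n))
        (slice-below p t f (weight (t ℤ.* p ∷ z)) (weight z) (λ _ → refl) (λ _ → refl) upper S))
    , (λ S → subst (λ q → ℤ.- weight (t ℤ.* p ∷ z) S ℤ.≤ q ℤ.* h S) (sym (2^-suc n))
        (slice-below p (ℤ.- t) h (ℤ.-_ ∘ weight (t ℤ.* p ∷ z)) (ℤ.-_ ∘ weight z) (λ _ → refl) neg-inside lower S))

halve-nonneg : ∀ {x} → 0ℤ ℤ.≤ x ℤ.+ x → 0ℤ ℤ.≤ x
halve-nonneg {+ _} _ = ℤ.+≤+ z≤n

double-nonpos : ∀ {x} → x ℤ.≤ 0ℤ → x ℤ.+ x ℤ.≤ 0ℤ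
double-nonpos x≤0 = ℤ.+-mono-≤ x≤0 x≤0

halve-consistent : ∀ (f h : Subset n → ℤ) → Consistent (double f) (double h) → Consistent f h
halve-consistent f h good S = halve-nonneg (subst (0ℤ ℤ.≤_)
  (solve 2 (λ a b → (a :+ a) :+ (b :+ b) := (a :+ b) :+ (a :+ b)) refl (f S) (h S)) (good S))

double-consistent : ∀ (f h : Subset n → ℤ) → Consistent f h → Consistent (double f) (double h)
double-consistent f h good S = subst (0ℤ ℤ.≤_)
  (solve 2 (λ a b → (a :+ b) :+ (a :+ b) := (a :+ a) :+ (b :+ b)) refl (f S) (h S))
  (ℤ.+-mono-≤ (good S) (good S))

-- By induction on the dimension: the slice of a consistent polytope at
-- half-integral height t is consistent exactly for t in an interval with
-- integral endpoints, and the signs of such an interval add up to 1.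
∑grid-box : ∀ n K (f h : Subset n → ℤ) → Submodular f → Submodular h →
  f ⊥ ℤ.≤ 0ℤ → h ⊥ ℤ.≤ 0ℤ → (∀ i → f ⁅ i ⁆ ℤ.≤ + K) → (∀ i → h ⁅ i ⁆ ℤ.≤ 0ℤ) →
  ∑grid n K (λ z → 𝟙 (box? f h z)) ≡ 𝟙 (consistent? f h)
∑grid-box zero K f h _ _ f⊥ h⊥ _ _ = 𝟙-cong (box? f h []) (consistent? f h)
  (λ { (upper , lower) [] → ℤ.+-mono-≤
      (subst (0ℤ ℤ.≤_) (ℤ.*-identityˡ (f [])) (upper []))
      (subst (0ℤ ℤ.≤_) (ℤ.*-identityˡ (h [])) (lower [])) })
  (λ good →
    (λ { [] → subst (0ℤ ℤ.≤_) (sym (ℤ.*-identityˡ (f []))) (nonneg-of-sum (good []) h⊥) }) ,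
    (λ { [] → subst (0ℤ ℤ.≤_) (sym (ℤ.*-identityˡ (h [])))
                (nonneg-of-sum {h []} {f []} (subst (0ℤ ℤ.≤_) (ℤ.+-comm (f []) (h [])) (good [])) f⊥) }))
∑grid-box (suc n) K f h subf subh f⊥ h⊥ f≤K h≤0 = trans (alt-cong K inner) (outer (consistent? f h))
  where
  fₜ hₜ : ℤ → Subset n → ℤ
  fₜ t = slice t (double f)
  hₜ t = slice (ℤ.- t) (double h)

  ψ : ℕ → ℤ
  ψ t = 𝟙 (consistent? (fₜ (+ t)) (hₜ (+ t)))

  inner : ∀ t → ∑grid n (K ℕ.+ K) (λ z → 𝟙 (box? f h (+ t ℤ.* + 2^ n ∷ z))) ≡ ψ t
  inner t = trans
    (∑grid-cong n (K ℕ.+ K) λ z → 𝟙-cong (box? f h (+ t ℤ.* + 2^ n ∷ z)) (box? (fₜ (+ t)) (hₜ (+ t)) z)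
       (box-slice f h (+ t) z) (slice-box f h (+ t) z))
    (∑grid-box n (K ℕ.+ K) (fₜ (+ t)) (hₜ (+ t))
      (slice-submodular (+ t) (double f) (double-submodular f subf))
      (slice-submodular (ℤ.- + t) (double h) (double-submodular h subh))
      (ℤ.≤-trans (slice-outside (+ t) (double f) ⊥) (double-nonpos f⊥))
      (ℤ.≤-trans (slice-outside (ℤ.- + t) (double h) ⊥) (double-nonpos h⊥))
      (λ i → ℤ.≤-trans (slice-outside (+ t) (double f) ⁅ i ⁆) (ℤ.+-mono-≤ (f≤K (suc i)) (f≤K (suc i))))
      (λ i → ℤ.≤-trans (slice-outside (ℤ.- + t) (double h) ⁅ i ⁆) (double-nonpos (h≤0 (suc i)))))

  outer : (d : Dec (Consistent f h)) → alt K ψ ≡ 𝟙 d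
  outer (no ¬good) = alt-zero K λ t → 𝟙-false (consistent? (fₜ (+ t)) (hₜ (+ t))) λ good →
          ¬good (halve-consistent f h (consistent-slice (double f) (double h) (+ t) good))
  outer (yes good) = go lo hi refl refl 0≤lo
    where
    open Range (range f h subf subh good)

    -- The bounds at `⊥` and at the singletons confine the first coordinate to the interval from 0
    -- to `K`, which is what the finite sum covers.
    0≤lo : 0ℤ ℤ.≤ lo
    0≤lo = ℤ.≤-trans (ℤ.neg-mono-≤ (ℤ.+-mono-≤ f⊥ (h≤0 zero))) (lo-max ⊥)

    hi≤K : hi ℤ.≤ + K
    hi≤K = ℤ.≤-trans (hi-min ⊥) (ℤ.≤-trans (ℤ.+-mono-≤ (f≤K zero) h⊥) (ℤ.≤-reflexive (ℤ.+-identityʳ (+ K))))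

    lo-slice : ∀ t → Consistent (fₜ t) (hₜ t) → lo ℤ.+ lo ℤ.≤ t
    lo-slice t c with lo-attained
    ... | S , e = subst (ℤ._≤ t)
      (trans (solve 2 (λ f h → :- ((f :+ f) :+ (h :+ h)) := (:- (f :+ h)) :+ (:- (f :+ h))) refl
                (f (outside ∷ S)) (h (inside ∷ S)))
             (sym (cong₂ ℤ._+_ e e)))
      (slice-lower (double f) (double h) t c S)

    hi-slice : ∀ t → Consistent (fₜ t) (hₜ t) → t ℤ.≤ hi ℤ.+ hi
    hi-slice t c with hi-attained
    ... | S , e = subst (t ℤ.≤_)
      (trans (solve 2 (λ f h → (f :+ f) :+ (h :+ h) := (f :+ h) :+ (f :+ h)) refl
                (f (inside ∷ S)) (h (outside ∷ S)))
             (sym (cong₂ ℤ._+_ e e)))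
      (slice-upper (double f) (double h) t c S)

    slice-good : ∀ t → lo ℤ.+ lo ℤ.≤ t → t ℤ.≤ hi ℤ.+ hi → Consistent (fₜ t) (hₜ t)
    slice-good t lo≤t t≤hi = slice-consistent (double f) (double h) t (double-consistent f h good)
      (λ S → ℤ.≤-trans (subst (ℤ._≤ lo ℤ.+ lo)
          (solve 2 (λ f h → (:- (f :+ h)) :+ (:- (f :+ h)) := :- ((f :+ f) :+ (h :+ h))) refl
                (f (outside ∷ S)) (h (inside ∷ S)))
          (ℤ.+-mono-≤ (lo-max S) (lo-max S))) lo≤t)
      (λ S → ℤ.≤-trans t≤hi (subst (hi ℤ.+ hi ℤ.≤_)
          (solve 2 (λ f h → (f :+ h) :+ (f :+ h) := (f :+ f) :+ (h :+ h)) refl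
                (f (inside ∷ S)) (h (outside ∷ S)))
          (ℤ.+-mono-≤ (hi-min S) (hi-min S))))

    go : ∀ l m → l ≡ lo → m ≡ hi → 0ℤ ℤ.≤ l → alt K ψ ≡ 1ℤ
    go (+ a) (ℤ.-[1+ _ ]) el em _ = case subst₂ ℤ._≤_ (sym el) (sym em) lo≤hi of λ ()
    go (+ a) (+ b) el em _ = alt-interval K a b ψ
      (ℤ.drop‿+≤+ (subst₂ ℤ._≤_ (sym el) (sym em) lo≤hi))
      (ℤ.drop‿+≤+ (subst (ℤ._≤ + K) (sym em) hi≤K))
      (λ t ≤t t≤ → 𝟙-true (consistent? (fₜ (+ t)) (hₜ (+ t))) (slice-good (+ t)
        (subst (ℤ._≤ + t) (cong₂ ℤ._+_ el el) (ℤ.+≤+ ≤t))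
        (subst (+ t ℤ.≤_) (cong₂ ℤ._+_ em em) (ℤ.+≤+ t≤))))
      (λ t t< → 𝟙-false (consistent? (fₜ (+ t)) (hₜ (+ t))) λ c → ℕ.<⇒≱ t<
        (ℤ.drop‿+≤+ (subst (ℤ._≤ + t) (sym (cong₂ ℤ._+_ el el)) (lo-slice (+ t) c))))
      (λ t <t → 𝟙-false (consistent? (fₜ (+ t)) (hₜ (+ t))) λ c → ℕ.<⇒≱ <t
        (ℤ.drop‿+≤+ (subst (+ t ℤ.≤_) (sym (cong₂ ℤ._+_ em em)) (hi-slice (+ t) c))))

-- Finite sets and cardinalities

⟦_⟧ : {P : Pred (Fin n) 0ℓ} → Decidable P → Subset n
⟦ P? ⟧ = Vec.tabulate (does ∘ P?)

module _ {P : Pred (Fin n) 0ℓ} (P? : Decidable P) where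

  ∈-⟦⟧⁺ : ∀ {i} → P i → i ∈ ⟦ P? ⟧
  ∈-⟦⟧⁺ {i} p = lookup⇒[]= i _ (trans (lookup∘tabulate _ i) (lemma (P? i)))
    where
    lemma : (d : Dec (P i)) → does d ≡ true
    lemma (yes _) = refl
    lemma (no ¬p) = contradiction p ¬p

  ∈-⟦⟧⁻ : ∀ {i} → i ∈ ⟦ P? ⟧ → P i
  ∈-⟦⟧⁻ {i} i∈ = lemma (P? i) (trans (sym (lookup∘tabulate _ i)) ([]=⇒lookup i∈))
    where
    lemma : (d : Dec (P i)) → does d ≡ true → P i
    lemma (yes p) _ = p

∣∪∣+∣∩∣ : (A B : Subset n) → ∣ A ∪ B ∣ + ∣ A ∩ B ∣ ≡ ∣ A ∣ + ∣ B ∣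
∣∪∣+∣∩∣ [] [] = refl
∣∪∣+∣∩∣ (outside ∷ A) (outside ∷ B) = ∣∪∣+∣∩∣ A B
∣∪∣+∣∩∣ (outside ∷ A) (inside ∷ B)  = trans (cong suc (∣∪∣+∣∩∣ A B)) (sym (ℕ.+-suc ∣ A ∣ ∣ B ∣))
∣∪∣+∣∩∣ (inside ∷ A) (outside ∷ B)  = cong suc (∣∪∣+∣∩∣ A B)
∣∪∣+∣∩∣ (inside ∷ A) (inside ∷ B)   = cong suc (trans (ℕ.+-suc ∣ A ∪ B ∣ ∣ A ∩ B ∣)
  (trans (cong suc (∣∪∣+∣∩∣ A B)) (sym (ℕ.+-suc ∣ A ∣ ∣ B ∣))))

∣∪⁅⁆∣ : (A : Subset n) {e : Fin n} → e ∉ A → ∣ A ∪ ⁅ e ⁆ ∣ ≡ suc ∣ A ∣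
∣∪⁅⁆∣ (outside ∷ A) {zero}  e∉A = cong (suc ∘ ∣_∣) (∪-identityʳ A)
∣∪⁅⁆∣ (inside ∷ A)  {zero}  e∉A = contradiction here e∉A
∣∪⁅⁆∣ (outside ∷ A) {suc e} e∉A = ∣∪⁅⁆∣ A (e∉A ∘ there)
∣∪⁅⁆∣ (inside ∷ A)  {suc e} e∉A = cong suc (∣∪⁅⁆∣ A (e∉A ∘ there))

∣-∣ : (A : Subset n) {e : Fin n} → e ∈ A → suc ∣ A - e ∣ ≡ ∣ A ∣
∣-∣ (inside ∷ A)  here         = cong (suc ∘ ∣_∣) (p─⊥≡p A)
∣-∣ (outside ∷ A) (there e∈A) = ∣-∣ A e∈A
∣-∣ (inside ∷ A)  (there e∈A) = cong suc (∣-∣ A e∈A)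

∉- : (A : Subset n) (e : Fin n) → e ∉ A - e
∉- (outside ∷ A) zero ()
∉- (inside ∷ A)  zero ()
∉- (s ∷ A) (suc e) (there e∈) = ∉- A e e∈

-⇒∈ : (A : Subset n) {e x : Fin n} → x ∈ A - e → x ∈ A
-⇒∈ A {e} = p─q⊆p A ⁅ e ⁆

⊆-insert : (A : Subset n) (e : Fin n) → A ⊆ A ∪ ⁅ e ⁆
⊆-insert A e = p⊆p∪q ⁅ e ⁆

∈-insert : (A : Subset n) (e : Fin n) → e ∈ A ∪ ⁅ e ⁆
∈-insert A e = q⊆p∪q A ⁅ e ⁆ (x∈⁅x⁆ e)

insert-⊆ : {A B : Subset n} {e : Fin n} → A ⊆ B → e ∈ B → A ∪ ⁅ e ⁆ ⊆ B
insert-⊆ {A = A} {e = e} A⊆B e∈B x∈ with x∈p∪q⁻ A ⁅ e ⁆ x∈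
... | inj₁ x∈A = A⊆B x∈A
... | inj₂ x∈e rewrite x∈⁅y⁆⇒x≡y e x∈e = e∈B

⊆∧∣≥∣⇒≡ : {A B : Subset n} → A ⊆ B → ∣ B ∣ ≤ ∣ A ∣ → A ≡ B
⊆∧∣≥∣⇒≡ {A = A} {B} A⊆B ∣B∣≤∣A∣ = ⊆-antisym A⊆B B⊆A
  where
  B⊆A : B ⊆ A
  B⊆A {x} x∈B with x ∈? A
  ... | yes x∈A = x∈A
  ... | no x∉A  = contradiction ∣B∣≤∣A∣ (ℕ.<⇒≱ (p⊂q⇒∣p∣<∣q∣ (A⊆B , x , x∈B , x∉A)))

⊆-or-witness : (A B : Subset n) → A ⊆ B ⊎ ∃[ x ] x ∈ A × x ∉ B
⊆-or-witness A B with nonempty? (A ∩ ∁ B)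
... | yes (x , x∈) = let x∈A , x∈∁B = x∈p∩q⁻ A (∁ B) x∈ in inj₂ (x , x∈A , x∈∁p⇒x∉p x∈∁B)
... | no empty = inj₁ λ {x} x∈A → case x ∈? B of λ where
  (yes x∈B) → x∈B
  (no x∉B)  → contradiction (x , x∈p∩q⁺ (x∈A , x∉p⇒x∈∁p x∉B)) empty

max-upper : (g : A → ℕ) {x : A} {xs : List A} → x List.∈ xs → g x ≤ foldr _⊔_ 0 (List.map g xs)
max-upper g (here refl)             = ℕ.m≤m⊔n _ _
max-upper g {xs = y ∷ xs} (there x∈) = ℕ.≤-trans (max-upper g x∈) (ℕ.m≤n⊔m (g y) _)

max-attained : (g : A → ℕ) (xs : List A) → foldr _⊔_ 0 (List.map g xs) ≡ 0 ⊎
               ∃[ x ] x List.∈ xs × g x ≡ foldr _⊔_ 0 (List.map g xs)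
max-attained g [] = inj₁ refl
max-attained g (x ∷ xs) with ℕ.⊔-sel (g x) (foldr _⊔_ 0 (List.map g xs))
... | inj₁ e = inj₂ (x , here refl , sym e)
... | inj₂ e rewrite e with max-attained g xs
...   | inj₁ z = inj₁ z
...   | inj₂ (y , y∈ , e′) = inj₂ (y , there y∈ , e′)

subsets-complete : (S : Subset n) → S List.∈ subsets n
subsets-complete []            = here refl
subsets-complete (outside ∷ S) = ∈-++⁺ˡ (∈-map⁺ (outside ∷_) (subsets-complete S))
subsets-complete {suc n} (inside ∷ S) =
  ∈-++⁺ʳ (List.map (outside ∷_) (subsets n)) (∈-map⁺ (inside ∷_) (subsets-complete S))

-- Independence and rank

module _ {E : GroundSet} (M : Matroid E) where
  open Matroid M

  private
    Sub : Set
    Sub = Subset (size E)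

  ∣exchange∣ : (A : Sub) {a b : Fin (size E)} → a ∈ A → b ∉ A → ∣ (A - a) ∪ ⁅ b ⁆ ∣ ≡ ∣ A ∣
  ∣exchange∣ A {a} a∈A b∉A = trans (∣∪⁅⁆∣ (A - a) (b∉A ∘ -⇒∈ A)) (∣-∣ A a∈A)

  private
    -- Induction on the number of elements of `A` outside `B`, bounded by `m`: an exchange trades
    -- such an element for one of `B`, which keeps the size of `A` and lowers this number.
    basis-≤′ : ∀ m {A B : Sub} → IsBasis A → IsBasis B → ∣ A ∩ ∁ B ∣ ≤ m → ∣ A ∣ ≤ ∣ B ∣
    basis-≤′ m {A} {B} bA bB ≤m with ⊆-or-witness A B
    ... | inj₁ A⊆B = p⊆q⇒∣p∣≤∣q∣ A⊆B
    ... | inj₂ (a , a∈A , a∉B) with exchange bA bB a∈A a∉B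
    ...   | b , b∈B , b∉A , bA′ = lemma m ≤m
      where
      A′ = (A - a) ∪ ⁅ b ⁆
      sub : A′ ∩ ∁ B ⊆ A ∩ ∁ B
      sub x∈ with x∈p∩q⁻ A′ (∁ B) x∈
      ... | x∈A′ , x∈∁B with x∈p∪q⁻ (A - a) ⁅ b ⁆ x∈A′
      ...   | inj₁ x∈A-a = x∈p∩q⁺ (-⇒∈ A x∈A-a , x∈∁B)
      ...   | inj₂ x∈b rewrite x∈⁅y⁆⇒x≡y b x∈b = contradiction b∈B (x∈∁p⇒x∉p x∈∁B)
      a∉ : a ∉ A′ ∩ ∁ B
      a∉ a∈ with x∈p∪q⁻ (A - a) ⁅ b ⁆ (proj₁ (x∈p∩q⁻ A′ (∁ B) a∈))
      ... | inj₁ a∈A-a = ∉- A a a∈A-a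
      ... | inj₂ a∈b   = b∉A (subst (_∈ A) (x∈⁅y⁆⇒x≡y b a∈b) a∈A)
      smaller : ∣ A′ ∩ ∁ B ∣ < ∣ A ∩ ∁ B ∣
      smaller = p⊂q⇒∣p∣<∣q∣ (sub , a , x∈p∩q⁺ (a∈A , x∉p⇒x∈∁p a∉B) , a∉)
      lemma : ∀ m → ∣ A ∩ ∁ B ∣ ≤ m → ∣ A ∣ ≤ ∣ B ∣
      lemma zero    ≤0 = contradiction (ℕ.<-≤-trans smaller ≤0) λ ()
      lemma (suc m) ≤m = subst (_≤ ∣ B ∣) (∣exchange∣ A a∈A b∉A)
        (basis-≤′ m bA′ bB (ℕ.s≤s⁻¹ (ℕ.<-≤-trans smaller ≤m)))

  basis-equicardinal : ∀ {A B : Sub} → IsBasis A → IsBasis B → ∣ A ∣ ≡ ∣ B ∣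
  basis-equicardinal bA bB = ℕ.≤-antisym (basis-≤′ _ bA bB ℕ.≤-refl) (basis-≤′ _ bB bA ℕ.≤-refl)

  -- Exchange the elements outside J ∪ A for elements of A.
  basis-between : ∀ m {J A B : Sub} → IsBasis A → IsBasis B → J ⊆ B → ∣ B ∩ ∁ (J ∪ A) ∣ ≤ m →
                  ∃[ B′ ] IsBasis B′ × J ⊆ B′ × B′ ⊆ J ∪ A
  basis-between m {J} {A} {B} bA bB J⊆B ≤m with ⊆-or-witness B (J ∪ A)
  ... | inj₁ B⊆ = B , bB , J⊆B , B⊆
  ... | inj₂ (x , x∈B , x∉J∪A) with exchange bB bA x∈B (x∉J∪A ∘ q⊆p∪q J A)
  ...   | y , y∈A , y∉B , bB′ = lemma m ≤m
    where
    B′ = (B - x) ∪ ⁅ y ⁆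
    J⊆B′ : J ⊆ B′
    J⊆B′ {z} z∈J = ⊆-insert (B - x) y (x∈p∧x≢y⇒x∈p-y (J⊆B z∈J)
      λ { refl → x∉J∪A (p⊆p∪q A z∈J) })
    sub : B′ ∩ ∁ (J ∪ A) ⊆ B ∩ ∁ (J ∪ A)
    sub z∈ with x∈p∩q⁻ B′ (∁ (J ∪ A)) z∈
    ... | z∈B′ , z∈∁ with x∈p∪q⁻ (B - x) ⁅ y ⁆ z∈B′
    ...   | inj₁ z∈B-x = x∈p∩q⁺ (-⇒∈ B z∈B-x , z∈∁)
    ...   | inj₂ z∈y rewrite x∈⁅y⁆⇒x≡y y z∈y = contradiction (q⊆p∪q J A y∈A) (x∈∁p⇒x∉p z∈∁)
    x∉ : x ∉ B′ ∩ ∁ (J ∪ A)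
    x∉ x∈ with x∈p∪q⁻ (B - x) ⁅ y ⁆ (proj₁ (x∈p∩q⁻ B′ (∁ (J ∪ A)) x∈))
    ... | inj₁ x∈B-x = ∉- B x x∈B-x
    ... | inj₂ x∈y   = y∉B (subst (_∈ B) (x∈⁅y⁆⇒x≡y y x∈y) x∈B)
    smaller : ∣ B′ ∩ ∁ (J ∪ A) ∣ < ∣ B ∩ ∁ (J ∪ A) ∣
    smaller = p⊂q⇒∣p∣<∣q∣ (sub , x , x∈p∩q⁺ (x∈B , x∉p⇒x∈∁p x∉J∪A) , x∉)
    lemma : ∀ m → ∣ B ∩ ∁ (J ∪ A) ∣ ≤ m → ∃[ B′ ] IsBasis B′ × J ⊆ B′ × B′ ⊆ J ∪ A
    lemma zero    ≤0 = contradiction (ℕ.<-≤-trans smaller ≤0) λ ()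
    lemma (suc m) ≤m = basis-between m bA bB′ J⊆B′ (ℕ.s≤s⁻¹ (ℕ.<-≤-trans smaller ≤m))

  -- Take bases `A ⊇ I` and `B` with `J ⊆ B ⊆ J ∪ A`. An element of `J ∩ A` outside `I` can be added
  -- at once. If some `x` in `A` lies outside `B ∪ I`, exchanging it brings in some `y` of `B`
  -- outside `A`; it lies in `J`, and `I` with `y` is inside the new basis. Otherwise `D = A ∩ ∁ I`
  -- lies in `B` and misses `J`, so `|J| + |D| ≤ |B| = |A| ≤ |I| + |D|`, a contradiction.
  augmentation : ∀ {I J : Sub} → Independent M I → Independent M J → ∣ I ∣ < ∣ J ∣ →
                 ∃[ e ] e ∈ J × e ∉ I × Independent M (I ∪ ⁅ e ⁆)
  augmentation {I} {J} (A , bA , I⊆A) (B₀ , bB₀ , J⊆B₀) ∣I∣<∣J∣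
    with basis-between _ bA bB₀ J⊆B₀ ℕ.≤-refl
  ... | B , bB , J⊆B , B⊆J∪A with ⊆-or-witness (J ∩ A) I
  ...   | inj₂ (e , e∈ , e∉I) = let e∈J , e∈A = x∈p∩q⁻ J A e∈ in
          e , e∈J , e∉I , A , bA , insert-⊆ I⊆A e∈A
  ...   | inj₁ J∩A⊆I with ⊆-or-witness A (B ∪ I)
  ...     | inj₂ (x , x∈A , x∉) with exchange bA bB x∈A (x∉ ∘ p⊆p∪q I)
  ...       | y , y∈B , y∉A , bA′ = y , y∈J , y∉A ∘ I⊆A , _ , bA′ ,
              insert-⊆ (λ {z} z∈I → ⊆-insert (A - x) y (x∈p∧x≢y⇒x∈p-y (I⊆A z∈I) λ { refl → x∉ (q⊆p∪q B I z∈I) }))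
                       (∈-insert (A - x) y)
    where
    y∈J : y ∈ J
    y∈J = [ (λ p → p) , (λ y∈A → contradiction y∈A y∉A) ]′ (x∈p∪q⁻ J A (B⊆J∪A y∈B))
  augmentation {I} {J} (A , bA , I⊆A) (B₀ , bB₀ , J⊆B₀) ∣I∣<∣J∣
      | B , bB , J⊆B , B⊆J∪A | inj₁ J∩A⊆I | inj₁ A⊆B∪I =
    contradiction ∣I∣<∣J∣ (ℕ.≤⇒≯ (ℕ.+-cancelʳ-≤ (∣ D ∣) (∣ J ∣) (∣ I ∣) (begin
      ∣ J ∣ + ∣ D ∣                  ≡⟨ ∣∪∣+∣∩∣ J D ⟨
      ∣ J ∪ D ∣ + ∣ J ∩ D ∣          ≤⟨ ℕ.+-mono-≤ (p⊆q⇒∣p∣≤∣q∣ J∪D⊆B) (p⊆q⇒∣p∣≤∣q∣ {q = ⊥} J∩D⊆⊥) ⟩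
      ∣ B ∣ + ∣ ⊥ {n = size E} ∣     ≡⟨ cong₂ _+_ (basis-equicardinal bB bA) (∣⊥∣≡0 (size E)) ⟩
      ∣ A ∣ + 0                      ≡⟨ ℕ.+-identityʳ ∣ A ∣ ⟩
      ∣ A ∣                          ≤⟨ p⊆q⇒∣p∣≤∣q∣ A⊆I∪D ⟩
      ∣ I ∪ D ∣                      ≤⟨ ℕ.m≤m+n (∣ I ∪ D ∣) (∣ I ∩ D ∣) ⟩
      ∣ I ∪ D ∣ + ∣ I ∩ D ∣          ≡⟨ ∣∪∣+∣∩∣ I D ⟩
      ∣ I ∣ + ∣ D ∣                  ∎)))
    where
    open ℕ.≤-Reasoning
    D = A ∩ ∁ I
    J∪D⊆B : J ∪ D ⊆ B
    J∪D⊆B x∈ with x∈p∪q⁻ J D x∈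
    ... | inj₁ x∈J = J⊆B x∈J
    ... | inj₂ x∈D with x∈p∩q⁻ A (∁ I) x∈D
    ...   | x∈A , x∈∁I = [ (λ p → p) , (λ x∈I → contradiction x∈I (x∈∁p⇒x∉p x∈∁I)) ]′ (x∈p∪q⁻ B I (A⊆B∪I x∈A))
    J∩D⊆⊥ : J ∩ D ⊆ ⊥
    J∩D⊆⊥ x∈ with x∈p∩q⁻ J D x∈
    ... | x∈J , x∈D with x∈p∩q⁻ A (∁ I) x∈D
    ...   | x∈A , x∈∁I = contradiction (J∩A⊆I (x∈p∩q⁺ (x∈J , x∈A))) (x∈∁p⇒x∉p x∈∁I)
    A⊆I∪D : A ⊆ I ∪ D
    A⊆I∪D {x} x∈A with x ∈? I
    ... | yes x∈I = p⊆p∪q D x∈I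
    ... | no x∉I  = q⊆p∪q I D (x∈p∩q⁺ (x∈A , x∉p⇒x∈∁p x∉I))

  ⊥-independent : Independent M ⊥
  ⊥-independent = let B , bB = nonempty in B , bB , ⊥⊆

  independent-⊆ : ∀ {I J : Sub} → I ⊆ J → Independent M J → Independent M I
  independent-⊆ I⊆J (B , bB , J⊆B) = B , bB , λ x∈ → J⊆B (I⊆J x∈)

  ∣independent∣≤rank : ∀ {I S : Sub} → Independent M I → I ⊆ S → ∣ I ∣ ≤ rank M S
  ∣independent∣≤rank {I} {S} indI I⊆S = max-upper ∣_∣
    (∈-filter⁺ (λ I → independent? M I ×-dec I ⊆? S) (subsets-complete I) (indI , I⊆S))

  rank-witness : ∀ S → ∃[ I ] Independent M I × I ⊆ S × ∣ I ∣ ≡ rank M S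
  rank-witness S with max-attained ∣_∣ (filter (λ I → independent? M I ×-dec I ⊆? S) (subsets (size E)))
  ... | inj₁ e = ⊥ , ⊥-independent , ⊥⊆ , trans (∣⊥∣≡0 (size E)) (sym e)
  ... | inj₂ (I , I∈ , e) with ∈-filter⁻ (λ I → independent? M I ×-dec I ⊆? S) {xs = subsets (size E)} I∈
  ...   | _ , indI , I⊆S = I , indI , I⊆S , e

  private
    extend : ∀ k {I S : Sub} → Independent M I → I ⊆ S → rank M S ≤ ∣ I ∣ + k →
             ∃[ J ] Independent M J × I ⊆ J × J ⊆ S × ∣ J ∣ ≡ rank M S
    extend k {I} {S} indI I⊆S ≤k with ∣ I ∣ ℕ.<? rank M S
    ... | no ≮ = I , indI , (λ x → x) , I⊆S , ℕ.≤-antisym (∣independent∣≤rank indI I⊆S) (ℕ.≮⇒≥ ≮)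
    ... | yes I<r with rank-witness S
    ...   | K , indK , K⊆S , ∣K∣≡ with augmentation indI indK (subst (∣ I ∣ <_) (sym ∣K∣≡) I<r)
    ...     | e , e∈K , e∉I , indI′ = lemma k ≤k
      where
      lemma : ∀ k → rank M S ≤ ∣ I ∣ + k → ∃[ J ] Independent M J × I ⊆ J × J ⊆ S × ∣ J ∣ ≡ rank M S
      lemma zero ≤k = contradiction I<r (ℕ.≤⇒≯ (subst (rank M S ≤_) (ℕ.+-identityʳ ∣ I ∣) ≤k))
      lemma (suc k) ≤k with extend k indI′ (insert-⊆ I⊆S (K⊆S e∈K))
        (subst (rank M S ≤_) (trans (ℕ.+-suc ∣ I ∣ k) (sym (cong (_+ k) (∣∪⁅⁆∣ I e∉I)))) ≤k)
      ... | J , indJ , I′⊆J , J⊆S , e = J , indJ , (λ x → I′⊆J (⊆-insert I _ x)) , J⊆S , e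

  extend-independent : ∀ {I S : Sub} → Independent M I → I ⊆ S →
                       ∃[ J ] Independent M J × I ⊆ J × J ⊆ S × ∣ J ∣ ≡ rank M S
  extend-independent {I} {S} indI I⊆S = extend (rank M S) indI I⊆S (ℕ.m≤n+m (rank M S) ∣ I ∣)

  rank-mono : ∀ {S T : Sub} → S ⊆ T → rank M S ≤ rank M T
  rank-mono {S} S⊆T with rank-witness S
  ... | I , indI , I⊆S , e = subst (_≤ _) e (∣independent∣≤rank indI λ x → S⊆T (I⊆S x))

  rank≤∣∣ : ∀ S → rank M S ≤ ∣ S ∣
  rank≤∣∣ S with rank-witness S
  ... | I , indI , I⊆S , e = subst (_≤ _) e (p⊆q⇒∣p∣≤∣q∣ I⊆S)

  rank-⊥ : rank M ⊥ ≡ 0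
  rank-⊥ = ℕ.n≤0⇒n≡0 (subst (rank M ⊥ ≤_) (∣⊥∣≡0 (size E)) (rank≤∣∣ ⊥))

  -- Extend a maximal independent subset `I` of `S ∩ T` to a maximal one `J` of `S ∪ T`, and count
  -- `J ∩ S` and `J ∩ T`: their union contains `J` and their intersection contains `I`.
  rank-submodular : ∀ S T → rank M (S ∪ T) + rank M (S ∩ T) ≤ rank M S + rank M T
  rank-submodular S T with rank-witness (S ∩ T)
  ... | I , indI , I⊆ , ∣I∣ with extend-independent indI (λ x → p⊆p∪q T (proj₁ (x∈p∩q⁻ S T (I⊆ x))))
  ...   | J , indJ , I⊆J , J⊆ , ∣J∣ = begin
    rank M (S ∪ T) + rank M (S ∩ T)              ≡⟨ cong₂ _+_ ∣J∣ ∣I∣ ⟨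
    ∣ J ∣ + ∣ I ∣                                ≤⟨ ℕ.+-mono-≤ (p⊆q⇒∣p∣≤∣q∣ J⊆′) (p⊆q⇒∣p∣≤∣q∣ I⊆′) ⟩
    ∣ (J ∩ S) ∪ (J ∩ T) ∣ + ∣ (J ∩ S) ∩ (J ∩ T) ∣ ≡⟨ ∣∪∣+∣∩∣ (J ∩ S) (J ∩ T) ⟩
    ∣ J ∩ S ∣ + ∣ J ∩ T ∣                        ≤⟨ ℕ.+-mono-≤ (part S) (part T) ⟩
    rank M S + rank M T                          ∎
    where
    open ℕ.≤-Reasoning
    part : ∀ U → ∣ J ∩ U ∣ ≤ rank M U
    part U = ∣independent∣≤rank (independent-⊆ (p∩q⊆p J U) indJ) (p∩q⊆q J U)
    J⊆′ : J ⊆ (J ∩ S) ∪ (J ∩ T)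
    J⊆′ x∈J with x∈p∪q⁻ S T (J⊆ x∈J)
    ... | inj₁ x∈S = p⊆p∪q (J ∩ T) (x∈p∩q⁺ (x∈J , x∈S))
    ... | inj₂ x∈T = q⊆p∪q (J ∩ S) (J ∩ T) (x∈p∩q⁺ (x∈J , x∈T))
    I⊆′ : I ⊆ (J ∩ S) ∩ (J ∩ T)
    I⊆′ x∈I with x∈p∩q⁻ S T (I⊆ x∈I)
    ... | x∈S , x∈T = x∈p∩q⁺ (x∈p∩q⁺ (I⊆J x∈I , x∈S) , x∈p∩q⁺ (I⊆J x∈I , x∈T))

  rank-insert : ∀ S e → rank M (S ∪ ⁅ e ⁆) ≤ suc (rank M S)
  rank-insert S e = begin
    rank M (S ∪ ⁅ e ⁆)                          ≤⟨ ℕ.m≤m+n _ _ ⟩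
    rank M (S ∪ ⁅ e ⁆) + rank M (S ∩ ⁅ e ⁆)     ≤⟨ rank-submodular S ⁅ e ⁆ ⟩
    rank M S + rank M ⁅ e ⁆                     ≤⟨ ℕ.+-monoʳ-≤ (rank M S) (rank≤∣∣ ⁅ e ⁆) ⟩
    rank M S + ∣ ⁅ e ⁆ ∣                        ≡⟨ cong (λ x → rank M S + x) (∣⁅x⁆∣≡1 e) ⟩
    rank M S + 1                                ≡⟨ ℕ.+-comm (rank M S) 1 ⟩
    suc (rank M S)                              ∎
    where open ℕ.≤-Reasoning

  full-rank⇒independent : ∀ {I : Sub} → ∣ I ∣ ≤ rank M I → Independent M I
  full-rank⇒independent {I} ∣I∣≤ with rank-witness I
  ... | J , indJ , J⊆I , e = subst (Independent M) (⊆∧∣≥∣⇒≡ J⊆I (subst (∣ I ∣ ≤_) (sym e) ∣I∣≤)) indJ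

  ∣basis∣ : ∀ {B : Sub} → IsBasis B → ∣ B ∣ ≡ rank M ⊤
  ∣basis∣ {B} bB = ℕ.≤-antisym (∣independent∣≤rank (B , bB , λ x → x) ⊆⊤) ≤B
    where
    ≤B : rank M ⊤ ≤ ∣ B ∣
    ≤B with rank-witness ⊤
    ... | I , (B′ , bB′ , I⊆B′) , _ , e = subst₂ _≤_ e (basis-equicardinal bB′ bB) (p⊆q⇒∣p∣≤∣q∣ I⊆B′)

  spanning-independent⇒basis : ∀ {I : Sub} → Independent M I → rank M ⊤ ≤ ∣ I ∣ → IsBasis I
  spanning-independent⇒basis {I} (B , bB , I⊆B) r≤ =
    subst IsBasis (sym (⊆∧∣≥∣⇒≡ I⊆B (subst (_≤ ∣ I ∣) (sym (∣basis∣ bB)) r≤))) bB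

  closure : Sub → Sub
  closure S = ⟦ (λ e → rank M (S ∪ ⁅ e ⁆) ℕ.≤? rank M S) ⟧

  ⊆-closure : ∀ S → S ⊆ closure S
  ⊆-closure S {e} e∈S = ∈-⟦⟧⁺ (λ e → rank M (S ∪ ⁅ e ⁆) ℕ.≤? rank M S)
    (rank-mono (insert-⊆ (λ x → x) e∈S))

  -- Extend a maximal independent `I ⊆ S` to `J` inside the closure. A further element `e` of `J`
  -- would give an independent set of size `suc ∣ I ∣` in `S ∪ ⁅ e ⁆`, whose rank is only `∣ I ∣`.
  rank-closure : ∀ S → rank M (closure S) ≡ rank M S
  rank-closure S with rank-witness S
  ... | I , indI , I⊆S , ∣I∣ with extend-independent indI (λ x → ⊆-closure S (I⊆S x))
  ...   | J , indJ , I⊆J , J⊆cl , ∣J∣ = trans (sym ∣J∣) (trans (cong ∣_∣ (sym I≡J)) ∣I∣)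
    where
    J⊆I : J ⊆ I
    J⊆I {e} e∈J with e ∈? I
    ... | yes e∈I = e∈I
    ... | no e∉I  = contradiction
      (ℕ.≤-trans (ℕ.≤-reflexive (sym (∣∪⁅⁆∣ I e∉I)))
        (ℕ.≤-trans (∣independent∣≤rank (independent-⊆ (insert-⊆ I⊆J e∈J) indJ)
                      (insert-⊆ (λ x → ⊆-insert S e (I⊆S x)) (∈-insert S e)))
          (ℕ.≤-trans (∈-⟦⟧⁻ (λ e → rank M (S ∪ ⁅ e ⁆) ℕ.≤? rank M S) (J⊆cl e∈J)) (ℕ.≤-reflexive (sym ∣I∣)))))
      (ℕ.1+n≰n)
    I≡J : I ≡ J
    I≡J = ⊆-antisym I⊆J J⊆I

  closure-flat : ∀ S → Flat M (closure S)
  closure-flat S e e∉ = subst (_< rank M (closure S ∪ ⁅ e ⁆)) (sym (rank-closure S))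
    (ℕ.<-≤-trans
      (ℕ.≰⇒> (e∉ ∘ ∈-⟦⟧⁺ (λ e → rank M (S ∪ ⁅ e ⁆) ℕ.≤? rank M S)))
      (rank-mono (insert-⊆ (λ x → ⊆-insert (closure S) e (⊆-closure S x)) (∈-insert (closure S) e))))

-- Weights as modular functions; vectors with entries 0 and 1

weight-⊥ : (z : Vec ℤ n) → weight z ⊥ ≡ 0ℤ
weight-⊥ []      = refl
weight-⊥ (x ∷ z) = weight-⊥ z

weight-⁅⁆ : (z : Vec ℤ n) (e : Fin n) → weight z ⁅ e ⁆ ≡ lookup z e
weight-⁅⁆ (x ∷ z) zero    = trans (+-congˡ x (weight-⊥ z)) (ℤ.+-identityʳ x)
weight-⁅⁆ (x ∷ z) (suc e) = weight-⁅⁆ z e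

weight-⊤- : (z : Vec ℤ n) (e : Fin n) → lookup z e ℤ.+ weight z (⊤ - e) ≡ weight z ⊤
weight-⊤- (x ∷ z) zero    = cong (λ S → x ℤ.+ weight z S) (p─⊥≡p ⊤)
weight-⊤- (x ∷ z) (suc e) = trans
  (solve 3 (λ y x w → y :+ (x :+ w) := x :+ (y :+ w)) refl (lookup z e) x (weight z (⊤ - e)))
  (+-congˡ x (weight-⊤- z e))

weight-modular : (z : Vec ℤ n) (A B : Subset n) →
                 weight z (A ∪ B) ℤ.+ weight z (A ∩ B) ≡ weight z A ℤ.+ weight z B
weight-modular [] [] [] = refl
weight-modular (x ∷ z) (outside ∷ A) (outside ∷ B) = weight-modular z A B
weight-modular (x ∷ z) (outside ∷ A) (inside ∷ B)  = trans
  (ℤ.+-assoc x (weight z (A ∪ B)) (weight z (A ∩ B)))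
  (trans (+-congˡ x (weight-modular z A B))
  (solve 3 (λ x a b → x :+ (a :+ b) := a :+ (x :+ b)) refl x (weight z A) (weight z B)))
weight-modular (x ∷ z) (inside ∷ A) (outside ∷ B)  = trans
  (ℤ.+-assoc x (weight z (A ∪ B)) (weight z (A ∩ B)))
  (trans (+-congˡ x (weight-modular z A B)) (sym (ℤ.+-assoc x (weight z A) (weight z B))))
weight-modular (x ∷ z) (inside ∷ A) (inside ∷ B)   = trans
  (solve 3 (λ x a b → (x :+ a) :+ (x :+ b) := (x :+ x) :+ (a :+ b)) refl x (weight z (A ∪ B)) (weight z (A ∩ B)))
  (trans (+-congˡ (x ℤ.+ x) (weight-modular z A B))
  (solve 3 (λ x a b → (x :+ x) :+ (a :+ b) := (x :+ a) :+ (x :+ b)) refl x (weight z A) (weight z B)))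

weight-difference : (y z : Vec ℤ n) (S : Subset n) →
                    weight (Vec.zipWith ℤ._-_ y z) S ≡ weight y S ℤ.- weight z S
weight-difference [] [] [] = refl
weight-difference (x ∷ y) (x′ ∷ z) (outside ∷ S) = weight-difference y z S
weight-difference (x ∷ y) (x′ ∷ z) (inside ∷ S)  = trans
  (+-congˡ (x ℤ.- x′) (weight-difference y z S))
  (solve 4 (λ x x′ a b → (x :- x′) :+ (a :- b) := (x :+ a) :- (x′ :+ b)) refl x x′ (weight y S) (weight z S))

support : Vec ℤ n → Subset n
support = Vec.map (λ x → does (x ℤ.≟ 1ℤ))

module _ where
  private
    ∷-01 : ∀ {x} {z : Vec ℤ n} → (∀ e → lookup (x ∷ z) e ≡ 0ℤ ⊎ lookup (x ∷ z) e ≡ 1ℤ) →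
            ∀ e → lookup z e ≡ 0ℤ ⊎ lookup z e ≡ 1ℤ
    ∷-01 01z e = 01z (suc e)

  weight-support : (z : Vec ℤ n) → (∀ e → lookup z e ≡ 0ℤ ⊎ lookup z e ≡ 1ℤ) →
                   weight z (support z) ≡ + ∣ support z ∣
  weight-support [] _ = refl
  weight-support (x ∷ z) 01z with 01z zero
  ... | inj₁ refl = weight-support z (∷-01 {x = 0ℤ} 01z)
  ... | inj₂ refl = +-congˡ 1ℤ (weight-support z (∷-01 {x = 1ℤ} 01z))

  weight-⊤ : (z : Vec ℤ n) → (∀ e → lookup z e ≡ 0ℤ ⊎ lookup z e ≡ 1ℤ) →
             weight z ⊤ ≡ + ∣ support z ∣
  weight-⊤ [] _ = refl
  weight-⊤ (x ∷ z) 01z with 01z zero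
  ... | inj₁ refl = trans (ℤ.+-identityˡ _) (weight-⊤ z (∷-01 {x = 0ℤ} 01z))
  ... | inj₂ refl = +-congˡ 1ℤ (weight-⊤ z (∷-01 {x = 1ℤ} 01z))

  lookup-support : (z : Vec ℤ n) → (∀ e → lookup z e ≡ 0ℤ ⊎ lookup z e ≡ 1ℤ) →
                   ∀ e → lookup z e ≡ χ (lookup (support z) e)
  lookup-support z 01z e rewrite lookup-map e (λ x → does (x ℤ.≟ 1ℤ)) z with lookup z e | 01z e
  ... | _ | inj₁ refl = refl
  ... | _ | inj₂ refl = refl

-- Integer decomposition of dilated base polytopes

0≤x≤1 : ∀ {x} → 0ℤ ℤ.≤ x → x ℤ.≤ 1ℤ → x ≡ 0ℤ ⊎ x ≡ 1ℤ
0≤x≤1 {+ 0} _ _ = inj₁ refl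
0≤x≤1 {+ 1} _ _ = inj₂ refl
0≤x≤1 {+ suc (suc _)} _ (ℤ.+≤+ (s≤s ()))

-- The inequality that makes `p f - w` submodular for submodular `f` and modular `w`; the function
-- `h` behind `split-off` and the function `excess` are of this form.
scaled-difference : ∀ p .{{_ : ℤ.NonNegative p}} {a b u i wa wb wu wi} →
  u ℤ.+ i ℤ.≤ a ℤ.+ b → wu ℤ.+ wi ≡ wa ℤ.+ wb →
  (p ℤ.* u ℤ.- wu) ℤ.+ (p ℤ.* i ℤ.- wi) ℤ.≤ (p ℤ.* a ℤ.- wa) ℤ.+ (p ℤ.* b ℤ.- wb)
scaled-difference p {a} {b} {u} {i} {wa} {wb} {wu} {wi} u+i≤a+b w≡ = subst₂ ℤ._≤_
  (trans (cong (ℤ._-_ (p ℤ.* (u ℤ.+ i))) (sym w≡))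
    (solve 5 (λ p u i wu wi → p :* (u :+ i) :- (wu :+ wi) := (p :* u :- wu) :+ (p :* i :- wi)) refl p u i wu wi))
  (solve 5 (λ p a b wa wb → p :* (a :+ b) :- (wa :+ wb) := (p :* a :- wa) :+ (p :* b :- wb)) refl p a b wa wb)
  (ℤ.+-monoˡ-≤ (ℤ.- (wa ℤ.+ wb)) (ℤ.*-monoˡ-≤-nonNeg p u+i≤a+b))

suc-* : ∀ p r → (1ℤ ℤ.+ p) ℤ.* r ≡ r ℤ.+ p ℤ.* r
suc-* = solve 2 (λ p r → (con 1ℤ :+ p) :* r := r :+ p :* r) refl

x≡w+[x-w] : ∀ x w → x ≡ w ℤ.+ (x ℤ.- w)
x≡w+[x-w] = solve 2 (λ x w → x := w :+ (x :- w)) refl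

module _ (p : ℤ) .{{_ : ℤ.NonNegative p}} (f : Subset n → ℤ) (f-submodular : Submodular f) (f⊥ : f ⊥ ≡ 0ℤ)
         (y : Vec ℤ n) (upper : ∀ S → weight y S ℤ.≤ f S ℤ.+ p ℤ.* f S)
         (total : weight y ⊤ ≡ f ⊤ ℤ.+ p ℤ.* f ⊤) where

  private
    h : Subset n → ℤ
    h S = p ℤ.* f S ℤ.- weight y S

    sandwiched : ∃[ w ] ∀ S → weight w S ℤ.≤ f S × ℤ.- weight w S ℤ.≤ h S
    sandwiched = sandwich f h f-submodular
      (λ A B → scaled-difference p {f A} {f B} {f (A ∪ B)} {f (A ∩ B)} (f-submodular A B) (weight-modular y A B))
      (ℤ.≤-reflexive f⊥)
      (ℤ.≤-reflexive (trans (cong₂ (λ r w → p ℤ.* r ℤ.- w) f⊥ (weight-⊥ y))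
        (trans (ℤ.+-identityʳ (p ℤ.* 0ℤ)) (ℤ.*-zeroʳ p))))
      (λ S → subst (0ℤ ℤ.≤_) (ℤ.+-assoc (f S) (p ℤ.* f S) (ℤ.- weight y S)) (ℤ.i≤j⇒0≤j-i (upper S)))

    w = proj₁ sandwiched
    y′ = Vec.zipWith ℤ._-_ y w

    upper-w : ∀ S → weight w S ℤ.≤ f S
    upper-w S = proj₁ (proj₂ sandwiched S)

    upper-y′ : ∀ S → weight y′ S ℤ.≤ p ℤ.* f S
    upper-y′ S = ≤-cert (ℤ.i≤j⇒0≤j-i (proj₂ (proj₂ sandwiched S)))
      (trans (solve 3 (λ r y w → (r :- y) :- (:- w) := r :- (y :- w)) refl (p ℤ.* f S) (weight y S) (weight w S))
        (cong (λ x → p ℤ.* f S ℤ.- x) (sym (weight-difference y w S))))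

    total-sum : weight w ⊤ ℤ.+ weight y′ ⊤ ≡ f ⊤ ℤ.+ p ℤ.* f ⊤
    total-sum = trans (+-congˡ (weight w ⊤) (weight-difference y w ⊤))
      (trans (sym (x≡w+[x-w] (weight y ⊤) (weight w ⊤))) total)

    -- Both upper bounds are attained because their sum is.
    total-w : weight w ⊤ ≡ f ⊤
    total-w = ℤ.≤-antisym (upper-w ⊤) (≤-cert (ℤ.i≤j⇒0≤j-i (upper-y′ ⊤))
      (trans (solve 3 (λ a b c → c :- b := (a :+ c) :- (a :+ b)) refl
          (weight w ⊤) (weight y′ ⊤) (p ℤ.* f ⊤))
        (trans (cong (λ x → (weight w ⊤ ℤ.+ p ℤ.* f ⊤) ℤ.- x) total-sum)
          (solve 3 (λ a c d → (a :+ c) :- (d :+ c) := a :- d) refl (weight w ⊤) (p ℤ.* f ⊤) (f ⊤)))))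

    total-y′ : weight y′ ⊤ ≡ p ℤ.* f ⊤
    total-y′ = trans
      (solve 2 (λ a b → b := (a :+ b) :- a) refl (weight w ⊤) (weight y′ ⊤))
      (trans (cong₂ ℤ._-_ total-sum total-w)
        (solve 2 (λ a b → (a :+ b) :- a := b) refl (f ⊤) (p ℤ.* f ⊤)))

  -- Consistency of `f` with `h = p f - y` is exactly the upper bound on `y`, and the lower bound
  -- `- h ≤ w` is the upper bound `p f` for what remains of `y`.
  split-off : ∃[ w ] ((∀ S → weight w S ℤ.≤ f S) × weight w ⊤ ≡ f ⊤) ×
                     ((∀ S → weight (Vec.zipWith ℤ._-_ y w) S ℤ.≤ p ℤ.* f S) ×
                      weight (Vec.zipWith ℤ._-_ y w) ⊤ ≡ p ℤ.* f ⊤)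
  split-off = w , (upper-w , total-w) , (upper-y′ , total-y′)

module _ {E : GroundSet} (M : Matroid E) where
  open Matroid M

  rankℤ : Subset (size E) → ℤ
  rankℤ S = + rank M S

  rankℤ-submodular : Submodular rankℤ
  rankℤ-submodular A B = ℤ.+≤+ (rank-submodular M A B)

  -- The points of q times the base polytope.
  InDilate : ℕ → Vec ℤ (size E) → Set
  InDilate q y = (∀ S → weight y S ℤ.≤ + q ℤ.* rankℤ S) × weight y ⊤ ≡ + q ℤ.* rankℤ ⊤

  inDilate? : ∀ q y → Dec (InDilate q y)
  inDilate? q y = allSubset? (λ S → weight y S ℤ.≤? + q ℤ.* rankℤ S) ×-dec (weight y ⊤ ℤ.≟ + q ℤ.* rankℤ ⊤)

  -- The entry at `e` is at most `rk {e} ≤ 1` and at least `rk E - rk (E - e) ≥ 0`. So `y` is the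
  -- indicator of a set whose size is at most its rank and equals the rank of `E`.
  integral-point⇒basis : ∀ y → (∀ S → weight y S ℤ.≤ rankℤ S) → weight y ⊤ ≡ rankℤ ⊤ →
                 ∃[ B ] IsBasis B × ∀ e → lookup y e ≡ χ (lookup B e)
  integral-point⇒basis y upper total = support y , basis , lookup-support y 01y
    where
    01y : ∀ e → lookup y e ≡ 0ℤ ⊎ lookup y e ≡ 1ℤ
    01y e = 0≤x≤1
      (≤-cert (ℤ.i≤j⇒0≤j-i (ℤ.≤-trans (upper (⊤ - e)) (ℤ.≤-trans (ℤ.+≤+ (rank-mono M {⊤ - e} {⊤} ⊆⊤)) (ℤ.≤-reflexive (sym total)))))
        (trans (cong (ℤ._- weight y (⊤ - e)) (sym (weight-⊤- y e)))
          (solve 2 (λ a b → (a :+ b) :- b := a :- con 0ℤ) refl (lookup y e) (weight y (⊤ - e)))))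
      (subst (ℤ._≤ 1ℤ) (weight-⁅⁆ y e)
        (ℤ.≤-trans (upper ⁅ e ⁆) (ℤ.+≤+ (ℕ.≤-trans (rank≤∣∣ M ⁅ e ⁆) (ℕ.≤-reflexive (∣⁅x⁆∣≡1 e))))))
    basis : IsBasis (support y)
    basis = spanning-independent⇒basis M
      (full-rank⇒independent M (ℤ.drop‿+≤+ (subst (ℤ._≤ rankℤ (support y)) (weight-support y 01y) (upper (support y)))))
      (ℕ.≤-reflexive (sym (ℤ.+-injective (trans (sym (weight-⊤ y 01y)) total))))

  Decomposition : ℕ → Vec ℤ (size E) → Set
  Decomposition q y = ∃ λ (B : Fin q → Subset (size E)) →
    (∀ j → IsBasis (B j)) × ∀ e → lookup y e ≡ sumℤ (λ j → χ (lookup (B j) e))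

  private
    add-basis : ∀ {q} y w → (∃[ B ] IsBasis B × ∀ e → lookup w e ≡ χ (lookup B e)) →
                Decomposition q (Vec.zipWith ℤ._-_ y w) → Decomposition (suc q) y
    add-basis y w (B₀ , basis₀ , w≡) (B , basis , y′≡) =
        (λ { zero → B₀ ; (suc j) → B j })
      , (λ { zero → basis₀ ; (suc j) → basis j })
      , λ e → trans
          (x≡w+[x-w] (lookup y e) (lookup w e))
          (cong₂ ℤ._+_ (w≡ e) (trans (sym (lookup-zipWith ℤ._-_ e y w)) (y′≡ e)))

  -- Integer decomposition: split off one basis at a time, the sandwich
  -- theorem providing an integral point between y - q rk and rk.
  decompose : ∀ q y → InDilate q y → Decomposition q y
  decompose zero y (upper , total) = (λ ()) , (λ ()) , λ e → ℤ.≤-antisym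
    (subst₂ ℤ._≤_ (weight-⁅⁆ y e) (ℤ.*-zeroˡ (rankℤ ⁅ e ⁆)) (upper ⁅ e ⁆))
    (≤-cert (ℤ.i≤j⇒0≤j-i (subst (weight y (⊤ - e) ℤ.≤_) (ℤ.*-zeroˡ (rankℤ (⊤ - e))) (upper (⊤ - e))))
      (trans (solve 2 (λ a b → con 0ℤ :- b := a :- (a :+ b)) refl (lookup y e) (weight y (⊤ - e)))
        (cong (λ x → lookup y e ℤ.- x) (trans (weight-⊤- y e) (trans total (ℤ.*-zeroˡ (rankℤ ⊤)))))))
  decompose (suc q) y (upper , total) =
    let w , (upper-w , total-w) , inDilate =
          split-off (+ q) rankℤ rankℤ-submodular (cong +_ (rank-⊥ M)) y
            (λ S → subst (weight y S ℤ.≤_) (suc-* (+ q) (rankℤ S)) (upper S))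
            (trans total (suc-* (+ q) (rankℤ ⊤)))
    in add-basis y w (integral-point⇒basis w upper-w total-w) (decompose q (Vec.zipWith ℤ._-_ y w) inDilate)

-- Membership of rational points in the base polytope

sum-χ*lookup : (S : Subset n) (y : Vec ℤ n) → sumℤ (λ e → χ (lookup S e) ℤ.* lookup y e) ≡ weight y S
sum-χ*lookup [] [] = refl
sum-χ*lookup (outside ∷ S) (x ∷ y) = trans (ℤ.+-identityˡ _) (sum-χ*lookup S y)
sum-χ*lookup (inside ∷ S) (x ∷ y)  = cong₂ ℤ._+_ (ℤ.*-identityˡ x) (sum-χ*lookup S y)

sum-χ*χ : (S B : Subset n) → sumℤ (λ e → χ (lookup S e) ℤ.* χ (lookup B e)) ≡ + ∣ S ∩ B ∣
sum-χ*χ [] [] = refl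
sum-χ*χ (outside ∷ S) (_ ∷ B)       = trans (ℤ.+-identityˡ _) (sum-χ*χ S B)
sum-χ*χ (inside ∷ S) (outside ∷ B)  = trans (ℤ.+-identityˡ _) (sum-χ*χ S B)
sum-χ*χ (inside ∷ S) (inside ∷ B)   = +-congˡ 1ℤ (sum-χ*χ S B)

sum-neg : (f g : Fin n → ℤ) → sumℤ (λ e → (ℤ.- f e) ℤ.* g e) ≡ ℤ.- sumℤ (λ e → f e ℤ.* g e)
sum-neg {zero}  f g = refl
sum-neg {suc n} f g = trans
  (cong₂ ℤ._+_ (sym (ℤ.neg-distribˡ-* (f zero) (g zero))) (sum-neg (f ∘ suc) (g ∘ suc)))
  (sym (ℤ.neg-distrib-+ (f zero ℤ.* g zero) _))

module _ (q : ℕ) .{{_ : ℕ.NonZero q}} where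

  ι-positive : ℚ.Positive (ι (+ q))
  ι-positive = ℚ.positive (ℚ.<-≤-trans (ℚ.positive⁻¹ 1ℚ) (ι-mono-≤ (ℤ.+≤+ (ℕ.>-nonZero⁻¹ q))))

  reciprocal : ℚ
  reciprocal = ℚ.1/_ (ι (+ q)) {{ℚ.pos⇒nonZero (ι (+ q)) {{ι-positive}}}}

  reciprocal-inverse : ι (+ q) ℚ.* reciprocal ≡ 1ℚ
  reciprocal-inverse = ℚ.*-inverseʳ (ι (+ q)) {{ℚ.pos⇒nonZero (ι (+ q)) {{ι-positive}}}}

  reciprocal-positive : 0ℚ ℚ.< reciprocal
  reciprocal-positive = ℚ.positive⁻¹ reciprocal {{ℚ.1/pos⇒pos (ι (+ q)) {{ι-positive}}}}

  ratio : Vec ℤ n → Point n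
  ratio y e = fromℚ (ι (lookup y e) ℚ.* reciprocal)

  module _ {E : GroundSet} (M : Matroid E) (y : Vec ℤ (size E)) where
    open Matroid M

    private
      linear-bound : basePolytope M (ratio y) → (w : Fin (size E) → ℤ) (m : ℤ) →
        (∀ B → IsBasis B → sumℤ (λ e → w e ℤ.* χ (lookup B e)) ℤ.≤ m) →
        sumℤ (λ e → w e ℤ.* lookup y e) ℤ.≤ + q ℤ.* m
      linear-bound y∈P w m w≤m = ι-cancel-≤ (begin
        ι (sumℤ (λ e → w e ℤ.* lookup y e))
          ≡⟨ ℚ.*-identityʳ _ ⟨
        ι (sumℤ (λ e → w e ℤ.* lookup y e)) ℚ.* 1ℚ
          ≡⟨ cong (ι (sumℤ (λ e → w e ℤ.* lookup y e)) ℚ.*_) (trans (ℚ.*-comm reciprocal (ι (+ q))) reciprocal-inverse) ⟨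
        ι (sumℤ (λ e → w e ℤ.* lookup y e)) ℚ.* (reciprocal ℚ.* ι (+ q))
          ≡⟨ ℚ.*-assoc (ι (sumℤ (λ e → w e ℤ.* lookup y e))) reciprocal (ι (+ q)) ⟨
        ι (sumℤ (λ e → w e ℤ.* lookup y e)) ℚ.* reciprocal ℚ.* ι (+ q)
          ≡⟨ cong (ℚ._* ι (+ q)) (trans (cong (ℚ._* reciprocal) (trans (ι-sum (λ e → w e ℤ.* lookup y e))
               (Σℚ.sum-cong-≗ (λ e → ι-* (w e) (lookup y e)))))
               (trans (Σℚ.*-distribʳ-sum reciprocal (λ e → ι (w e) ℚ.* ι (lookup y e)))
                 (Σℚ.sum-cong-≗ (λ e → ℚ.*-assoc (ι (w e)) (ι (lookup y e)) reciprocal)))) ⟩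
        sumℚ (λ e → ι (w e) ℚ.* (ι (lookup y e) ℚ.* reciprocal)) ℚ.* ι (+ q)
          ≤⟨ ℚ.*-monoʳ-≤-nonNeg (ι (+ q)) {{ℚ.pos⇒nonNeg (ι (+ q)) {{ι-positive}}}}
               (hull-bound IsBasis (λ e → ι (lookup y e) ℚ.* reciprocal) y∈P (ι ∘ w) (ι m)
                 λ B basis → subst (ℚ._≤ ι m)
                   (trans (ι-sum (λ e → w e ℤ.* χ (lookup B e))) (Σℚ.sum-cong-≗ (λ e → ι-* (w e) (χ (lookup B e)))))
                   (ι-mono-≤ (w≤m B basis))) ⟩
        ι m ℚ.* ι (+ q)
          ≡⟨ ι-* m (+ q) ⟨
        ι (m ℤ.* + q)
          ≡⟨ cong ι (ℤ.*-comm m (+ q)) ⟩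
        ι (+ q ℤ.* m) ∎)
        where open ℚ.≤-Reasoning

    basePolytope⇒inDilate : basePolytope M (ratio y) → InDilate M q y
    basePolytope⇒inDilate y∈P = upper , ℤ.≤-antisym (upper ⊤) lower
      where
      upper : ∀ S → weight y S ℤ.≤ + q ℤ.* rankℤ M S
      upper S = subst (ℤ._≤ + q ℤ.* rankℤ M S) (sum-χ*lookup S y)
        (linear-bound y∈P (χ ∘ lookup S) (rankℤ M S) λ B basis →
          ℤ.≤-trans (ℤ.≤-reflexive (sum-χ*χ S B))
            (ℤ.+≤+ (∣independent∣≤rank M (B , basis , p∩q⊆q S B) (p∩q⊆p S B))))
      -- All bases have size `rank M ⊤`, so the negated coordinate sum is bounded as well.
      lower : + q ℤ.* rankℤ M ⊤ ℤ.≤ weight y ⊤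
      lower = ℤ.neg-cancel-≤ (subst₂ ℤ._≤_
        (trans (sum-neg (χ ∘ lookup ⊤) (lookup y)) (cong ℤ.-_ (sum-χ*lookup ⊤ y)))
        (sym (ℤ.neg-distribʳ-* (+ q) (rankℤ M ⊤)))
        (linear-bound y∈P (λ e → ℤ.- χ (lookup ⊤ e)) (ℤ.- rankℤ M ⊤) λ B basis →
          ℤ.≤-reflexive (trans (sum-neg (χ ∘ lookup ⊤) (χ ∘ lookup B)) (cong ℤ.-_
            (trans (sum-χ*χ ⊤ B) (cong +_ (trans (cong ∣_∣ (∩-identityˡ B)) (∣basis∣ M basis))))))))

    -- A sum of `q` bases divided by `q` is their average, so all coefficients are `reciprocal` and
    -- the convex combination is exact at every index.
    inDilate⇒basePolytope : InDilate M q y → basePolytope M (ratio y)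
    inDilate⇒basePolytope inDilate with decompose M q y inDilate
    ... | B , basis , y≡ = q , (λ j → indicatorVector (B j)) , (λ _ → fromℚ reciprocal)
      , (λ j → B j , basis j , refl)
      , (λ j {ε} 0<ε → 0 , λ _ _ → ℚ.+-mono-< reciprocal-positive 0<ε)
      , ≗⇒≈ℝ {sumℝ {q} (λ _ → fromℚ reciprocal)} {1ℝ} (λ N → trans (seq-sum {q} (λ _ → fromℚ reciprocal) N)
          (trans (sum-const q) reciprocal-inverse))
      , λ e → ≗⇒≈ℝ {ratio y e} {sumℝ (λ j → fromℚ reciprocal *ℝ indicatorVector (B j) e)} λ N → begin
          ι (lookup y e) ℚ.* reciprocal
            ≡⟨ cong (λ z → ι z ℚ.* reciprocal) (y≡ e) ⟩
          ι (sumℤ (λ j → χ (lookup (B j) e))) ℚ.* reciprocal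
            ≡⟨ cong (ℚ._* reciprocal) (ι-sum (λ j → χ (lookup (B j) e))) ⟩
          sumℚ (λ j → ι (χ (lookup (B j) e))) ℚ.* reciprocal
            ≡⟨ ℚ.*-comm _ reciprocal ⟩
          reciprocal ℚ.* sumℚ (λ j → ι (χ (lookup (B j) e)))
            ≡⟨ Σℚ.*-distribˡ-sum reciprocal (λ j → ι (χ (lookup (B j) e))) ⟩
          sumℚ (λ j → reciprocal ℚ.* ι (χ (lookup (B j) e)))
            ≡⟨ Σℚ.sum-cong-≗ (λ j → cong (reciprocal ℚ.*_) (seq-indicator (B j) e N)) ⟨
          sumℚ (λ j → reciprocal ℚ.* seq (indicatorVector (B j) e) N)
            ≡⟨ seq-sum (λ j → fromℚ reciprocal *ℝ indicatorVector (B j) e) N ⟨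
          seq (sumℝ (λ j → fromℚ reciprocal *ℝ indicatorVector (B j) e)) N ∎
      where
      open ≡-Reasoning
      sum-const : ∀ k → sumℚ {k} (λ _ → reciprocal) ≡ ι (+ k) ℚ.* reciprocal
      sum-const zero    = sym (ℚ.*-zeroˡ reciprocal)
      sum-const (suc k) = trans (cong₂ ℚ._+_ (sym (ℚ.*-identityˡ reciprocal)) (sum-const k))
        (trans (sym (ℚ.*-distribʳ-+ reciprocal 1ℚ (ι (+ k)))) (cong (ℚ._* reciprocal) (sym (ι-+ 1ℤ (+ k)))))

    -- Supplies the decisions that the hypothesis of `IsValuation` asks for.
    basePolytope? : Dec (basePolytope M (ratio y))
    basePolytope? = map′ inDilate⇒basePolytope basePolytope⇒inDilate (inDilate? M q y)

-- Relations among indicator functions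

∑list : List A → (A → ℤ) → ℤ
∑list []       φ = 0ℤ
∑list (x ∷ xs) φ = φ x ℤ.+ ∑list xs φ

alt-* : ∀ c K φ → alt K (λ t → c ℤ.* φ t) ≡ c ℤ.* alt K φ
alt-* c zero    φ = refl
alt-* c (suc K) φ = trans (+-congˡ (c ℤ.* φ 0 ℤ.- c ℤ.* φ 1) (alt-* c K (φ ∘ (2 ℕ.+_))))
  (solve 4 (λ c a b r → (c :* a :- c :* b) :+ c :* r := c :* ((a :- b) :+ r)) refl
    c (φ 0) (φ 1) (alt K (φ ∘ (2 ℕ.+_))))

∑grid-* : ∀ c n K φ → ∑grid n K (λ z → c ℤ.* φ z) ≡ c ℤ.* ∑grid n K φ
∑grid-* c zero    K φ = refl
∑grid-* c (suc n) K φ = trans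
  (alt-cong K λ t → ∑grid-* c n (K ℕ.+ K) λ z → φ (+ t ℤ.* + 2^ n ∷ z))
  (alt-* c K λ t → ∑grid n (K ℕ.+ K) λ z → φ (+ t ℤ.* + 2^ n ∷ z))

sum-zero : {f : Fin n → ℤ} → (∀ i → f i ≡ 0ℤ) → sumℤ f ≡ 0ℤ
sum-zero {zero}  f≡0 = refl
sum-zero {suc n} f≡0 = cong₂ ℤ._+_ (f≡0 zero) (sum-zero (f≡0 ∘ suc))

sum-single : (f : Fin n → ℤ) (i : Fin n) → (∀ j → j ≢ i → f j ≡ 0ℤ) → sumℤ f ≡ f i
sum-single {suc n} f zero others = trans
  (+-congˡ (f zero) (sum-zero λ j → others (suc j) λ ())) (ℤ.+-identityʳ (f zero))
sum-single {suc n} f (suc i) others = trans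
  (cong₂ ℤ._+_ (others zero λ ()) (sum-single (f ∘ suc) i λ j j≢i → others (suc j) λ { refl → j≢i refl }))
  (ℤ.+-identityˡ (f (suc i)))

-- `Vanishes φ` says that the relation with coefficients `a` holds for the values `φ i` of some
-- function at the `i`-th matroid. The closure properties carry it from point evaluations to their
-- integral combinations.
module Linear {s} (a : Fin s → ℤ) where

  Vanishes : (Fin s → ℤ) → Set
  Vanishes φ = sumℤ (λ i → a i ℤ.* φ i) ≡ 0ℤ

  vanishes-cong : ∀ {φ ψ} → (∀ i → φ i ≡ ψ i) → Vanishes φ → Vanishes ψ
  vanishes-cong φ≗ψ vφ = trans (Σℤ.sum-cong-≗ (λ i → cong (a i ℤ.*_) (sym (φ≗ψ i)))) vφ

  vanishes-0 : Vanishes (λ _ → 0ℤ)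
  vanishes-0 = sum-zero (λ i → ℤ.*-zeroʳ (a i))

  vanishes-+ : ∀ {φ ψ} → Vanishes φ → Vanishes ψ → Vanishes (λ i → φ i ℤ.+ ψ i)
  vanishes-+ {φ} {ψ} vφ vψ = trans
    (trans (Σℤ.sum-cong-≗ (λ i → ℤ.*-distribˡ-+ (a i) (φ i) (ψ i)))
           (Σℤ.∑-distrib-+ (λ i → a i ℤ.* φ i) (λ i → a i ℤ.* ψ i)))
    (cong₂ ℤ._+_ vφ vψ)

  vanishes-* : ∀ c {φ} → Vanishes φ → Vanishes (λ i → c ℤ.* φ i)
  vanishes-* c {φ} vφ = trans
    (trans (Σℤ.sum-cong-≗ (λ i → solve 3 (λ a c x → a :* (c :* x) := c :* (a :* x)) refl (a i) c (φ i)))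
           (sym (Σℤ.*-distribˡ-sum c (λ i → a i ℤ.* φ i))))
    (trans (cong (c ℤ.*_) vφ) (ℤ.*-zeroʳ c))

  vanishes-- : ∀ {φ ψ} → Vanishes φ → Vanishes ψ → Vanishes (λ i → φ i ℤ.- ψ i)
  vanishes-- {φ} {ψ} vφ vψ = vanishes-+ {φ} vφ
    (vanishes-cong {λ i → ℤ.-1ℤ ℤ.* ψ i} (λ i → ℤ.-1*i≡-i (ψ i)) (vanishes-* ℤ.-1ℤ {ψ} vψ))

  vanishes-sum : ∀ {m} (φ : Fin m → Fin s → ℤ) → (∀ j → Vanishes (φ j)) → Vanishes (λ i → sumℤ (λ j → φ j i))
  vanishes-sum {zero}  φ vφ = vanishes-0
  vanishes-sum {suc m} φ vφ = vanishes-+ {φ zero} (vφ zero) (vanishes-sum (φ ∘ suc) (vφ ∘ suc))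

  vanishes-∑list : (xs : List A) (φ : A → Fin s → ℤ) → (∀ x → Vanishes (φ x)) → Vanishes (λ i → ∑list xs (λ x → φ x i))
  vanishes-∑list []       φ vφ = vanishes-0
  vanishes-∑list (x ∷ xs) φ vφ = vanishes-+ {φ x} (vφ x) (vanishes-∑list xs φ vφ)

  vanishes-alt : ∀ K (φ : ℕ → Fin s → ℤ) → (∀ t → Vanishes (φ t)) → Vanishes (λ i → alt K (λ t → φ t i))
  vanishes-alt zero    φ vφ = vφ 0
  vanishes-alt (suc K) φ vφ = vanishes-+ {λ i → φ 0 i ℤ.- φ 1 i} (vanishes-- {φ 0} {φ 1} (vφ 0) (vφ 1))
    (vanishes-alt K (φ ∘ (2 ℕ.+_)) (vφ ∘ (2 ℕ.+_)))

  vanishes-∑grid : ∀ n K (φ : Vec ℤ n → Fin s → ℤ) → (∀ z → Vanishes (φ z)) → Vanishes (λ i → ∑grid n K (λ z → φ z i))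
  vanishes-∑grid zero    K φ vφ = vφ []
  vanishes-∑grid (suc n) K φ vφ = vanishes-alt K (λ t i → ∑grid n (K ℕ.+ K) λ z → φ (+ t ℤ.* + 2^ n ∷ z) i)
    (λ t → vanishes-∑grid n (K ℕ.+ K) (λ z → φ (+ t ℤ.* + 2^ n ∷ z)) (λ z → vφ (+ t ℤ.* + 2^ n ∷ z)))

𝟙-× : (d : Dec A) (e : Dec B) → 𝟙 d ℤ.* 𝟙 e ≡ 𝟙 (d ×-dec e)
𝟙-× (yes _) (yes _) = refl
𝟙-× (yes _) (no _)  = refl
𝟙-× (no _)  (yes _) = refl
𝟙-× (no _)  (no _)  = refl

-- Chains of sets with levels

Comparable : Subset n → Subset n → Set
Comparable S T = S ⊆ T ⊎ T ⊆ S

peak : List (Subset n × ℕ) → Subset n → ℕ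
peak L A = foldr _⊔_ 0 (List.map proj₂ (filter (λ p → proj₁ p ⊆? A) L))

≤peak : ∀ {L : List (Subset n × ℕ)} {A S d} → (S , d) List.∈ L → S ⊆ A → d ℕ.≤ peak L A
≤peak {A = A} ∈L S⊆A = max-upper proj₂ (∈-filter⁺ (λ p → proj₁ p ⊆? A) ∈L S⊆A)

peak-attained : ∀ (L : List (Subset n × ℕ)) A →
                peak L A ≡ 0 ⊎ ∃[ S ] ∃[ d ] (S , d) List.∈ L × S ⊆ A × d ≡ peak L A
peak-attained L A with max-attained proj₂ (filter (λ p → proj₁ p ⊆? A) L)
... | inj₁ e = inj₁ e
... | inj₂ ((S , d) , ∈ , e) with ∈-filter⁻ (λ p → proj₁ p ⊆? A) {xs = L} ∈
...   | ∈L , S⊆A = inj₂ (S , d , ∈L , S⊆A , e)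

IsChain : List (Subset n × ℕ) → Set
IsChain L = ∀ p q → p List.∈ L → q List.∈ L → Comparable (proj₁ p) (proj₁ q)

-- Let `S ⊆ A` and `T ⊆ B` attain the two peaks. The larger of `S` and `T` lies in `A ∪ B` and the
-- smaller in `A ∩ B`, whichever of them has the higher level. A peak that is 0 by default adds
-- nothing, and the other one persists in `A ∪ B`.
peak-supermodular : ∀ (L : List (Subset n × ℕ)) →
  IsChain L →
  ∀ A B → peak L A ℕ.+ peak L B ℕ.≤ peak L (A ∪ B) ℕ.+ peak L (A ∩ B)
peak-supermodular L chain A B with peak-attained L A | peak-attained L B
... | inj₁ eA | inj₁ eB rewrite eA | eB = z≤n
... | inj₁ eA | inj₂ (T , e , T∈ , T⊆B , eB) rewrite eA | sym eB =
  ℕ.m≤n⇒m≤n+o _ (≤peak T∈ λ x → q⊆p∪q A B (T⊆B x))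
... | inj₂ (S , d , S∈ , S⊆A , eA) | inj₁ eB rewrite sym eA | eB | ℕ.+-identityʳ d =
  ℕ.m≤n⇒m≤n+o _ (≤peak S∈ λ x → p⊆p∪q B (S⊆A x))
... | inj₂ (S , d , S∈ , S⊆A , eA) | inj₂ (T , e , T∈ , T⊆B , eB) rewrite sym eA | sym eB
  with chain (S , d) (T , e) S∈ T∈
...   | inj₁ S⊆T = ℕ.≤-trans (ℕ.≤-reflexive (ℕ.+-comm d e)) (ℕ.+-mono-≤
        (≤peak T∈ λ x → q⊆p∪q A B (T⊆B x))
        (≤peak S∈ λ x → x∈p∩q⁺ (S⊆A x , T⊆B (S⊆T x))))
...   | inj₂ T⊆S = ℕ.+-mono-≤
        (≤peak S∈ λ x → p⊆p∪q B (S⊆A x))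
        (≤peak T∈ λ x → x∈p∩q⁺ (S⊆A (T⊆S x) , T⊆B x))

-- Plays the part of `h` in a pair `f , h`, whose lower bounds are `- h`, here `peak L`.
depth : List (Subset n × ℕ) → Subset n → ℤ
depth L S = ℤ.- + peak L S

depth-nonpos : ∀ (L : List (Subset n × ℕ)) S → depth L S ℤ.≤ 0ℤ
depth-nonpos L S = ℤ.neg-≤-pos {peak L S} {0}

depth-submodular : ∀ (L : List (Subset n × ℕ)) → IsChain L → Submodular (depth L)
depth-submodular L chain A B = subst₂ ℤ._≤_
  (ℤ.neg-distrib-+ (+ peak L (A ∪ B)) (+ peak L (A ∩ B)))
  (ℤ.neg-distrib-+ (+ peak L A) (+ peak L B))
  (ℤ.neg-mono-≤ (ℤ.+≤+ (peak-supermodular L chain A B)))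

-- Level conditions as counts in a translated dilate

weight-shift : (p : ℤ) (z : Vec ℤ n) (S : Subset n) →
               weight (Vec.map (ℤ._+ p) z) S ≡ weight z S ℤ.+ p ℤ.* + ∣ S ∣
weight-shift p [] [] = sym (trans (ℤ.+-identityˡ _) (ℤ.*-zeroʳ p))
weight-shift p (x ∷ z) (outside ∷ S) = weight-shift p z S
weight-shift p (x ∷ z) (inside ∷ S)  = trans (+-congˡ (x ℤ.+ p) (weight-shift p z S))
  (lemma x p (weight z S) (+ ∣ S ∣))
  where
  lemma : ∀ x p w c → (x ℤ.+ p) ℤ.+ (w ℤ.+ p ℤ.* c) ≡ (x ℤ.+ w) ℤ.+ p ℤ.* (1ℤ ℤ.+ c)
  lemma = solve 4 (λ x p w c → (x :+ p) :+ (w :+ p :* c) := (x :+ w) :+ p :* (con 1ℤ :+ c)) refl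

nonneg⇔≤ : ∀ {x c g} → (0ℤ ℤ.≤ (+ x ℤ.- + c) ℤ.+ ℤ.- + g → g ℕ.+ c ℕ.≤ x) ×
                        (g ℕ.+ c ℕ.≤ x → 0ℤ ℤ.≤ (+ x ℤ.- + c) ℤ.+ ℤ.- + g)
nonneg⇔≤ {x} {c} {g} =
    (λ p → ℤ.drop‿+≤+ (≤-cert p (lemma (+ x) (+ c) (+ g))))
  , (λ p → subst (0ℤ ℤ.≤_) (sym (lemma (+ x) (+ c) (+ g))) (ℤ.i≤j⇒0≤j-i (ℤ.+≤+ p)))
  where
  lemma : ∀ x c g → (x ℤ.- c) ℤ.+ ℤ.- g ≡ x ℤ.- (g ℤ.+ c)
  lemma = solve 3 (λ x c g → (x :- c) :+ :- g := x :- (g :+ c)) refl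

module _ (p : ℤ) .{{_ : ℤ.NonNegative p}} where
  private
    lemma : ∀ p d ρ c z → p ℤ.* (d ℤ.* ρ ℤ.- c) ℤ.- z ≡ (p ℤ.* d) ℤ.* ρ ℤ.- (z ℤ.+ p ℤ.* c)
    lemma = solve 5 (λ p d ρ c z → p :* (d :* ρ :- c) :- z := (p :* d) :* ρ :- (z :+ p :* c)) refl

  -- With `c = |S|`, adding `p` to every coordinate turns the bound `p (d rk S - |S|)` into the
  -- bound `(p d) rk S` of a dilated base polytope.
  shift-≤ : ∀ {d ρ c z} → z ℤ.≤ p ℤ.* (d ℤ.* ρ ℤ.- c) → z ℤ.+ p ℤ.* c ℤ.≤ (p ℤ.* d) ℤ.* ρ
  shift-≤ {d} {ρ} {c} {z} le = ≤-cert (ℤ.i≤j⇒0≤j-i le) (lemma p d ρ c z)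

  unshift-≤ : ∀ {d ρ c z} → z ℤ.+ p ℤ.* c ℤ.≤ (p ℤ.* d) ℤ.* ρ → z ℤ.≤ p ℤ.* (d ℤ.* ρ ℤ.- c)
  unshift-≤ {d} {ρ} {c} {z} le = ≤-cert (ℤ.i≤j⇒0≤j-i le) (sym (lemma p d ρ c z))

  -- Meant for `⊤`: once the level `g` there reaches the upper bound, the lower bound supplies the
  -- missing half of the equation for the whole ground set.
  total-lower : ∀ {d ρ c z g} → d ℤ.* ρ ℤ.- c ℤ.≤ g → ℤ.- z ℤ.≤ p ℤ.* (ℤ.- g) →
                (p ℤ.* d) ℤ.* ρ ℤ.≤ z ℤ.+ p ℤ.* c
  total-lower {d} {ρ} {c} {z} {g} le le′ = ≤-cert
    (ℤ.+-mono-≤ (ℤ.i≤j⇒0≤j-i le′) (ℤ.i≤j⇒0≤j-i (ℤ.*-monoˡ-≤-nonNeg p le)))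
    (solve 6 (λ p d ρ c z g → (p :* (:- g) :- (:- z)) :+ (p :* g :- p :* (d :* ρ :- c)) :=
        (z :+ p :* c) :- (p :* d) :* ρ) refl p d ρ c z g)

module _ {E : GroundSet} where

  private
    N = size E
    Sub = Subset N

  -- The scale is chosen larger than every cardinality.
  scale : ℕ
  scale = suc N

  module _ (M : Matroid E) where

    excess : Sub → ℤ
    excess S = + scale ℤ.* rankℤ M S ℤ.- + ∣ S ∣

    excess-submodular : Submodular excess
    excess-submodular A B = scaled-difference (+ scale)
      {rankℤ M A} {rankℤ M B} {rankℤ M (A ∪ B)} {rankℤ M (A ∩ B)}
      (rankℤ-submodular M A B) (cong +_ (∣∪∣+∣∩∣ A B))

    excess-⊥ : excess ⊥ ℤ.≤ 0ℤ
    excess-⊥ = ℤ.≤-reflexive (trans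
      (cong₂ (λ r c → + scale ℤ.* + r ℤ.- + c) (rank-⊥ M) (∣⊥∣≡0 N))
      (trans (ℤ.+-identityʳ (+ scale ℤ.* 0ℤ)) (ℤ.*-zeroʳ (+ scale))))

    excess-⁅⁆ : ∀ e → excess ⁅ e ⁆ ℤ.≤ + scale
    excess-⁅⁆ e = ℤ.≤-trans (ℤ.i≤j⇒i-k≤j (+ ∣ ⁅ e ⁆ ∣) ℤ.≤-refl)
      (ℤ.≤-trans (ℤ.*-monoˡ-≤-nonNeg (+ scale) (ℤ.+≤+ (ℕ.≤-trans (rank≤∣∣ M ⁅ e ⁆) (ℕ.≤-reflexive (∣⁅x⁆∣≡1 e)))))
        (ℤ.≤-reflexive (ℤ.*-identityʳ (+ scale))))

  -- The condition `d ≤ excess M A` on the supersets of `S`, kept in `ℕ` by moving `∣ A ∣` to the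
  -- left.
  Tail : Matroid E → Sub → ℕ → Set
  Tail M S d = ∀ A → S ⊆ A → d ℕ.+ ∣ A ∣ ℕ.≤ scale ℕ.* rank M A

  tail? : ∀ M S d → Dec (Tail M S d)
  tail? M S d = allSubset? λ A → (S ⊆? A) →-dec (d ℕ.+ ∣ A ∣ ℕ.≤? scale ℕ.* rank M A)

  module _ (M : Matroid E) where

    private
      consistent⇒peak : ∀ {L} → Consistent (excess M) (depth L) → ∀ A → peak L A ℕ.+ ∣ A ∣ ℕ.≤ scale ℕ.* rank M A
      consistent⇒peak {L} good A = proj₁ (nonneg⇔≤ {scale ℕ.* rank M A} {∣ A ∣} {peak L A})
        (subst (λ x → 0ℤ ℤ.≤ (x ℤ.- + ∣ A ∣) ℤ.+ depth L A) (sym (ℤ.pos-* scale (rank M A))) (good A))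

      peak⇒consistent : ∀ {L} → (∀ A → peak L A ℕ.+ ∣ A ∣ ℕ.≤ scale ℕ.* rank M A) → Consistent (excess M) (depth L)
      peak⇒consistent {L} good A =
        subst (λ x → 0ℤ ℤ.≤ (x ℤ.- + ∣ A ∣) ℤ.+ depth L A) (ℤ.pos-* scale (rank M A))
          (proj₂ (nonneg⇔≤ {scale ℕ.* rank M A} {∣ A ∣} {peak L A}) (good A))

    consistent⇒tail : ∀ {L S d} → (S , d) List.∈ L → Consistent (excess M) (depth L) → Tail M S d
    consistent⇒tail {L} ∈L good A S⊆A =
      ℕ.≤-trans (ℕ.+-monoˡ-≤ ∣ A ∣ (≤peak ∈L S⊆A)) (consistent⇒peak {L} good A)

    -- The default 0 of `peak` demands a nonnegative excess from every set, whatever `L` is. This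
    -- expresses that there are no loops: a loop would have excess -1.
    consistent⇒tail₀ : ∀ {L} → Consistent (excess M) (depth L) → Tail M ⊥ 0
    consistent⇒tail₀ {L} good A _ = ℕ.≤-trans (ℕ.m≤n+m ∣ A ∣ (peak L A)) (consistent⇒peak {L} good A)

    tails⇒consistent : ∀ {L} → Tail M ⊥ 0 → (∀ {S d} → (S , d) List.∈ L → Tail M S d) →
                       Consistent (excess M) (depth L)
    tails⇒consistent {L} tail₀ tails = peak⇒consistent {L} λ A → lemma A
      where
      lemma : ∀ A → peak L A ℕ.+ ∣ A ∣ ℕ.≤ scale ℕ.* rank M A
      lemma A with peak-attained L A
      ... | inj₁ e = subst (λ x → x ℕ.+ ∣ A ∣ ℕ.≤ scale ℕ.* rank M A) (sym e) (tail₀ A ⊥⊆)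
      ... | inj₂ (S , d , ∈L , S⊆A , e) = subst (λ x → x ℕ.+ ∣ A ∣ ℕ.≤ scale ℕ.* rank M A) e (tails ∈L A S⊆A)

    tail₀⇒loopless : Tail M ⊥ 0 → Loopless M
    tail₀⇒loopless tail₀ e loop = loop (full-rank⇒independent M
      (subst (ℕ._≤ rank M ⁅ e ⁆) (sym (∣⁅x⁆∣≡1 e)) (lemma (rank M ⁅ e ⁆) refl)))
      where
      lemma : ∀ r → rank M ⁅ e ⁆ ≡ r → 1 ℕ.≤ r
      lemma (suc r) _ = s≤s z≤n
      lemma zero eq = contradiction
        (subst₂ ℕ._≤_ (∣⁅x⁆∣≡1 e) (trans (cong (scale ℕ.*_) eq) (ℕ.*-zeroʳ scale)) (tail₀ ⁅ e ⁆ ⊥⊆)) λ ()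

    loopless⇒rank-pos : Loopless M → ∀ {A e} → e ∈ A → 1 ℕ.≤ rank M A
    loopless⇒rank-pos loopless {A} {e} e∈A with independent? M ⁅ e ⁆
    ... | no dep  = contradiction dep (loopless e)
    ... | yes ind = subst (ℕ._≤ rank M A) (∣⁅x⁆∣≡1 e)
      (∣independent∣≤rank M ind λ x → subst (_∈ A) (sym (x∈⁅y⁆⇒x≡y e x)) e∈A)

    loopless⇒tail₀ : Loopless M → Tail M ⊥ 0
    loopless⇒tail₀ loopless A _ with nonempty? A
    ... | yes (e , e∈A) = ℕ.≤-trans (∣p∣≤n A) (ℕ.≤-trans (ℕ.n≤1+n N)
            (ℕ.≤-trans (ℕ.≤-reflexive (sym (ℕ.*-identityʳ scale))) (ℕ.*-monoʳ-≤ scale (loopless⇒rank-pos loopless e∈A))))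
    ... | no empty rewrite Empty-unique empty | ∣⊥∣≡0 N = z≤n

    -- Among the tails with d + ∣ S ∣ = scale * ρ, the rank of S is where the
    -- condition fails on increasing d by one, and it holds there for flats.
    tail-difference : ∀ S → 1 ℕ.≤ ∣ S ∣ → ∀ ρ d → d ℕ.+ ∣ S ∣ ≡ scale ℕ.* ρ →
      𝟙 (tail? M S d) ℤ.- 𝟙 (tail? M S (suc d)) ≡ 𝟙 (flat? M S ×-dec (rank M S ℕ.≟ ρ))
    tail-difference S 1≤∣S∣ ρ d d+ with ℕ.<-cmp (rank M S) ρ
    ... | tri< r<ρ _ _ = trans
      (cong₂ ℤ._-_ (𝟙-false (tail? M S d) fails) (𝟙-false (tail? M S (suc d)) λ t → fails λ A S⊆A → ℕ.<⇒≤ (t A S⊆A)))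
      (sym (𝟙-false (flat? M S ×-dec (rank M S ℕ.≟ ρ)) λ (_ , e) → ℕ.<⇒≢ r<ρ e))
      where
      fails : ¬ Tail M S d
      fails t = ℕ.<⇒≱ r<ρ (ℕ.*-cancelˡ-≤ scale (subst (ℕ._≤ scale ℕ.* rank M S) d+ (t S λ x → x)))
    ... | tri> _ _ ρ<r = trans
      (cong₂ ℤ._-_ (𝟙-true (tail? M S d) λ A S⊆A → ℕ.<⇒≤ (holds A S⊆A)) (𝟙-true (tail? M S (suc d)) holds))
      (sym (𝟙-false (flat? M S ×-dec (rank M S ℕ.≟ ρ)) λ (_ , e) → ℕ.<⇒≢ ρ<r (sym e)))
      where
      holds : Tail M S (suc d)
      -- The spare unit of rank is worth `scale`, which exceeds `∣ A ∣`, and `1≤∣S∣` pays for the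
      -- successor in `suc d`.
      holds A S⊆A = begin
        suc d ℕ.+ ∣ A ∣              ≡⟨ cong (ℕ._+ ∣ A ∣) (ℕ.+-comm 1 d) ⟩
        d ℕ.+ 1 ℕ.+ ∣ A ∣            ≤⟨ ℕ.+-mono-≤ (ℕ.+-monoʳ-≤ d 1≤∣S∣) (ℕ.≤-trans (∣p∣≤n A) (ℕ.n≤1+n N)) ⟩
        d ℕ.+ ∣ S ∣ ℕ.+ scale        ≡⟨ cong (ℕ._+ scale) d+ ⟩
        scale ℕ.* ρ ℕ.+ scale        ≡⟨ trans (ℕ.+-comm _ scale) (sym (ℕ.*-suc scale ρ)) ⟩
        scale ℕ.* suc ρ              ≤⟨ ℕ.*-monoʳ-≤ scale (ℕ.≤-trans ρ<r (rank-mono M S⊆A)) ⟩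
        scale ℕ.* rank M A           ∎
        where open ℕ.≤-Reasoning
    -- Here the bound for `d` is an equality at `A = S`. So `suc d` fails, and `d` leaves no room
    -- for `S ∪ ⁅ e ⁆` to have the same rank, its size being one larger.
    ... | tri≈ _ refl _ = trans
      (trans (cong (λ x → 𝟙 (tail? M S d) ℤ.- x) (𝟙-false (tail? M S (suc d)) fails)) (ℤ.+-identityʳ _))
      (𝟙-cong (tail? M S d) (flat? M S ×-dec (rank M S ℕ.≟ rank M S)) (λ t → tail⇒flat t , refl) (flat⇒tail ∘ proj₁))
      where
      fails : ¬ Tail M S (suc d)
      fails t = ℕ.<⇒≱ (ℕ.≤-refl {suc (scale ℕ.* rank M S)})
        (subst (λ x → suc x ℕ.≤ scale ℕ.* rank M S) d+ (t S λ x → x))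
      tail⇒flat : Tail M S d → Flat M S
      tail⇒flat t e e∉S = ℕ.*-cancelˡ-< scale (rank M S) (rank M (S ∪ ⁅ e ⁆))
        (subst (ℕ._≤ scale ℕ.* rank M (S ∪ ⁅ e ⁆))
          (trans (cong (d ℕ.+_) (∣∪⁅⁆∣ S e∉S)) (trans (ℕ.+-suc d ∣ S ∣) (cong suc d+)))
          (t (S ∪ ⁅ e ⁆) (⊆-insert S e)))
      flat⇒tail : Flat M S → Tail M S d
      flat⇒tail flat A S⊆A with ⊆-or-witness A S
      ... | inj₁ A⊆S rewrite ⊆-antisym A⊆S S⊆A = ℕ.≤-reflexive d+
      ... | inj₂ (e , e∈A , e∉S) = begin
        d ℕ.+ ∣ A ∣                  ≤⟨ ℕ.+-mono-≤ (ℕ.m≤m+n d ∣ S ∣) (ℕ.≤-trans (∣p∣≤n A) (ℕ.n≤1+n N)) ⟩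
        d ℕ.+ ∣ S ∣ ℕ.+ scale        ≡⟨ cong (ℕ._+ scale) d+ ⟩
        scale ℕ.* rank M S ℕ.+ scale ≡⟨ trans (ℕ.+-comm _ scale) (sym (ℕ.*-suc scale (rank M S))) ⟩
        scale ℕ.* suc (rank M S)     ≤⟨ ℕ.*-monoʳ-≤ scale (ℕ.≤-trans (flat e e∉S) (rank-mono M (insert-⊆ S⊆A e∈A))) ⟩
        scale ℕ.* rank M A           ∎
        where open ℕ.≤-Reasoning

  -- The points of the dilate by 2^N * scale are z + 2^N, for z in the grid.
  dilation : ℕ
  dilation = 2^ N ℕ.* scale

  instance
    dilation-nonZero : ℕ.NonZero dilation
    dilation-nonZero = ℕ.m*n≢0 (2^ N) scale {{ℕ.m^n≢0 2 N}}

  shift : Vec ℤ N → Vec ℤ N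
  shift = Vec.map (ℤ._+ + 2^ N)

  module _ (r : ℕ) (L : List (Sub × ℕ)) where

    -- The requirements on a grid point that do not mention a matroid. They become coefficients, and
    -- the matroid enters through `InDilate` alone.
    Eligible : Vec ℤ N → Set
    Eligible z = (∀ S → ℤ.- weight z S ℤ.≤ + 2^ N ℤ.* depth L S) × weight (shift z) ⊤ ≡ + dilation ℤ.* + r

    eligible? : ∀ z → Dec (Eligible z)
    eligible? z = (allSubset? λ S → ℤ.- weight z S ℤ.≤? + 2^ N ℤ.* depth L S) ×-dec
                  (weight (shift z) ⊤ ℤ.≟ + dilation ℤ.* + r)

    Dominates : Matroid E → Set
    Dominates M = rank M ⊤ ≡ r × Consistent (excess M) (depth L)

    dominates? : ∀ M → Dec (Dominates M)
    dominates? M = (rank M ⊤ ℕ.≟ r) ×-dec consistent? (excess M) (depth L)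

    module _ (M : Matroid E) (z : Vec ℤ N) where
      private
        dilation-* : ∀ x → + dilation ℤ.* x ≡ (+ 2^ N ℤ.* + scale) ℤ.* x
        dilation-* x = cong (ℤ._* x) (ℤ.pos-* (2^ N) scale)

      eligible⇒box : Eligible z → InDilate M dilation (shift z) →
                     rank M ⊤ ≡ r × Box (excess M) (depth L) z
      eligible⇒box (lower , total) (upper , total′) =
          ℤ.+-injective (ℤ.*-cancelˡ-≡ (+ dilation) (+ rank M ⊤) (+ r) (trans (sym total′) total))
        , (λ S → unshift-≤ (+ 2^ N) {+ scale} {rankℤ M S} {+ ∣ S ∣} {weight z S}
            (subst₂ ℤ._≤_ (weight-shift (+ 2^ N) z S) (dilation-* (rankℤ M S)) (upper S)))
        , lower

      box⇒eligible : + scale ℤ.* + r ℤ.- + ∣ ⊤ {n = N} ∣ ℤ.≤ + peak L ⊤ →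
                     rank M ⊤ ≡ r → Box (excess M) (depth L) z →
                     Eligible z × InDilate M dilation (shift z)
      box⇒eligible peak⊤ refl (upper , lower) = (lower , total) , upper′ , total
        where
        upper′ : ∀ S → weight (shift z) S ℤ.≤ + dilation ℤ.* rankℤ M S
        upper′ S = subst₂ ℤ._≤_ (sym (weight-shift (+ 2^ N) z S)) (sym (dilation-* (rankℤ M S)))
          (shift-≤ (+ 2^ N) {+ scale} {rankℤ M S} {+ ∣ S ∣} {weight z S} (upper S))
        total : weight (shift z) ⊤ ≡ + dilation ℤ.* rankℤ M ⊤
        total = ℤ.≤-antisym (upper′ ⊤)
          (subst₂ ℤ._≤_ (sym (dilation-* (rankℤ M ⊤))) (sym (weight-shift (+ 2^ N) z ⊤))
            (total-lower (+ 2^ N) {+ scale} {rankℤ M ⊤} {+ ∣ ⊤ {n = N} ∣} {weight z ⊤} {+ peak L ⊤} peak⊤ (lower ⊤)))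

    -- The left side is an integral combination, with coefficients independent of `M`, of values of
    -- the indicator function of the base polytope at rational points.
    grid-dominates : ∀ M → IsChain L → + scale ℤ.* + r ℤ.- + ∣ ⊤ {n = N} ∣ ℤ.≤ + peak L ⊤ →
      ∑grid N scale (λ z → 𝟙 (eligible? z) ℤ.* 𝟙 (inDilate? M dilation (shift z))) ≡ 𝟙 (dominates? M)
    grid-dominates M chain peak⊤ = begin
      ∑grid N scale (λ z → 𝟙 (eligible? z) ℤ.* 𝟙 (inDilate? M dilation (shift z)))
        ≡⟨ ∑grid-cong N scale pointwise ⟩
      ∑grid N scale (λ z → 𝟙 (rank M ⊤ ℕ.≟ r) ℤ.* 𝟙 (box? (excess M) (depth L) z))
        ≡⟨ ∑grid-* (𝟙 (rank M ⊤ ℕ.≟ r)) N scale (λ z → 𝟙 (box? (excess M) (depth L) z)) ⟩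
      𝟙 (rank M ⊤ ℕ.≟ r) ℤ.* ∑grid N scale (λ z → 𝟙 (box? (excess M) (depth L) z))
        ≡⟨ cong (𝟙 (rank M ⊤ ℕ.≟ r) ℤ.*_) (∑grid-box N scale (excess M) (depth L)
             (excess-submodular M) (depth-submodular L chain) (excess-⊥ M) (depth-nonpos L ⊥)
             (excess-⁅⁆ M) (λ e → depth-nonpos L ⁅ e ⁆)) ⟩
      𝟙 (rank M ⊤ ℕ.≟ r) ℤ.* 𝟙 (consistent? (excess M) (depth L))
        ≡⟨ 𝟙-× (rank M ⊤ ℕ.≟ r) (consistent? (excess M) (depth L)) ⟩
      𝟙 (dominates? M) ∎
      where
      open ≡-Reasoning
      pointwise : ∀ z → 𝟙 (eligible? z) ℤ.* 𝟙 (inDilate? M dilation (shift z)) ≡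
                        𝟙 (rank M ⊤ ℕ.≟ r) ℤ.* 𝟙 (box? (excess M) (depth L) z)
      pointwise z = trans (𝟙-× (eligible? z) (inDilate? M dilation (shift z)))
        (trans (𝟙-cong (eligible? z ×-dec inDilate? M dilation (shift z))
                       ((rank M ⊤ ℕ.≟ r) ×-dec box? (excess M) (depth L) z)
            (λ (el , inD) → eligible⇒box M z el inD)
            (λ (rank≡ , box) → box⇒eligible M z peak⊤ rank≡ box))
          (sym (𝟙-× (rank M ⊤ ℕ.≟ r) (box? (excess M) (depth L) z))))

  -- The index `ρ` stands for the rank `suc ρ`, since nonempty sets have positive rank in a loopless
  -- matroid. The truncated subtraction is exact because `∣ S ∣ ≤ scale`.
  level : Sub → ℕ → ℕ
  level S ρ = scale ℕ.* suc ρ ∸ ∣ S ∣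

  level+∣∣ : ∀ S ρ → level S ρ ℕ.+ ∣ S ∣ ≡ scale ℕ.* suc ρ
  level+∣∣ S ρ = ℕ.m∸n+n≡m (ℕ.≤-trans (∣p∣≤n S) (ℕ.≤-trans (ℕ.n≤1+n N) (ℕ.m≤m*n scale (suc ρ))))

  module _ (r : ℕ) (M : Matroid E) where

    dominates-tail : ∀ {L S d} → Dominates r ((S , d) ∷ L) M → Dominates r L M × Tail M S d
    dominates-tail {L} {S} {d} (rank≡ , good) =
      (rank≡ , tails⇒consistent M {L} (consistent⇒tail₀ M {(S , d) ∷ L} good)
                 (λ ∈L → consistent⇒tail M {(S , d) ∷ L} (there ∈L) good)) ,
      consistent⇒tail M {(S , d) ∷ L} (here refl) good

    tail-dominates : ∀ {L S d} → Dominates r L M → Tail M S d → Dominates r ((S , d) ∷ L) M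
    tail-dominates {L} {S} {d} (rank≡ , good) tail =
      rank≡ , tails⇒consistent M {(S , d) ∷ L} (consistent⇒tail₀ M {L} good) λ where
        (here refl) → tail
        (there ∈L)  → consistent⇒tail M {L} ∈L good

    -- By `tail-difference` the summand at `j` asks for a flat of rank `suc j`, so only the index
    -- belonging to the actual rank of `S` can contribute.
    flat-sum : ∀ S → 1 ℕ.≤ ∣ S ∣ → 1 ℕ.≤ rank M S →
      sumℤ {N} (λ j → 𝟙 (tail? M S (level S (toℕ j))) ℤ.- 𝟙 (tail? M S (suc (level S (toℕ j))))) ≡
      𝟙 (flat? M S)
    flat-sum S 1≤∣S∣ 1≤rank = begin
      sumℤ {N} (λ j → 𝟙 (tail? M S (level S (toℕ j))) ℤ.- 𝟙 (tail? M S (suc (level S (toℕ j)))))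
        ≡⟨ sum-single {N} (λ j → 𝟙 (tail? M S (level S (toℕ j))) ℤ.- 𝟙 (tail? M S (suc (level S (toℕ j))))) i
             (λ j j≢i → trans (difference j) (𝟙-false (flat? M S ×-dec (rank M S ℕ.≟ suc (toℕ j)))
               λ (_ , e) → j≢i (toℕ-injective (ℕ.suc-injective (trans (sym e) (sym rank≡)))))) ⟩
      𝟙 (tail? M S (level S (toℕ i))) ℤ.- 𝟙 (tail? M S (suc (level S (toℕ i))))
        ≡⟨ difference i ⟩
      𝟙 (flat? M S ×-dec (rank M S ℕ.≟ suc (toℕ i)))
        ≡⟨ 𝟙-cong (flat? M S ×-dec (rank M S ℕ.≟ suc (toℕ i))) (flat? M S) proj₁ (λ flat → flat , sym rank≡) ⟩
      𝟙 (flat? M S) ∎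
      where
      open ≡-Reasoning
      difference : ∀ (j : Fin N) → _
      difference j = tail-difference M S 1≤∣S∣ (suc (toℕ j)) (level S (toℕ j)) (level+∣∣ S (toℕ j))
      pred<N : ℕ.pred (rank M S) ℕ.< N
      pred<N = ℕ.<-≤-trans (ℕ.≤-reflexive (ℕ.suc-pred (rank M S) {{ℕ.>-nonZero 1≤rank}}))
        (ℕ.≤-trans (rank≤∣∣ M S) (∣p∣≤n S))
      i : Fin N
      i = fromℕ< pred<N
      rank≡ : suc (toℕ i) ≡ rank M S
      rank≡ = trans (cong suc (toℕ-fromℕ< pred<N)) (ℕ.suc-pred (rank M S) {{ℕ.>-nonZero 1≤rank}})

    private
      -- An intermediate condition: the levels in `L` are already imposed, while the sets in `U` are
      -- still required to be flats.
      Stage : List (Sub × ℕ) → List Sub → Set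
      Stage L U = Dominates r L M × All (Flat M) U

    stage? : ∀ L U → Dec (Dominates r L M × All (Flat M) U)
    stage? L U = dominates? r L M ×-dec All.all? (flat? M) U

    -- Trades the flatness of `S` for levels. Every stage on either side contains `Stage L U`, so
    -- all terms vanish if that fails. If it holds, only the tail conditions at `S` remain and
    -- `flat-sum` applies, the rank of `S` being positive because `Dominates` excludes loops.
    stage-sum : ∀ S U L → 1 ℕ.≤ ∣ S ∣ → 𝟙 (stage? L (S ∷ U)) ≡
      sumℤ {N} λ j → 𝟙 (stage? ((S , level S (toℕ j)) ∷ L) U) ℤ.- 𝟙 (stage? ((S , suc (level S (toℕ j))) ∷ L) U)
    stage-sum S U L 1≤∣S∣ = lemma (stage? L U)
      where
      lemma : Dec (Stage L U) → 𝟙 (stage? L (S ∷ U)) ≡ sumℤ {N} λ j →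
        𝟙 (stage? ((S , level S (toℕ j)) ∷ L) U) ℤ.- 𝟙 (stage? ((S , suc (level S (toℕ j))) ∷ L) U)
      lemma (no ¬stage) = trans
        (𝟙-false (stage? L (S ∷ U)) λ { (dom , (_ ∷ flats)) → ¬stage (dom , flats) })
        (sym (sum-zero {n = N} λ j → cong₂ ℤ._-_ (vanish (level S (toℕ j))) (vanish (suc (level S (toℕ j))))))
        where
        vanish : ∀ d → 𝟙 (stage? ((S , d) ∷ L) U) ≡ 0ℤ
        vanish d = 𝟙-false (stage? ((S , d) ∷ L) U) λ (dom , flats) → ¬stage (proj₁ (dominates-tail {L} {S} {d} dom) , flats)
      lemma (yes (dom , flats)) = begin
        𝟙 (stage? L (S ∷ U))
          ≡⟨ 𝟙-cong (stage? L (S ∷ U)) (flat? M S) (λ { (_ , (flat ∷ _)) → flat }) (λ flat → dom , flat ∷ flats) ⟩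
        𝟙 (flat? M S)
          ≡⟨ flat-sum S 1≤∣S∣ 1≤rank ⟨
        sumℤ {N} (λ j → 𝟙 (tail? M S (level S (toℕ j))) ℤ.- 𝟙 (tail? M S (suc (level S (toℕ j)))))
          ≡⟨ Σℤ.sum-cong-≗ {n = N} (λ j → cong₂ ℤ._-_ (extend (level S (toℕ j))) (extend (suc (level S (toℕ j))))) ⟩
        sumℤ {N} (λ j → 𝟙 (stage? ((S , level S (toℕ j)) ∷ L) U) ℤ.- 𝟙 (stage? ((S , suc (level S (toℕ j))) ∷ L) U)) ∎
        where
        open ≡-Reasoning
        extend : ∀ d → 𝟙 (tail? M S d) ≡ 𝟙 (stage? ((S , d) ∷ L) U)
        extend d = 𝟙-cong (tail? M S d) (stage? ((S , d) ∷ L) U)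
          (λ tail → tail-dominates {L} {S} {d} dom tail , flats)
          (λ (dom′ , _) → proj₂ (dominates-tail {L} {S} {d} dom′))
        1≤rank : 1 ℕ.≤ rank M S
        1≤rank with nonempty? S
        ... | yes (e , e∈S) = loopless⇒rank-pos M (tail₀⇒loopless M (consistent⇒tail₀ M {L} (proj₂ dom))) e∈S
        ... | no empty = contradiction (subst (1 ℕ.≤_) (trans (cong ∣_∣ (Empty-unique empty)) (∣⊥∣≡0 N)) 1≤∣S∣) λ ()

  -- Linear relations for chains of flats

  module _ {s} (M : Fin s → Matroid E) (a : Fin s → ℤ)
    (relation : ∀ (x : Point N) (x∈P? : ∀ i → Dec (basePolytope (M i) x)) → sumℤ (λ i → a i ℤ.* 𝟙 (x∈P? i)) ≡ 0ℤ) where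

    open Linear a

    vanishes-inDilate : ∀ y → Vanishes (λ i → 𝟙 (inDilate? (M i) dilation y))
    vanishes-inDilate y = relation (ratio dilation y)
      (λ i → basePolytope? dilation (M i) y)

    vanishes-dominates : ∀ r L → IsChain L → + scale ℤ.* + r ℤ.- + ∣ ⊤ {n = N} ∣ ℤ.≤ + peak L ⊤ →
                         Vanishes (λ i → 𝟙 (dominates? r L (M i)))
    vanishes-dominates r L chain peak⊤ = vanishes-cong
      (λ i → grid-dominates r L (M i) chain peak⊤)
      (vanishes-∑grid N scale (λ z i → 𝟙 (eligible? r L z) ℤ.* 𝟙 (inDilate? (M i) dilation (shift z)))
        (λ z → vanishes-* (𝟙 (eligible? r L z)) {λ i → 𝟙 (inDilate? (M i) dilation (shift z))} (vanishes-inDilate (shift z))))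

    module _ (r : ℕ) (C : Pred Sub 0ℓ) (comparable : ∀ {S T} → C S → C T → Comparable S T) where

      -- Induction on `U` through `stage-sum`, until only levels are left. The predicate `C`
      -- confines all sets to one chain, and the entry for `⊤` stays in `L` throughout to fix the
      -- total weight.
      vanishes-stage : ∀ U L → All (λ S → C S × 1 ℕ.≤ ∣ S ∣) U → (∀ p → p List.∈ L → C (proj₁ p)) →
        (⊤ , level ⊤ r) List.∈ L → Vanishes (λ i → 𝟙 (stage? (suc r) (M i) L U))
      vanishes-stage [] L _ CL ⊤∈L = vanishes-cong
        (λ i → 𝟙-cong (dominates? (suc r) L (M i)) (stage? (suc r) (M i) L []) (_, []) proj₁)
        (vanishes-dominates (suc r) L (λ p q p∈ q∈ → comparable (CL p p∈) (CL q q∈))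
          (≤-cert {e = + peak L ⊤ ℤ.- + level ⊤ r} (ℤ.i≤j⇒0≤j-i (ℤ.+≤+ (≤peak ⊤∈L λ x → x)))
            (cong (λ x → + peak L ⊤ ℤ.- x) (level≡ (level ⊤ r) ∣ ⊤ {n = N} ∣ (level+∣∣ ⊤ r)))))
        where
        level≡ : ∀ d c → d ℕ.+ c ≡ scale ℕ.* suc r → + d ≡ + scale ℤ.* + suc r ℤ.- + c
        level≡ d c e = trans (sym (trans (ℤ.+-assoc (+ d) (+ c) (ℤ.- + c))
            (trans (+-congˡ (+ d) (ℤ.+-inverseʳ (+ c))) (ℤ.+-identityʳ (+ d)))))
          (cong (ℤ._- + c) (trans (cong +_ e) (ℤ.pos-* scale (suc r))))
      vanishes-stage (S ∷ U) L ((CS , 1≤∣S∣) ∷ CU) CL ⊤∈L = vanishes-cong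
        (λ i → sym (stage-sum (suc r) (M i) S U L 1≤∣S∣))
        (vanishes-sum {N} (λ j i → 𝟙 (stage? (suc r) (M i) ((S , level S (toℕ j)) ∷ L) U) ℤ.-
                               𝟙 (stage? (suc r) (M i) ((S , suc (level S (toℕ j))) ∷ L) U))
          λ j → vanishes-- {λ i → 𝟙 (stage? (suc r) (M i) ((S , level S (toℕ j)) ∷ L) U)}
                           {λ i → 𝟙 (stage? (suc r) (M i) ((S , suc (level S (toℕ j))) ∷ L) U)}
                  (next (level S (toℕ j))) (next (suc (level S (toℕ j)))))
        where
        next : ∀ d → Vanishes (λ i → 𝟙 (stage? (suc r) (M i) ((S , d) ∷ L) U))
        next d = vanishes-stage U ((S , d) ∷ L) CU
          (λ { p (here refl) → CS ; p (there ∈L) → CL p ∈L }) (there ⊤∈L)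

      vanishes-flats : C ⊤ → ∀ U → All (λ S → C S × 1 ℕ.≤ ∣ S ∣) U →
        Vanishes (λ i → 𝟙 ((rank (M i) ⊤ ℕ.≟ suc r) ×-dec loopless? (M i) ×-dec All.all? (flat? (M i)) U))
      vanishes-flats C⊤ U CU = vanishes-cong
        (λ i → 𝟙-cong (stage? (suc r) (M i) L U)
          ((rank (M i) ⊤ ℕ.≟ suc r) ×-dec loopless? (M i) ×-dec All.all? (flat? (M i)) U)
          (λ ((rank≡ , good) , flats) → rank≡ , tail₀⇒loopless (M i) (consistent⇒tail₀ (M i) {L} good) , flats)
          (λ (rank≡ , loopless , flats) →
            (rank≡ , tails⇒consistent (M i) {L} (loopless⇒tail₀ (M i) loopless)
              λ { (here refl) A ⊤⊆A → top (M i) rank≡ A ⊤⊆A }) , flats))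
        (vanishes-stage U L CU (λ { p (here refl) → C⊤ }) (here refl))
        where
        -- This level is `excess M ⊤` for a matroid of rank `suc r`, so its tail condition holds,
        -- with equality.
        L = (⊤ , level ⊤ r) ∷ []
        top : ∀ M → rank M ⊤ ≡ suc r → Tail M ⊤ (level ⊤ r)
        top M rank≡ A ⊤⊆A = ℕ.≤-reflexive (subst (λ A → level ⊤ r ℕ.+ ∣ A ∣ ≡ scale ℕ.* rank M A)
          (⊆-antisym ⊤⊆A ⊆⊤) (trans (level+∣∣ ⊤ r) (cong (scale ℕ.*_) (sym rank≡))))

-- Chains of flats

element : (F : Subset n) → Fin ∣ F ∣ → Fin n
element (outside ∷ F) j       = suc (element F j)
element (inside ∷ F)  zero    = zero
element (inside ∷ F)  (suc j) = suc (element F j)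

element-∈ : (F : Subset n) (j : Fin ∣ F ∣) → element F j ∈ F
element-∈ (outside ∷ F) j       = there (element-∈ F j)
element-∈ (inside ∷ F)  zero    = here
element-∈ (inside ∷ F)  (suc j) = there (element-∈ F j)

element-injective : (F : Subset n) {i j : Fin ∣ F ∣} → element F i ≡ element F j → i ≡ j
element-injective (outside ∷ F) e = element-injective F (suc-injective e)
element-injective (inside ∷ F) {zero}  {zero}  e = refl
element-injective (inside ∷ F) {suc i} {suc j} e = cong suc (element-injective F (suc-injective e))

position : {F : Subset n} {i : Fin n} → i ∈ F → ∃[ j ] element F j ≡ i
position {F = inside ∷ F}  here       = zero , refl
position {F = inside ∷ F}  (there i∈) = let j , e = position i∈ in suc j , cong suc e
position {F = outside ∷ F} (there i∈) = let j , e = position i∈ in j , cong suc e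

∣∣≤ : (F : Subset n) {m : ℕ} (ρ : Fin n → ℕ) → (∀ {i} → i ∈ F → ρ i ℕ.< m) →
      (∀ {i j} → i ∈ F → j ∈ F → ρ i ≡ ρ j → i ≡ j) → ∣ F ∣ ℕ.≤ m
∣∣≤ F ρ ρ< ρ-injective = injective⇒≤ {f = λ j → fromℕ< (ρ< (element-∈ F j))} λ {i} {j} e →
  element-injective F (ρ-injective (element-∈ F i) (element-∈ F j)
    (fromℕ<-injective _ _ (ρ< (element-∈ F i)) (ρ< (element-∈ F j)) e))

≤∣∣ : (F : Subset n) {m : ℕ} (g : Fin m → Fin n) → (∀ j → g j ∈ F) →
      (∀ {i j} → g i ≡ g j → i ≡ j) → m ℕ.≤ ∣ F ∣
≤∣∣ F g g∈ g-injective = injective⇒≤ {f = λ j → proj₁ (position (g∈ j))} λ {i} {j} e →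
  g-injective (trans (sym (proj₂ (position (g∈ i)))) (trans (cong (element F) e) (proj₂ (position (g∈ j)))))

≢⊥⇒1≤∣∣ : (S : Subset n) → S ≢ ⊥ → 1 ℕ.≤ ∣ S ∣
≢⊥⇒1≤∣∣ S S≢⊥ with nonempty? S
... | no empty = contradiction (Empty-unique empty) S≢⊥
... | yes (e , e∈S) = subst (ℕ._≤ ∣ S ∣) (∣⁅x⁆∣≡1 e)
  (p⊆q⇒∣p∣≤∣q∣ λ x → subst (_∈ S) (sym (x∈⁅y⁆⇒x≡y e x)) e∈S)

subsets-unique : ∀ n → Unique (subsets n)
subsets-unique zero    = [] ∷ []
subsets-unique (suc n) = Unique.++⁺
  (Unique.map⁺ ∷-injectiveʳ (subsets-unique n)) (Unique.map⁺ ∷-injectiveʳ (subsets-unique n))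
  λ (∈out , ∈in) → case ∈-map⁻ (outside ∷_) ∈out , ∈-map⁻ (inside ∷_) ∈in of λ { ((_ , _ , refl) , (_ , _ , ())) }

lookup-injective : {xs : List A} → Unique xs → ∀ {i j} → List.lookup xs i ≡ List.lookup xs j → i ≡ j
lookup-injective (x∉ ∷ u) {zero}  {zero}  e = refl
lookup-injective (x∉ ∷ u) {zero}  {suc j} e = contradiction e (All.lookup x∉ (∈-lookup j))
lookup-injective (x∉ ∷ u) {suc i} {zero}  e = contradiction (sym e) (All.lookup x∉ (∈-lookup i))
lookup-injective (x∉ ∷ u) {suc i} {suc j} e = cong suc (lookup-injective u e)

nth : Fin (length (subsets n)) → Subset n
nth {n} = List.lookup (subsets n)

nth-injective : {i j : Fin (length (subsets n))} → nth i ≡ nth j → i ≡ j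
nth-injective {n} = lookup-injective (subsets-unique n)

code : Subset n → Fin (length (subsets n))
code S = Any.index (subsets-complete S)

nth-code : (S : Subset n) → nth (code S) ≡ S
nth-code S = sym (lookup-index (subsets-complete S))

-- The size of a longest chain of proper flats

module _ {E : GroundSet} (M : Matroid E) (loopless : Loopless M) (1≤N : 1 ℕ.≤ size E) where
  private
    N = size E
    Sub = Subset N
    r = rank M ⊤
    Δ = flatComplex M
    open SimplicialComplex Δ

    1≤r : 1 ℕ.≤ r
    1≤r = loopless⇒rank-pos M loopless (∈⊤ {x = fromℕ< 1≤N})

    suc-r-1 : suc (r ∸ 1) ≡ r
    suc-r-1 = ℕ.m+[n∸m]≡n 1≤r

  flat-rank-< : ∀ {S T : Sub} → Flat M S → S ⊆ T → S ≢ T → rank M S ℕ.< rank M T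
  flat-rank-< {S} {T} flat S⊆T S≢T with ⊆-or-witness T S
  ... | inj₁ T⊆S = contradiction (⊆-antisym S⊆T T⊆S) S≢T
  ... | inj₂ (e , e∈T , e∉S) = ℕ.<-≤-trans (flat e e∉S) (rank-mono M (insert-⊆ S⊆T e∈T))

  rank-injective : ∀ {S T : Sub} → Flat M S → Flat M T → S ⊆ T ⊎ T ⊆ S → rank M S ≡ rank M T → S ≡ T
  rank-injective {S} {T} flatS flatT comp rank≡ with ≡-dec Bool._≟_ S T
  rank-injective flatS flatT comp rank≡ | yes S≡T = S≡T
  rank-injective flatS flatT (inj₁ S⊆T) rank≡ | no S≢T = contradiction rank≡ (ℕ.<⇒≢ (flat-rank-< flatS S⊆T S≢T))
  rank-injective flatS flatT (inj₂ T⊆S) rank≡ | no S≢T = contradiction (sym rank≡) (ℕ.<⇒≢ (flat-rank-< flatT T⊆S (S≢T ∘ sym)))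

  -- The members of a chain of flats have distinct ranks, and for proper nonempty flats these lie
  -- strictly between 0 and `r`.
  ∣face∣≤ : ∀ F → Face F → ∣ F ∣ ℕ.≤ r ∸ 1
  ∣face∣≤ F (proper , chain) = ∣∣≤ F (λ i → rank M (nth i) ∸ 1)
    (λ {i} i∈F → ℕ.∸-monoˡ-< (below (proper i i∈F)) (above (proper i i∈F)))
    (λ {i} {j} i∈F j∈F e → nth-injective (rank-injective (proj₁ (proper i i∈F)) (proj₁ (proper j j∈F)) (chain i i∈F j j∈F)
      (ℕ.∸-cancelʳ-≡ (above (proper i i∈F)) (above (proper j j∈F)) e)))
    where
    above : ∀ {S : Sub} → ProperFlat M S → 1 ℕ.≤ rank M S
    above {S} (_ , S≢⊥ , _) with nonempty? S
    ... | yes (e , e∈S) = loopless⇒rank-pos M loopless e∈S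
    ... | no empty      = contradiction (Empty-unique empty) S≢⊥
    below : ∀ {S : Sub} → ProperFlat M S → rank M S ℕ.< r
    below (flat , _ , S≢⊤) = flat-rank-< flat ⊆⊤ S≢⊤

  private
    -- Adds one missing element and closes up, which raises the rank of a flat by one. The first
    -- case is a default for sets without a missing element.
    step : Sub → Sub
    step S with ⊆-or-witness ⊤ S
    ... | inj₁ _ = S
    ... | inj₂ (e , _) = closure M (S ∪ ⁅ e ⁆)

    ⊆-step : ∀ S → S ⊆ step S
    ⊆-step S x∈S with ⊆-or-witness ⊤ S
    ... | inj₁ _ = x∈S
    ... | inj₂ (e , _) = ⊆-closure M (S ∪ ⁅ e ⁆) (⊆-insert S e x∈S)

    step-rank : ∀ S → Flat M S → rank M S ℕ.< r → Flat M (step S) × rank M (step S) ≡ suc (rank M S)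
    step-rank S flat <r with ⊆-or-witness ⊤ S
    ... | inj₁ ⊤⊆S = contradiction <r (ℕ.≤⇒≯ (rank-mono M ⊤⊆S))
    ... | inj₂ (e , _ , e∉S) = closure-flat M (S ∪ ⁅ e ⁆) ,
      trans (rank-closure M (S ∪ ⁅ e ⁆)) (ℕ.≤-antisym (rank-insert M S e) (flat e e∉S))

  tower : ℕ → Sub
  tower zero    = ⊥
  tower (suc j) = step (tower j)

  tower-rank : ∀ j → j ℕ.≤ r → Flat M (tower j) × rank M (tower j) ≡ j
  tower-rank zero    _ = ⊥-flat , rank-⊥ M
    where
    ⊥-flat : Flat M ⊥
    ⊥-flat e _ = subst (ℕ._< rank M (⊥ ∪ ⁅ e ⁆)) (sym (rank-⊥ M)) (loopless⇒rank-pos M loopless (∈-insert ⊥ e))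
  tower-rank (suc j) j<r =
    let flat , rank≡ = tower-rank j (ℕ.<⇒≤ j<r)
        flat′ , rank≡′ = step-rank (tower j) flat (subst (ℕ._< r) (sym rank≡) j<r)
    in flat′ , trans rank≡′ (cong suc rank≡)

  tower-mono : ∀ {i j} → i ℕ.≤′ j → tower i ⊆ tower j
  tower-mono ℕ.≤′-refl x = x
  tower-mono (ℕ.≤′-step {n = j} i≤j) x = ⊆-step (tower j) (tower-mono i≤j x)

  private
    InTower : Pred (Fin (length (subsets N))) 0ℓ
    InTower i = ∃ λ (j : Fin (r ∸ 1)) → nth i ≡ tower (suc (toℕ j))

    inTower? : Decidable InTower
    inTower? i = any? λ j → ≡-dec Bool._≟_ (nth i) (tower (suc (toℕ j)))

    <r : (j : Fin (r ∸ 1)) → suc (toℕ j) ℕ.< r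
    <r j = subst (suc (toℕ j) ℕ.<_) suc-r-1 (s≤s (toℕ<n j))

    tower-proper : ∀ j → ProperFlat M (tower (suc (toℕ {r ∸ 1} j)))
    tower-proper j = let flat , rank≡ = tower-rank (suc (toℕ j)) (ℕ.<⇒≤ (<r j)) in
        flat
      , (λ e → ℕ.1+n≢0 (trans (sym rank≡) (trans (cong (rank M) e) (rank-⊥ M))))
      , (λ e → ℕ.<⇒≢ (<r j) (trans (sym rank≡) (cong (rank M) e)))

    tower-comparable : ∀ i j → tower i ⊆ tower j ⊎ tower j ⊆ tower i
    tower-comparable i j with ℕ.≤-total i j
    ... | inj₁ i≤j = inj₁ (tower-mono (ℕ.≤⇒≤′ i≤j))
    ... | inj₂ j≤i = inj₂ (tower-mono (ℕ.≤⇒≤′ j≤i))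

    tower-face : Face ⟦ inTower? ⟧
    tower-face =
        (λ i i∈ → let j , e = ∈-⟦⟧⁻ inTower? i∈ in subst (ProperFlat M) (sym e) (tower-proper j))
      , (λ i i∈ i′ i′∈ → let j , e = ∈-⟦⟧⁻ inTower? i∈ ; j′ , e′ = ∈-⟦⟧⁻ inTower? i′∈ in
          subst₂ (λ S T → S ⊆ T ⊎ T ⊆ S) (sym e) (sym e′) (tower-comparable (suc (toℕ j)) (suc (toℕ j′))))

    tower-size : r ∸ 1 ℕ.≤ ∣ ⟦ inTower? ⟧ ∣
    tower-size = ≤∣∣ ⟦ inTower? ⟧ (λ j → code (tower (suc (toℕ j))))
      (λ j → ∈-⟦⟧⁺ inTower? (j , nth-code (tower (suc (toℕ j)))))
      (λ {i} {j} e → toℕ-injective (ℕ.suc-injective (trans (sym (proj₂ (tower-rank (suc (toℕ i)) (ℕ.<⇒≤ (<r i)))))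
        (trans (cong (rank M) (trans (sym (nth-code (tower (suc (toℕ i))))) (trans (cong nth e) (nth-code (tower (suc (toℕ j)))))))
          (proj₂ (tower-rank (suc (toℕ j)) (ℕ.<⇒≤ (<r j))))))))

  -- The flats of rank 1 to `r - 1` in the tower form a face that attains the bound of `∣face∣≤`.
  -- The degree of the chain polynomial is thus a function of the rank.
  largestFaceSize≡ : suc (largestFaceSize Δ) ≡ r
  largestFaceSize≡ = trans (cong suc (ℕ.≤-antisym upper
    (ℕ.≤-trans tower-size (max-upper ∣_∣ (∈-filter⁺ face? (subsets-complete ⟦ inTower? ⟧) tower-face))))) suc-r-1
    where
    upper : largestFaceSize Δ ℕ.≤ r ∸ 1
    upper with max-attained ∣_∣ (filter face? (subsets (length (subsets N))))
    ... | inj₁ e = ℕ.≤-trans (ℕ.≤-reflexive e) z≤n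
    ... | inj₂ (F , F∈ , e) with ∈-filter⁻ face? {xs = subsets (length (subsets N))} F∈
    ...   | _ , face = ℕ.≤-trans (ℕ.≤-reflexive (sym e)) (∣face∣≤ F face)

-- Coefficients of the chain polynomial

∑list-cong : (xs : List A) {φ ψ : A → ℤ} → (∀ x → φ x ≡ ψ x) → ∑list xs φ ≡ ∑list xs ψ
∑list-cong []       e = refl
∑list-cong (x ∷ xs) e = cong₂ ℤ._+_ (e x) (∑list-cong xs e)

∑list-zero : (xs : List A) {φ : A → ℤ} → (∀ x → φ x ≡ 0ℤ) → ∑list xs φ ≡ 0ℤ
∑list-zero []       e = refl
∑list-zero (x ∷ xs) e = cong₂ ℤ._+_ (e x) (∑list-zero xs e)

length-filter : {P : Pred A 0ℓ} (P? : Decidable P) (xs : List A) →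
                + length (filter P? xs) ≡ ∑list xs (λ x → 𝟙 (P? x))
length-filter P? []       = refl
length-filter P? (x ∷ xs) with P? x
... | yes _ = +-congˡ 1ℤ (length-filter P? xs)
... | no _  = trans (length-filter P? xs) (sym (ℤ.+-identityˡ _))

coeff-sum : (f : Fin n → ℤ[t]) (k : ℕ) → coeff (sumₚ f) k ≡ sumℤ (λ i → coeff (f i) k)
coeff-sum {zero}  f k = refl
coeff-sum {suc n} f k = trans (coeff-+ₚ (f zero) (sumₚ (f ∘ suc)) k) (+-congˡ (coeff (f zero) k) (coeff-sum (f ∘ suc) k))

coeff-monomial : ∀ c m → coeff (monomial c m) m ≡ c
coeff-monomial c zero    = refl
coeff-monomial c (suc m) = coeff-monomial c m

coeff-monomial-≢ : ∀ c m k → m ≢ k → coeff (monomial c m) k ≡ 0ℤ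
coeff-monomial-≢ c zero    zero    m≢k = contradiction refl m≢k
coeff-monomial-≢ c zero    (suc k) m≢k = refl
coeff-monomial-≢ c (suc m) zero    m≢k = refl
coeff-monomial-≢ c (suc m) (suc k) m≢k = coeff-monomial-≢ c m k (m≢k ∘ cong suc)

coeff-× : ∀ m p k → coeff (m ×ₚ p) k ≡ + m ℤ.* coeff p k
coeff-× zero    p k = sym (ℤ.*-zeroˡ (coeff p k))
coeff-× (suc m) p k = trans (coeff-+ₚ p (m ×ₚ p) k)
  (trans (+-congˡ (coeff p k) (coeff-× m p k)) (sym (suc-* (+ m) (coeff p k))))

coeff-×ᶻ : ∀ z p k → coeff (_×ᶻ_ ℤ[t]-abelianGroup z p) k ≡ z ℤ.* coeff p k
coeff-×ᶻ (+ m)    p k = coeff-× m p k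
coeff-×ᶻ -[1+ m ] p k = trans (coeff--ₚ (suc m ×ₚ p) k)
  (trans (cong ℤ.-_ (coeff-× (suc m) p k)) (ℤ.neg-distribˡ-* (+ suc m) (coeff p k)))

coeff-if : (d : Dec A) (p : ℤ[t]) (k : ℕ) → coeff (if does d then p else []) k ≡ 𝟙 d ℤ.* coeff p k
coeff-if (yes _) p k = sym (ℤ.*-identityˡ (coeff p k))
coeff-if (no _)  p k = sym (ℤ.*-zeroˡ (coeff p k))

module _ (Δ : SimplicialComplex n) where
  open SimplicialComplex Δ

  -- The addition in `∣ F ∣ + k` covers the case where `k` exceeds the degree, in which both sides
  -- are 0; a truncated difference would count the empty face there.
  coeff-fPolynomial : ∀ k → coeff (fPolynomial Δ) k ≡
    ∑list (subsets n) (λ F → 𝟙 (face? F ×-dec (∣ F ∣ ℕ.+ k ℕ.≟ largestFaceSize Δ)))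
  coeff-fPolynomial k = trans (coeff-sum {suc d} term k) (lemma (k ℕ.≤? d))
    where
    d = largestFaceSize Δ
    term : Fin (suc d) → ℤ[t]
    term i = monomial (+ faceCount Δ (toℕ i)) (d ∸ toℕ i)
    lemma : Dec (k ℕ.≤ d) → sumℤ {suc d} (λ i → coeff (term i) k) ≡
      ∑list (subsets n) (λ F → 𝟙 (face? F ×-dec (∣ F ∣ ℕ.+ k ℕ.≟ d)))
    lemma (no k≰d) = trans
      (sum-zero {suc d} λ i → coeff-monomial-≢ (+ faceCount Δ (toℕ i)) (d ∸ toℕ i) k
        λ e → k≰d (subst (ℕ._≤ d) e (ℕ.m∸n≤m d (toℕ i))))
      (sym (∑list-zero (subsets n) λ F → 𝟙-false (face? F ×-dec (∣ F ∣ ℕ.+ k ℕ.≟ d))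
        λ (_ , e) → k≰d (subst (k ℕ.≤_) e (ℕ.m≤n+m k ∣ F ∣))))
    lemma (yes k≤d) = begin
      sumℤ {suc d} (λ i → coeff (term i) k)
        ≡⟨ sum-single {suc d} (λ i → coeff (term i) k) i (λ j j≢i →
             coeff-monomial-≢ (+ faceCount Δ (toℕ j)) (d ∸ toℕ j) k λ e → j≢i (toℕ-injective
               (trans (sym (ℕ.m∸[m∸n]≡n (ℕ.s≤s⁻¹ (toℕ<n j)))) (trans (cong (d ∸_) e) (sym toℕ-i))))) ⟩
      coeff (monomial (+ faceCount Δ (toℕ i)) (d ∸ toℕ i)) k
        ≡⟨ cong (λ m → coeff (monomial (+ faceCount Δ m) (d ∸ m)) k) toℕ-i ⟩
      coeff (monomial (+ faceCount Δ (d ∸ k)) (d ∸ (d ∸ k))) k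
        ≡⟨ cong (λ m → coeff (monomial (+ faceCount Δ (d ∸ k)) m) k) (ℕ.m∸[m∸n]≡n k≤d) ⟩
      coeff (monomial (+ faceCount Δ (d ∸ k)) k) k
        ≡⟨ coeff-monomial (+ faceCount Δ (d ∸ k)) k ⟩
      + faceCount Δ (d ∸ k)
        ≡⟨ length-filter (λ F → face? F ×-dec (∣ F ∣ ℕ.≟ d ∸ k)) (subsets n) ⟩
      ∑list (subsets n) (λ F → 𝟙 (face? F ×-dec (∣ F ∣ ℕ.≟ d ∸ k)))
        ≡⟨ ∑list-cong (subsets n) (λ F → 𝟙-cong (face? F ×-dec (∣ F ∣ ℕ.≟ d ∸ k)) (face? F ×-dec (∣ F ∣ ℕ.+ k ℕ.≟ d))
             (λ (face , e) → face , trans (cong (ℕ._+ k) e) (ℕ.m∸n+n≡m k≤d))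
             (λ (face , e) → face , trans (sym (ℕ.m+n∸n≡m ∣ F ∣ k)) (cong (_∸ k) e))) ⟩
      ∑list (subsets n) (λ F → 𝟙 (face? F ×-dec (∣ F ∣ ℕ.+ k ℕ.≟ d))) ∎
      where
      open ≡-Reasoning
      i : Fin (suc d)
      i = fromℕ< (s≤s (ℕ.m∸n≤m d k))
      toℕ-i : toℕ i ≡ d ∸ k
      toℕ-i = toℕ-fromℕ< (s≤s (ℕ.m∸n≤m d k))

module _ {E : GroundSet} where
  private
    N = size E
    Vertices = Subset (length (subsets N))

  FlagOf : Matroid E → ℕ → Vertices → Set
  FlagOf M r F = SimplicialComplex.Face (flatComplex M) F × Loopless M × rank M ⊤ ≡ suc r

  flagOf? : ∀ M r F → Dec (FlagOf M r F)
  flagOf? M r F = SimplicialComplex.face? (flatComplex M) F ×-dec loopless? M ×-dec (rank M ⊤ ℕ.≟ suc r)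

  -- Sorting by rank replaces the degree, which varies with the matroid, by the index `r`. The two
  -- zero cases are absorbed: `FlagOf` excludes loops, and over an empty ground set the outer sum is
  -- empty.
  coeff-chainPolynomial : ∀ M k → coeff (chainPolynomial M) k ≡
    sumℤ {N} (λ r → ∑list (subsets (length (subsets N))) (λ F → 𝟙 ((∣ F ∣ ℕ.+ k ℕ.≟ toℕ r) ×-dec flagOf? M (toℕ r) F)))
  coeff-chainPolynomial M k = trans
    (coeff-if (¬? (N ℕ.≟ 0) ×-dec loopless? M) (fPolynomial Δ) k)
    (lemma (¬? (N ℕ.≟ 0) ×-dec loopless? M))
    where
    Δ = flatComplex M
    open SimplicialComplex Δ
    Fs = subsets (length (subsets N))
    entry : ℕ → Vertices → ℤ
    entry r F = 𝟙 ((∣ F ∣ ℕ.+ k ℕ.≟ r) ×-dec flagOf? M r F)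
    lemma : (d : Dec (N ≢ 0 × Loopless M)) → 𝟙 d ℤ.* coeff (fPolynomial Δ) k ≡ sumℤ {N} (λ r → ∑list Fs (entry (toℕ r)))
    lemma (no ¬d) = trans (ℤ.*-zeroˡ (coeff (fPolynomial Δ) k)) (sym (sum-zero {N} λ r → ∑list-zero Fs λ F →
      𝟙-false ((∣ F ∣ ℕ.+ k ℕ.≟ toℕ r) ×-dec flagOf? M (toℕ r) F)
        λ (_ , _ , loopless , _) → ¬d ((λ N≡0 → ℕ.<⇒≱ (toℕ<n r) (subst (ℕ._≤ toℕ r) (sym N≡0) z≤n)) , loopless)))
    lemma (yes (N≢0 , loopless)) = begin
      1ℤ ℤ.* coeff (fPolynomial Δ) k
        ≡⟨ trans (ℤ.*-identityˡ (coeff (fPolynomial Δ) k)) (coeff-fPolynomial Δ k) ⟩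
      ∑list Fs (λ F → 𝟙 (face? F ×-dec (∣ F ∣ ℕ.+ k ℕ.≟ d)))
        ≡⟨ ∑list-cong Fs (λ F → 𝟙-cong (face? F ×-dec (∣ F ∣ ℕ.+ k ℕ.≟ d))
             ((∣ F ∣ ℕ.+ k ℕ.≟ toℕ r) ×-dec flagOf? M (toℕ r) F)
             (λ (face , e) → trans e (sym toℕ-r) , face , loopless , sym suc-r)
             (λ (e , face , _) → face , trans e toℕ-r)) ⟩
      ∑list Fs (entry (toℕ r))
        ≡⟨ sum-single {N} (λ r → ∑list Fs (entry (toℕ r))) r (λ j j≢r → ∑list-zero Fs λ F →
             𝟙-false ((∣ F ∣ ℕ.+ k ℕ.≟ toℕ j) ×-dec flagOf? M (toℕ j) F)
               λ (_ , _ , _ , rank≡) → j≢r (toℕ-injective (ℕ.suc-injective (trans (sym rank≡) (sym suc-r))))) ⟨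
      sumℤ {N} (λ r → ∑list Fs (entry (toℕ r))) ∎
      where
      open ≡-Reasoning
      d = largestFaceSize Δ
      d≡ : suc d ≡ rank M ⊤
      d≡ = largestFaceSize≡ M loopless (ℕ.n≢0⇒n>0 N≢0)
      d<N : d ℕ.< N
      d<N = ℕ.≤-trans (ℕ.≤-reflexive d≡) (ℕ.≤-trans (rank≤∣∣ M ⊤) (∣p∣≤n (⊤ {n = N})))
      r : Fin N
      r = fromℕ< d<N
      toℕ-r : toℕ r ≡ d
      toℕ-r = toℕ-fromℕ< d<N
      suc-r : suc (toℕ r) ≡ rank M ⊤
      suc-r = trans (cong suc toℕ-r) d≡

  -- The part of the condition on a face that does not depend on the matroid.
  ProperChain : Vertices → Set
  ProperChain F = (∀ i → i ∈ F → nth {N} i ≢ ⊥ × nth {N} i ≢ ⊤) ×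
                  (∀ i → i ∈ F → ∀ j → j ∈ F → Comparable (nth {N} i) (nth {N} j))

  properChain? : ∀ F → Dec (ProperChain F)
  properChain? F =
    (all? λ i → (i ∈? F) →-dec (¬? (≡-dec Bool._≟_ (nth {N} i) ⊥) ×-dec ¬? (≡-dec Bool._≟_ (nth {N} i) ⊤))) ×-dec
    (all? λ i → (i ∈? F) →-dec (all? λ j → (j ∈? F) →-dec ((nth {N} i ⊆? nth {N} j) ⊎-dec (nth {N} j ⊆? nth {N} i))))

  members : Vertices → List (Subset N)
  members F = List.tabulate (λ j → nth {N} (element F j))

  module _ (M : Matroid E) (r : ℕ) (F : Vertices) where

    flag⇒flats : FlagOf M r F → rank M ⊤ ≡ suc r × Loopless M × All (Flat M) (members F)
    flag⇒flats ((proper , _) , loopless , rank≡) =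
      rank≡ , loopless , All.tabulate⁺ λ j → proj₁ (proper (element F j) (element-∈ F j))

    flag⇒chain : FlagOf M r F → ProperChain F
    flag⇒chain ((proper , chain) , _) = (λ i i∈F → proj₂ (proper i i∈F)) , chain

    flats⇒flag : ProperChain F → rank M ⊤ ≡ suc r × Loopless M × All (Flat M) (members F) → FlagOf M r F
    flats⇒flag (proper , chain) (rank≡ , loopless , flats) =
      ((λ i i∈F → flat i∈F , proper i i∈F) , chain) , loopless , rank≡
      where
      flat : ∀ {i} → i ∈ F → Flat M (nth {N} i)
      flat i∈F with position i∈F
      ... | j , refl = All.tabulate⁻ {f = λ j → nth {N} (element F j)} flats j

  module _ {s} (M : Fin s → Matroid E) (a : Fin s → ℤ)
    (relation : ∀ (x : Point N) (x∈P? : ∀ i → Dec (basePolytope (M i) x)) → sumℤ (λ i → a i ℤ.* 𝟙 (x∈P? i)) ≡ 0ℤ) where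

    open Linear a

    -- If the sets named by `F` are not a chain of proper nonempty sets, `F` is a flag of no
    -- matroid. Otherwise these sets together with `⊤` form the chain to which `vanishes-flats`
    -- applies.
    vanishes-flag : ∀ r F → Vanishes (λ i → 𝟙 (flagOf? (M i) r F))
    vanishes-flag r F = lemma (properChain? F)
      where
      lemma : Dec (ProperChain F) → Vanishes (λ i → 𝟙 (flagOf? (M i) r F))
      lemma (no ¬chain) = vanishes-cong {λ _ → 0ℤ}
        (λ i → sym (𝟙-false (flagOf? (M i) r F) λ flag → ¬chain (flag⇒chain (M i) r F flag))) vanishes-0
      lemma (yes (proper , chain)) = vanishes-cong
        (λ i → 𝟙-cong ((rank (M i) ⊤ ℕ.≟ suc r) ×-dec loopless? (M i) ×-dec All.all? (flat? (M i)) (members F))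
          (flagOf? (M i) r F) (flats⇒flag (M i) r F (proper , chain)) (flag⇒flats (M i) r F))
        (vanishes-flats M a relation r C comparable (inj₁ refl) (members F)
          (All.tabulate⁺ λ j → inj₂ (element F j , element-∈ F j , refl) ,
            ≢⊥⇒1≤∣∣ (nth {N} (element F j)) (proj₁ (proper (element F j) (element-∈ F j)))))
        where
        C : Pred (Subset N) 0ℓ
        C S = S ≡ ⊤ ⊎ ∃[ i ] i ∈ F × S ≡ nth {N} i
        comparable : ∀ {S T} → C S → C T → Comparable S T
        comparable (inj₁ refl) _ = inj₂ ⊆⊤
        comparable (inj₂ _) (inj₁ refl) = inj₁ ⊆⊤
        comparable (inj₂ (i , i∈F , refl)) (inj₂ (j , j∈F , refl)) = chain i i∈F j j∈F

    vanishes-coeff : ∀ k → Vanishes (λ i → coeff (chainPolynomial (M i)) k)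
    vanishes-coeff k = vanishes-cong (λ i → sym (coeff-chainPolynomial (M i) k))
      (vanishes-sum {N} (λ r i → ∑list Fs (λ F → 𝟙 ((∣ F ∣ ℕ.+ k ℕ.≟ toℕ r) ×-dec flagOf? (M i) (toℕ r) F))) λ r →
        vanishes-∑list Fs (λ F i → 𝟙 ((∣ F ∣ ℕ.+ k ℕ.≟ toℕ r) ×-dec flagOf? (M i) (toℕ r) F)) λ F →
          vanishes-cong (λ i → 𝟙-× (∣ F ∣ ℕ.+ k ℕ.≟ toℕ r) (flagOf? (M i) (toℕ r) F))
            (vanishes-* (𝟙 (∣ F ∣ ℕ.+ k ℕ.≟ toℕ r)) {λ i → 𝟙 (flagOf? (M i) (toℕ r) F)} (vanishes-flag (toℕ r) F)))
      where
      Fs = subsets (length (subsets N))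

chainPolynomial-valuation : IsValuation ℤ[t]-abelianGroup chainPolynomial
chainPolynomial-valuation E s M a relation = coeffwise λ k → trans
  (coeff-sum (λ i → _×ᶻ_ ℤ[t]-abelianGroup (a i) (chainPolynomial (M i))) k)
  (trans (Σℤ.sum-cong-≗ (λ i → coeff-×ᶻ (a i) (chainPolynomial (M i)) k))
    (vanishes-coeff M a relation k))

-- Invariance under isomorphism

∑list-↭ : {xs ys : List A} → xs ↭ ys → (φ : A → ℤ) → ∑list xs φ ≡ ∑list ys φ
∑list-↭ ↭.refl           φ = refl
∑list-↭ (↭.prep x p)     φ = +-congˡ (φ x) (∑list-↭ p φ)
∑list-↭ {xs = _ ∷ _ ∷ xs} {ys = _ ∷ _ ∷ ys} (↭.swap x y p) φ = trans
  (sym (ℤ.+-assoc (φ x) (φ y) (∑list xs φ)))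
  (trans (cong₂ ℤ._+_ (ℤ.+-comm (φ x) (φ y)) (∑list-↭ p φ)) (ℤ.+-assoc (φ y) (φ x) (∑list ys φ)))
∑list-↭ (↭.trans p q)    φ = trans (∑list-↭ p φ) (∑list-↭ q φ)

∑list-map : (f : A → B) (xs : List A) (φ : B → ℤ) → ∑list (List.map f xs) φ ≡ ∑list xs (φ ∘ f)
∑list-map f []       φ = refl
∑list-map f (x ∷ xs) φ = +-congˡ (φ (f x)) (∑list-map f xs φ)

relabel : Fin m ↔ Fin n → Subset m → Subset n
relabel π S = tabulate λ e → lookup S (Inverse.from π e)

module _ (π : Fin m ↔ Fin n) where
  open Inverse π

  ∈-relabel⁺ : ∀ {S e} → from e ∈ S → e ∈ relabel π S
  ∈-relabel⁺ {S} {e} e∈ = lookup⇒[]= e (relabel π S) (trans (lookup∘tabulate _ e) ([]=⇒lookup e∈))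

  ∈-relabel⁻ : ∀ {S e} → e ∈ relabel π S → from e ∈ S
  ∈-relabel⁻ {S} {e} e∈ = lookup⇒[]= (from e) S (trans (sym (lookup∘tabulate _ e)) ([]=⇒lookup e∈))

  to-∈-relabel : ∀ {S i} → i ∈ S → to i ∈ relabel π S
  to-∈-relabel {S} i∈S = ∈-relabel⁺ (subst (_∈ S) (sym (strictlyInverseʳ _)) i∈S)

  relabel-inverse : ∀ S → relabel (↔-sym π) (relabel π S) ≡ S
  relabel-inverse S = trans
    (tabulate-cong λ i → trans (lookup∘tabulate _ (to i)) (cong (lookup S) (strictlyInverseʳ i)))
    (tabulate∘lookup S)

  relabel-mono : ∀ {S T} → S ⊆ T → relabel π S ⊆ relabel π T
  relabel-mono S⊆T e∈ = ∈-relabel⁺ (S⊆T (∈-relabel⁻ e∈))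

  relabel-⊥ : relabel π ⊥ ≡ ⊥
  relabel-⊥ = Empty-unique λ (e , e∈) → ∉⊥ (∈-relabel⁻ e∈)

  relabel-⊤ : relabel π ⊤ ≡ ⊤
  relabel-⊤ = ⊆-antisym ⊆⊤ λ _ → ∈-relabel⁺ ∈⊤

  ∣relabel∣≥ : ∀ S → ∣ S ∣ ℕ.≤ ∣ relabel π S ∣
  ∣relabel∣≥ S = ≤∣∣ (relabel π S) (to ∘ element S) (λ j → to-∈-relabel (element-∈ S j))
    λ {i} {j} e → element-injective S (trans (sym (strictlyInverseʳ _)) (trans (cong from e) (strictlyInverseʳ _)))

∣relabel∣ : (π : Fin m ↔ Fin n) (S : Subset m) → ∣ relabel π S ∣ ≡ ∣ S ∣
∣relabel∣ π S = ℕ.≤-antisym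
  (subst (∣ relabel π S ∣ ℕ.≤_) (cong ∣_∣ (relabel-inverse π S)) (∣relabel∣≥ (↔-sym π) (relabel π S)))
  (∣relabel∣≥ π S)

relabel-injective : (π : Fin m ↔ Fin n) {S T : Subset m} → relabel π S ≡ relabel π T → S ≡ T
relabel-injective π {S} {T} e =
  trans (sym (relabel-inverse π S)) (trans (cong (relabel (↔-sym π)) e) (relabel-inverse π T))

-- Both lists contain every subset exactly once.
relabel-subsets : (π : Fin m ↔ Fin n) → List.map (relabel π) (subsets m) ↭ subsets n
relabel-subsets {m} {n} π = ∼bag⇒↭ (unique∧set⇒bag
  (Unique.map⁺ (relabel-injective π) (subsets-unique m)) (subsets-unique n)
  λ {S} → mk⇔ (λ _ → subsets-complete S)
    (λ _ → subst (List._∈ List.map (relabel π) (subsets m)) (relabel-inverse (↔-sym π) S)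
      (∈-map⁺ (relabel π) (subsets-complete (relabel (↔-sym π) S)))))

code-nth : (i : Fin (length (subsets n))) → code (nth {n} i) ≡ i
code-nth {n} i = nth-injective {n} (nth-code (nth {n} i))

-- A vertex of the flat complex is a position in the list of subsets, so relabelling has to pass
-- from positions to sets and back.
vertices : Fin m ↔ Fin n → Fin (length (subsets m)) ↔ Fin (length (subsets n))
vertices {m} {n} π = mk↔ₛ′ (code ∘ relabel π ∘ nth {m}) (code ∘ relabel (↔-sym π) ∘ nth {n})
  (λ j → trans (cong (code ∘ relabel π) (nth-code (relabel (↔-sym π) (nth {n} j))))
    (trans (cong code (relabel-inverse (↔-sym π) (nth {n} j))) (code-nth {n} j)))
  (λ i → trans (cong (code ∘ relabel (↔-sym π)) (nth-code (relabel π (nth {m} i))))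
    (trans (cong code (relabel-inverse π (nth {m} i))) (code-nth {m} i)))

nth-vertices : (π : Fin m ↔ Fin n) (j : Fin (length (subsets n))) →
               relabel π (nth {m} (Inverse.from (vertices π) j)) ≡ nth {n} j
nth-vertices {m} {n} π j = trans (cong (relabel π) (nth-code (relabel (↔-sym π) (nth {n} j))))
  (relabel-inverse (↔-sym π) (nth {n} j))

≅-sym : ∀ {E E′} {M : Matroid E} {N : Matroid E′} → M ≅ N → N ≅ M
≅-sym {M = M} {N} iso = record
  { bijection = ↔-sym bijection
  ; bases = λ B → mk⇔
      (λ basis → Equivalence.from (bases (relabel (↔-sym bijection) B))
        (subst (Matroid.IsBasis N) (sym (relabel-inverse (↔-sym bijection) B)) basis))
      (λ basis → subst (Matroid.IsBasis N) (relabel-inverse (↔-sym bijection) B)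
        (Equivalence.to (bases (relabel (↔-sym bijection) B)) basis))
  }
  where open _≅_ iso

module _ {E E′ : GroundSet} {M : Matroid E} {N : Matroid E′} (iso : M ≅ N) where
  open _≅_ iso renaming (bijection to π)

  relabel-independent : ∀ {I} → Independent M I → Independent N (relabel π I)
  relabel-independent (B , basis , I⊆B) = relabel π B , Equivalence.to (bases B) basis , relabel-mono π I⊆B

  rank-relabel-≥ : ∀ S → rank M S ℕ.≤ rank N (relabel π S)
  rank-relabel-≥ S with rank-witness M S
  ... | I , ind , I⊆S , e = subst (ℕ._≤ rank N (relabel π S)) (trans (∣relabel∣ π I) e)
    (∣independent∣≤rank N (relabel-independent ind) (relabel-mono π I⊆S))

module _ {E E′ : GroundSet} {M : Matroid E} {N : Matroid E′} (iso : M ≅ N) where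
  open _≅_ iso renaming (bijection to π)
  open Inverse π using (from; strictlyInverseˡ)

  rank-relabel : ∀ S → rank N (relabel π S) ≡ rank M S
  rank-relabel S = ℕ.≤-antisym
    (subst (λ T → rank N (relabel π S) ℕ.≤ rank M T) (relabel-inverse π S) (rank-relabel-≥ (≅-sym iso) (relabel π S)))
    (rank-relabel-≥ iso S)

  relabel-flat : ∀ {S} → Flat M S → Flat N (relabel π S)
  relabel-flat {S} flat e e∉ = ℕ.≤-<-trans (ℕ.≤-reflexive (rank-relabel S))
    (ℕ.<-≤-trans (flat (from e) (e∉ ∘ ∈-relabel⁺ π))
      (ℕ.≤-trans (ℕ.≤-reflexive (sym (rank-relabel (S ∪ ⁅ from e ⁆)))) (rank-mono N sub)))
    where
    sub : relabel π (S ∪ ⁅ from e ⁆) ⊆ relabel π S ∪ ⁅ e ⁆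
    sub {x} x∈ with x∈p∪q⁻ S ⁅ from e ⁆ (∈-relabel⁻ π x∈)
    ... | inj₁ x∈S = ⊆-insert (relabel π S) e (∈-relabel⁺ π x∈S)
    ... | inj₂ x∈e rewrite trans (sym (strictlyInverseˡ x)) (trans (cong (Inverse.to π) (x∈⁅y⁆⇒x≡y (from e) x∈e)) (strictlyInverseˡ e)) =
      ∈-insert (relabel π S) e

  relabel-properFlat : ∀ {S} → ProperFlat M S → ProperFlat N (relabel π S)
  relabel-properFlat (flat , S≢⊥ , S≢⊤) = relabel-flat flat
    , (λ e → S≢⊥ (relabel-injective π (trans e (sym (relabel-⊥ π)))))
    , (λ e → S≢⊤ (relabel-injective π (trans e (sym (relabel-⊤ π)))))

  relabel-loopless : Loopless M → Loopless N
  relabel-loopless loopless e loop = loopless (from e) λ ind → loop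
    (independent-⊆ N (λ x → subst (_∈ relabel π ⁅ from e ⁆) (sym (x∈⁅y⁆⇒x≡y e x)) (∈-relabel⁺ π (x∈⁅x⁆ (from e))))
      (relabel-independent iso ind))

  relabel-flag : ∀ r F → FlagOf M r F → FlagOf N r (relabel (vertices π) F)
  relabel-flag r F ((proper , chain) , loopless , rank≡) =
      ( (λ j j∈ → subst (ProperFlat N) (nth-vertices π j) (relabel-properFlat (proper _ (∈-relabel⁻ (vertices π) j∈))))
      , (λ i i∈ j j∈ → subst₂ (λ S T → S ⊆ T ⊎ T ⊆ S) (nth-vertices π i) (nth-vertices π j)
          (Sum.map (relabel-mono π) (relabel-mono π)
            (chain _ (∈-relabel⁻ (vertices π) i∈) _ (∈-relabel⁻ (vertices π) j∈)))))
    , relabel-loopless loopless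
    , trans (sym (cong (rank N) (relabel-⊤ π))) (trans (rank-relabel ⊤) rank≡)

relabel-flag⁻ : ∀ {E E′} {M : Matroid E} {N : Matroid E′} (iso : M ≅ N) r F →
                FlagOf N r (relabel (vertices (_≅_.bijection iso)) F) → FlagOf M r F
relabel-flag⁻ {M = M} iso r F flag = subst (FlagOf M r)
  (relabel-inverse (vertices (_≅_.bijection iso)) F)
  (relabel-flag (≅-sym iso) r (relabel (vertices (_≅_.bijection iso)) F) flag)

-- In the expansion by `coeff-chainPolynomial`, relabelling permutes the summation over `F` for each
-- rank and preserves both the size of `F` and the property of being a flag.
chainPolynomial-invariant : IsInvariant ℤ[t]-abelianGroup chainPolynomial
chainPolynomial-invariant {E} {E′} M N iso = coeffwise λ k → trans (coeff-chainPolynomial M k)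
  (trans (rows (size E) k) (trans (columns (↔⇒≡ π) λ r → ∑list Fs′ (λ F → entry N k r F)) (sym (coeff-chainPolynomial N k))))
  where
  open _≅_ iso renaming (bijection to π)
  Fs  = subsets (length (subsets (size E)))
  Fs′ = subsets (length (subsets (size E′)))
  σ = vertices π

  entry : ∀ {E} (M : Matroid E) → ℕ → ℕ → Subset (length (subsets (size E))) → ℤ
  entry M k r F = 𝟙 ((∣ F ∣ ℕ.+ k ℕ.≟ r) ×-dec flagOf? M r F)

  entry-relabel : ∀ k r F → entry M k r F ≡ entry N k r (relabel σ F)
  entry-relabel k r F = 𝟙-cong ((∣ F ∣ ℕ.+ k ℕ.≟ r) ×-dec flagOf? M r F)
    ((∣ relabel σ F ∣ ℕ.+ k ℕ.≟ r) ×-dec flagOf? N r (relabel σ F))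
    (λ (e , flag) → trans (cong (ℕ._+ k) (∣relabel∣ σ F)) e , relabel-flag iso r F flag)
    (λ (e , flag) → trans (cong (ℕ._+ k) (sym (∣relabel∣ σ F))) e , relabel-flag⁻ iso r F flag)

  row : ∀ k r → ∑list Fs (entry M k r) ≡ ∑list Fs′ (entry N k r)
  row k r = trans (∑list-cong Fs (entry-relabel k r))
    (trans (sym (∑list-map (relabel σ) Fs (entry N k r))) (∑list-↭ (relabel-subsets σ) (entry N k r)))

  rows : ∀ n k → sumℤ {n} (λ r → ∑list Fs (entry M k (toℕ r))) ≡ sumℤ {n} (λ r → ∑list Fs′ (entry N k (toℕ r)))
  rows n k = Σℤ.sum-cong-≗ {n = n} λ r → row k (toℕ r)

  -- The outer sums range over `size E` and `size E′` ranks, which the bijection shows to be equal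
  -- numbers.
  columns : ∀ {m n} → m ≡ n → (f : ℕ → ℤ) → sumℤ {m} (f ∘ toℕ) ≡ sumℤ {n} (f ∘ toℕ)
  columns refl f = refl

corollary8p8 : IsValuativeInvariant ℤ[t]-abelianGroup chainPolynomial
corollary8p8 = chainPolynomial-valuation , λ {E} {E′} → chainPolynomial-invariant {E} {E′}
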